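{- Let $w\in S_\infty$ and let $\varphi$ be a flag. The weak Edelman–Greene insertion map $\rho^{(\bullet)}\mapsto(\hat P(\rho^{(\bullet)}),\hat Q(\rho^{(\bullet)}))$ is a bijection $$\mathrm{RFC}(w,\varphi)\longrightarrow\bigsqcup_\alpha\big(\mathrm{YR}_\alpha(w)\times\mathrm{SSKT}(\alpha,\varphi)\big),$$ where $\alpha$ ranges over all weak compositions such that $\mathrm{YR}_\alpha(w)$ is nonempty.
   Context: $S_\infty$: permutations of $\mathbb{Z}_{>0}$ fixing all but finitely many points; $s_i$ swaps $i,i+1$; $i_1\cdots i_m$ is a reduced word for $w$ if $w=s_{i_1}\cdots s_{i_m}$ with $m$ minimal. An increasing factorization $\rho^{(\bullet)}=(\rho^{(k)}|\cdots|\rho^{(1)})$ of $\rho$ writes $\rho=\rho^{(k)}\cdots\rho^{(1)}$ with consecutive, possibly empty, strictly increasing subwords. A flag is a weakly increasing $\varphi:\mathbb{Z}_{>0}\to\mathbb{Z}_{>0}$ with $\varphi(m)\ge m$. $\rho^{(\bullet)}$ is $\varphi$-flagged if $\varphi(\rho^{(i)}_1)\ge i$ whenever $\rho^{(i)}$ is nonempty ($\rho^{(i)}_1$ its first letter). $\mathrm{RFC}(w,\varphi)$ is the set of $\varphi$-flagged increasing factorizations of reduced words for $w$ (factorizations differing only by empty components at the left end identified). Coxeter–Knuth equivalence $\sim$: transitive closure of $\mathbf a xyz\mathbf b\sim\mathbf a xzy\mathbf b$ ($y<x<z$), $\mathbf a xyz\mathbf b\sim\mathbf a yxz\mathbf b$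 ($y<z<x$), $\mathbf a\, i(i+1)i\,\mathbf b\sim\mathbf a\,(i+1)i(i+1)\,\mathbf b$. Tableaux are fillings by positive integers of finite sets of boxes (row $r\in\mathbb{Z}$, column $c\in\mathbb{Z}_{>0}$), rows left-justified, rows indexed upward; the shape (when all rows have positive index) is the weak composition of row lengths; $T_{rc}$ denotes an entry. Weak descent tableau $\mathsf{WeakDesTab}(\rho)$: with run factorization (maximal strictly increasing runs) $(\sigma^{(k)}|\cdots|\sigma^{(1)})$, place $\sigma^{(k)}$ in row $\sigma^{(k)}_1$; for $i=k-1,\dots,1$ place $\sigma^{(i)}$ in row $\sigma^{(i)}_1$ if that is below the row of $\sigma^{(i+1)}$, else directly below the row of $\sigma^{(i+1)}$. Virtual: uses a non-positive row; else $\mathrm{des}(\rho)$ is its shape. $\mu\le\nu$ iff $\sum_{i\le k}\mu_i\le\sum_{i\le k}\nu_i$ for all $k$; for non-virtual reduced words $\rho\le\tau$ iff $\rho\sim\tau$ and $\mathrm{des}(\rho)\le\mathrm{des}(\tau)$; each $\sim$-class has a unique non-virtual $\le$-minimal element, called Yamanouchi. $\hat P(\rho^{(\bullet)})=\hat P(\rho):=\mathsf{WeakDesTab}(\hat\rho)$ for the Yamanouchi word $\hat\rho\sim\rho$. $\mathrm{YR}_\alpha(w)$ is the set of Yamanouchi reduced words $\sigma$ for $w$ with $\mathrm{des}(\sigma)=\alpha$; a Yamanouchi word is identified with its weak descent tableau (so $\hat P(\rho^{(\bullet)})$ is regarded as an element of $\mathrm{YR}_{\alpha}(w)$). It is known that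 if $\sigma x$ is reduced then the diagram of $\hat P(\sigma x)$ is that of $\hat P(\sigma)$ plus one box. $\hat Q(\rho^{(\bullet)})$ is the filling of the diagram of $\hat P(\rho)$ in which a box has entry $i$ iff it lies in the diagram of $\hat P(\rho^{(k)}\cdots\rho^{(i)})$ but not in that of $\hat P(\rho^{(k)}\cdots\rho^{(i+1)})$. A key tableau is a tableau $T$ such that (a) rows weakly decrease left to right; (b) columns have distinct entries; (c) if $T$ contains $(i,j),(k,j)$ with $i<k$ and $T_{ij}>T_{kj}$, then $T$ contains $(i,j+1)$ and $T_{i,j+1}>T_{kj}$. It is $\varphi$-flagged if $T_{ij}\le\varphi(i)$ for all its boxes. $\mathrm{SSKT}(\alpha,\varphi)$ is the set of $\varphi$-flagged key tableaux of shape $\alpha$ (all rows of positive index). -}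

module Defs where

open import Data.Nat using (ℕ; zero; suc; _≤_; _<_; _∸_; _⊓_; _≡ᵇ_; _≤ᵇ_)
open import Data.Bool using (if_then_else_)
open import Data.List using (List; []; _∷_; _++_; [_]; concat; reverse; drop; take; length; applyUpTo)
open import Data.Nat.ListAction using (sum)
import Data.List as L
open import Data.Maybe using (Maybe; just; nothing; _>>=_; Is-just)
import Data.Maybe as M
open import Data.Product using (Σ; _×_; _,_; ∃)
open import Data.Empty using (⊥)
open import Relation.Nullary using (¬_)
open import Relation.Binary.PropositionalEquality using (_≡_)
open import Data.List.Relation.Unary.All using (All)
open import Data.List.Relation.Unary.Linked using (Linked)
open import Relation.Binary.Construct.Closure.Equivalence using (EqClosure)
open import Function.Bundles using (_⇔_)

nth : {A : Set} → List A → ℕ → Maybe A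
nth []       _       = nothing
nth (x ∷ _)  zero    = just x
nth (_ ∷ xs) (suc n) = nth xs n

Pos : ℕ → Set
Pos n = 1 ≤ n

-- S_∞ and reduced words.  Letters i ≥ 1 stand for s_i (swap i, i+1),
-- acting on ℕ (the point 0 is never moved by positive letters).

swap : ℕ → ℕ → ℕ
swap i x = if x ≡ᵇ i then suc i else (if x ≡ᵇ suc i then i else x)

act : List ℕ → ℕ → ℕ
act []      x = x
act (i ∷ ρ) x = swap i (act ρ x)

SamePerm : List ℕ → List ℕ → Set
SamePerm ρ τ = ∀ x → act ρ x ≡ act τ x

Word : List ℕ → Set
Word = All Pos

-- ρ is a reduced word for the permutation w represented by the word u
Reduced : (u ρ : List ℕ) → Set
Reduced u ρ = Word ρ × SamePerm ρ u
  × (∀ τ → Word τ → SamePerm τ u → length ρ ≤ length τ)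

Flag : (ℕ → ℕ) → Set
Flag φ = (∀ m n → 1 ≤ m → m ≤ n → φ m ≤ φ n) × (∀ m → 1 ≤ m → m ≤ φ m)

-- Increasing factorizations.
-- A factorization (ρ^(k) | ⋯ | ρ^(1)) is the list  fs = ρ^(1) ∷ ⋯ ∷ ρ^(k) ∷ []
-- (so nth fs j = ρ^(j+1)); the word is ρ^(k) ⋯ ρ^(1) = concat (reverse fs).
-- Identification of empty components at the left end (high indices) is
-- realised by the canonical representative with no trailing empty component.

Increasing : List ℕ → Set
Increasing = Linked _<_

factWord : List (List ℕ) → List ℕ
factWord fs = concat (reverse fs)

NoTrailingEmpty : List (List ℕ) → Set
NoTrailingEmpty fs = ¬ (Σ (List (List ℕ)) λ ys → fs ≡ ys ++ [ [] ])

Flagged : (ℕ → ℕ) → List (List ℕ) → Set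
Flagged φ fs = ∀ j x xs → nth fs j ≡ just (x ∷ xs) → suc j ≤ φ x

RFC : (u : List ℕ) (φ : ℕ → ℕ) → List (List ℕ) → Set
RFC u φ fs = All Increasing fs × Reduced u (factWord fs) × Flagged φ fs
  × NoTrailingEmpty fs

data CKstep : List ℕ → List ℕ → Set where
  ck₁ : ∀ a b x y z → y < x → x < z →
        CKstep (a ++ x ∷ y ∷ z ∷ b) (a ++ x ∷ z ∷ y ∷ b)
  ck₂ : ∀ a b x y z → y < z → z < x →
        CKstep (a ++ x ∷ y ∷ z ∷ b) (a ++ y ∷ x ∷ z ∷ b)
  braid : ∀ a b i →
        CKstep (a ++ i ∷ suc i ∷ i ∷ b) (a ++ suc i ∷ i ∷ suc i ∷ b)

_∼_ : List ℕ → List ℕ → Set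
_∼_ = EqClosure CKstep

-- Weak descent tableau.
-- runs ρ : maximal strictly increasing runs, left to right (σ^(k), …, σ^(1)).

runs : List ℕ → List (List ℕ)
runs [] = []
runs (x ∷ xs) with runs xs
... | [] = [ x ∷ [] ]
... | [] ∷ rs = (x ∷ []) ∷ [] ∷ rs
... | (y ∷ r) ∷ rs = if suc x ≤ᵇ y then (x ∷ y ∷ r) ∷ rs
                     else (x ∷ []) ∷ (y ∷ r) ∷ rs

headℕ : List ℕ → ℕ
headℕ []      = 0
headℕ (x ∷ _) = x

-- Place runs σ^(i) (left to right) in rows: row of σ^(i) is
-- min(σ^(i)_1, row(σ^(i+1)) - 1).  Rows are computed in ℕ; a row value
-- that would be ≤ 0 (virtual tableau) makes the result 'nothing'.
placeRows : ℕ → List (List ℕ) → Maybe (List (ℕ × List ℕ))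
placeRows p [] = just []
placeRows p (r ∷ rs) with headℕ r ⊓ (p ∸ 1)
... | zero  = nothing
... | suc q = M.map ((suc q , r) ∷_) (placeRows (suc q) rs)

-- the first run goes to row σ^(k)_1 = min(σ^(k)_1, (σ^(k)_1 + 1) - 1)
wdtRows : List ℕ → Maybe (List (ℕ × List ℕ))
wdtRows ρ with runs ρ
... | []     = just []
... | r ∷ rs = placeRows (suc (headℕ r)) (r ∷ rs)

rowAt : ℕ → List (ℕ × List ℕ) → List ℕ
rowAt j [] = []
rowAt j ((q , r) ∷ rest) = if q ≡ᵇ j then r else rowAt j rest

-- rows listed bottom (row 1) to top (the highest, nonempty, row)
toRowList : List (ℕ × List ℕ) → List (List ℕ)
toRowList [] = []
toRowList ((m , r) ∷ rest) = applyUpTo (λ i → rowAt (suc i) ((m , r) ∷ rest)) m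

weakDesTab : List ℕ → Maybe (List (List ℕ))
weakDesTab ρ = M.map toRowList (wdtRows ρ)

NonVirtual : List ℕ → Set
NonVirtual ρ = Is-just (weakDesTab ρ)

-- weak compositions are lists of naturals, α_r = nth α (r-1), with
-- trailing zeros omitted (des never produces trailing zeros)
des : List ℕ → Maybe (List ℕ)
des ρ = M.map (L.map length) (weakDesTab ρ)

HasDes : List ℕ → List ℕ → Set
HasDes ρ α = des ρ ≡ just α

_⊴_ : List ℕ → List ℕ → Set
μ ⊴ ν = ∀ k → sum (take k μ) ≤ sum (take k ν)

_≼_ : List ℕ → List ℕ → Set
ρ ≼ τ = ρ ∼ τ × Σ (List ℕ) λ μ → Σ (List ℕ) λ ν → HasDes ρ μ × HasDes τ ν × μ ⊴ ν

Yamanouchi : List ℕ → Set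
Yamanouchi σ = NonVirtual σ × (∀ τ → τ ≼ σ → σ ≼ τ)

YR : (u α σ : List ℕ) → Set
YR u α σ = Reduced u σ × Yamanouchi σ × HasDes σ α

-- Tableaux with all rows positive: list of rows, row r = nth T (r-1),
-- entry in column c = position c-1 in that row.

entry : List (List ℕ) → ℕ → ℕ → Maybe ℕ
entry T zero    _       = nothing
entry T (suc r) zero    = nothing
entry T (suc r) (suc c) = nth T r >>= λ row → nth row c

shape : List (List ℕ) → List ℕ
shape = L.map length

rowLen : List ℕ → ℕ → ℕ
rowLen α zero    = 0
rowLen α (suc r) = M.fromMaybe 0 (nth α r)

InShape : List ℕ → ℕ → ℕ → Set
InShape α r c = 1 ≤ c × c ≤ rowLen α r

KeyTableau : List (List ℕ) → Set
KeyTableau T =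
  (∀ r c x y → entry T r c ≡ just x → entry T r (suc c) ≡ just y → y ≤ x)
  × (∀ i k j x → i < k → entry T i j ≡ just x → entry T k j ≡ just x → ⊥)
  × (∀ i k j x y → i < k → entry T i j ≡ just x → entry T k j ≡ just y → y < x →
       Σ ℕ λ z → entry T i (suc j) ≡ just z × y < z)

PositiveEntries : List (List ℕ) → Set
PositiveEntries T = ∀ r c x → entry T r c ≡ just x → 1 ≤ x

FlaggedTab : (ℕ → ℕ) → List (List ℕ) → Set
FlaggedTab φ T = ∀ r c x → entry T r c ≡ just x → x ≤ φ r

SSKT : (α : List ℕ) (φ : ℕ → ℕ) → List (List ℕ) → Set
SSKT α φ T = shape T ≡ α × PositiveEntries T × KeyTableau T × FlaggedTab φ T

prefixWord : List (List ℕ) → ℕ → List ℕ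
prefixWord fs j = factWord (drop j fs)

InDiagP : List ℕ → ℕ → ℕ → Set
InDiagP x r c = Σ (List ℕ) λ σ → Σ (List ℕ) λ α →
  σ ∼ x × Yamanouchi σ × HasDes σ α × InShape α r c

IsQhat : List (List ℕ) → List ℕ → List (List ℕ) → Set
IsQhat fs α Q = shape Q ≡ α ×
  (∀ r c x → entry Q r c ≡ just x → ∀ j →
     (x ≡ suc j) ⇔ (InDiagP (prefixWord fs j) r c × ¬ InDiagP (prefixWord fs (suc j)) r c))

WeakEG : List (List ℕ) → List ℕ × List ℕ × List (List ℕ) → Set
WeakEG fs (α , σ , Q) = σ ∼ factWord fs × Yamanouchi σ × HasDes σ α × IsQhat fs α Q

Target : (u : List ℕ) (φ : ℕ → ℕ) → List ℕ × List ℕ × List (List ℕ) → Set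
Target u φ (α , σ , Q) = YR u α σ × SSKT α φ Q

IsBijectionGraph : {A B : Set} → (A → Set) → (B → Set) → (A → B → Set) → Set
IsBijectionGraph {A} {B} PA PB R =
  (∀ a → PA a → Σ B λ b → PB b × R a b × (∀ b' → PB b' → R a b' → b' ≡ b))
  × (∀ b → PB b → Σ A λ a → PA a × R a b × (∀ a' → PA a' → R a' b → a' ≡ a))

{-# OPTIONS --safe #-}

-- A letter x that enters a decreasing word B (a column) from the right is either
-- absorbed or pushes out a letter to the left: B x ∼ y C.  Letting a word ρ pass
-- through the empty column gives ρ ∼ e A with a column A and a shorter word e;
-- A and the class of e depend only on the class of ρ, and descents of ρ persist
-- in e.  The step (B , x) ↦ (y , C) is injective, so e A can be unwound to D w with
-- a column D as long as A.  Iterating ρ ↦ e yields nested columns D ⊇ D′ ⊇ ⋯ , the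
-- left key of the class; let ht ρ i be the number of them that contain i.
--
-- Appending x to ρ adds one box to the diagram ht ρ, namely an element k to the
-- column j in which x is absorbed.  All elements of that column below k already lie
-- in the next one, so k is the lowest row of length j in the new diagram.  Hence j
-- determines the row, and j together with the class of ρ x determines x and the
-- class of ρ.  As x < y holds for consecutive letters iff their columns increase,
-- increasing factorizations of words in a class correspond to key tableaux whose
-- shape is given by ht.  The least letter of ρ is the lowest nonempty row of ht ρ,
-- which matches the two flag conditions.
--
-- Rows of a weak descent tableau form a factorization flagged by the identity.
-- Its key tableau T satisfies T_{ij} ≤ i, so des ρ dominates the shape, with equality
-- only for the tableau T_{ij} = i; its word is thus the unique Yamanouchi word of
-- the class, and ht is the diagram of the weak insertion tableau.

module Submission where

open import Defs
open import Data.Bool using (true; false; T)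
open import Data.Empty using (⊥; ⊥-elim)
import Data.List as L
open import Data.List using (List; []; _∷_; _++_; [_]; _∷ʳ_; length; concat; reverse; take; applyUpTo; initLast; _∷ʳ′_)
open import Data.List.Membership.Propositional using (_∈_; _∉_)
open import Data.List.Membership.Propositional.Properties using (∈-++⁺ˡ; ∈-++⁺ʳ; ∈-++⁻; ∈-concat⁺′)
open import Data.List.Properties using (length-++; ++-assoc; ++-identityʳ; ++-conicalˡ; ++-conicalʳ; ∷-injectiveˡ; ∷-injectiveʳ; ∷ʳ-injective; unfold-reverse; reverse-++; concat-++; map-++; drop-[]; applyUpTo-∷ʳ; length-applyUpTo)
open import Data.List.Relation.Binary.Subset.Propositional using (_⊆_)
open import Data.List.Relation.Unary.All as All using (All; []; _∷_)
open import Data.List.Relation.Unary.All.Properties as AllP using (++⁺; ++⁻)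
open import Data.List.Relation.Unary.AllPairs using (AllPairs; []; _∷_)
open import Data.List.Relation.Unary.Any using (here; there)
open import Data.List.Relation.Unary.Linked as Linked using ([]; [-]; _∷_)
open import Data.List.Reverse using (Reverse; []; _∶_∶ʳ_; reverseView)
import Data.Maybe as M
open import Data.Maybe using (Maybe; just; nothing; Is-just; fromMaybe)
import Data.Maybe.Relation.Unary.Any as MAny
open import Data.Nat
open import Data.Nat.ListAction using (sum)
open import Data.Nat.Properties
open import Data.List.Membership.DecPropositional _≟_ using (_∈?_)
open import Data.Product using (Σ; _×_; _,_; proj₁; proj₂)
open import Data.Sum using (_⊎_; inj₁; inj₂)
open import Data.Unit using (⊤; tt)
open import Function using (_∘_; id)
open import Function.Bundles using (mk⇔; Equivalence)
open import Relation.Binary using (tri<; tri≈; tri>)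
import Relation.Binary.Construct.Closure.Equivalence as Eq
open import Relation.Binary.Construct.Closure.ReflexiveTransitive using (ε; _◅_; _◅◅_)
open import Relation.Binary.Construct.Closure.Symmetric using (fwd; bwd)
open import Relation.Binary.PropositionalEquality using (_≡_; _≢_; refl; sym; trans; cong; cong₂; subst; subst₂; ≢-sym; module ≡-Reasoning)
open import Relation.Nullary using (¬_; yes; no)

-- Defined as a minimum over a class, the weak insertion tableau does not show where an appended
-- letter puts its box. Insertion into columns (the Edelman-Greene rule with the order of the
-- letters reversed) yields only the column of that box, and the columns `A` it leaves need not be
-- nested, so they show no rows: the word 13 leaves the column 3, then the column 1. Moving each
-- column to the left end of the word repairs this: the columns `D` are nested, and an element of
-- `D` can serve as a row index. Both the nesting and the place of the new element are proved by
-- inserting one word from the left into two columns at once, one inside the other. Hence the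
-- diagram is first defined as `ht`, for every reduced word, and recognised as that of the weak
-- insertion tableau only when the correspondence with chains of diagrams is available. Existence
-- and uniqueness of the Yamanouchi word and growth by one box are then results, not assumptions.
-- Passing through a column is a partial operation; its undefined case is the cancellation of two
-- equal letters, which is why reducedness accompanies every step.

private
  variable
    a b c h i j k k′ x x′ y y′ z : ℕ
    ρ τ σ v w e f A A′ B B′ B⁰ C C′ C⁰ D D′ : List ℕ
    Ds Ds′ Es : List (List ℕ)
    m m′ m₁ m₂ m₃ n₁ n₂ n₃ : Maybe ℕ
    P : ℕ → Set

-- Reduced words

≡ᵇ-refl : ∀ n → (n ≡ᵇ n) ≡ true
≡ᵇ-refl zero    = refl
≡ᵇ-refl (suc n) = ≡ᵇ-refl n

≡ᵇ-≢ : ∀ m n → m ≢ n → (m ≡ᵇ n) ≡ false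
≡ᵇ-≢ zero    zero    p = ⊥-elim (p refl)
≡ᵇ-≢ zero    (suc n) p = refl
≡ᵇ-≢ (suc m) zero    p = refl
≡ᵇ-≢ (suc m) (suc n) p = ≡ᵇ-≢ m n (p ∘ cong suc)

swap-left : ∀ i → swap i i ≡ suc i
swap-left i rewrite ≡ᵇ-refl i = refl

swap-right : ∀ i → swap i (suc i) ≡ i
swap-right i rewrite ≡ᵇ-≢ (suc i) i 1+n≢n | ≡ᵇ-refl i = refl

swap-fixed : ∀ i x → x ≢ i → x ≢ suc i → swap i x ≡ x
swap-fixed i x p q rewrite ≡ᵇ-≢ x i p | ≡ᵇ-≢ x (suc i) q = refl

data SwapView (i x : ℕ) : Set where
  left  : x ≡ i → SwapView i x
  right : x ≡ suc i → SwapView i x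
  fixed : x ≢ i → x ≢ suc i → SwapView i x

swapView : ∀ i x → SwapView i x
swapView i x with x ≟ i | x ≟ suc i
... | yes p | _     = left p
... | no _  | yes q = right q
... | no p  | no q  = fixed p q

swap-involutive : ∀ i x → swap i (swap i x) ≡ x
swap-involutive i x with swapView i x
... | left refl  rewrite swap-left i  = swap-right i
... | right refl rewrite swap-right i = swap-left i
... | fixed p q  rewrite swap-fixed i x p q = swap-fixed i x p q

swap-comm : ∀ i j x → suc i < j → swap i (swap j x) ≡ swap j (swap i x)
swap-comm i j x i<j with swapView i x | swapView j x
... | left refl | left refl   = ⊥-elim (<-irrefl refl (<-trans (n<1+n _) i<j))
... | left refl | right refl  = ⊥-elim (<-irrefl refl (<-trans (n<1+n _) (<-trans (n<1+n _) i<j)))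
... | left refl | fixed p q
  rewrite swap-fixed j x p q | swap-left i =
  sym (swap-fixed j (suc i) (<⇒≢ i<j) (<⇒≢ (<-trans i<j (n<1+n _))))
... | right refl | left refl  = ⊥-elim (<-irrefl refl i<j)
... | right refl | right refl = ⊥-elim (<-irrefl refl (<-trans (n<1+n _) i<j))
... | right refl | fixed p q
  rewrite swap-fixed j x p q | swap-right i =
  sym (swap-fixed j i (<⇒≢ (<-trans (n<1+n _) i<j)) (<⇒≢ (<-trans (n<1+n _) (<-trans i<j (n<1+n _)))))
... | fixed p q | left refl
  rewrite swap-fixed i j p q | swap-left j =
  swap-fixed i (suc j) (>⇒≢ (<-trans (n<1+n _) (<-trans i<j (n<1+n _)))) (>⇒≢ (<-trans i<j (n<1+n _)))
... | fixed p q | right refl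
  rewrite swap-fixed i (suc j) p q | swap-right j =
  swap-fixed i j (>⇒≢ (<-trans (n<1+n _) i<j)) (>⇒≢ i<j)
... | fixed p q | fixed p′ q′
  rewrite swap-fixed i x p q | swap-fixed j x p′ q′ = swap-fixed i x p q

swap-braid : ∀ i x → swap i (swap (suc i) (swap i x)) ≡ swap (suc i) (swap i (swap (suc i) x))
swap-braid i x with swapView i x
... | left refl
  rewrite swap-left i | swap-left (suc i)
        | swap-fixed (suc i) i (<⇒≢ (n<1+n i)) (<⇒≢ (<-trans (n<1+n i) (n<1+n _)))
        | swap-left i | swap-left (suc i) =
  swap-fixed i (2 + i) (>⇒≢ (<-trans (n<1+n i) (n<1+n _))) 1+n≢n
... | right refl
  rewrite swap-right i | swap-left (suc i)
        | swap-fixed (suc i) i (<⇒≢ (n<1+n i)) (<⇒≢ (<-trans (n<1+n i) (n<1+n _)))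
        | swap-left i
        | swap-fixed i (2 + i) (>⇒≢ (<-trans (n<1+n i) (n<1+n _))) 1+n≢n =
  sym (swap-right (suc i))
... | fixed p q with x ≟ 2 + i
...   | yes refl
  rewrite swap-fixed i (2 + i) p q | swap-right (suc i) | swap-right i =
  sym (swap-fixed (suc i) i (<⇒≢ (n<1+n i)) (<⇒≢ (<-trans (n<1+n i) (n<1+n _))))
...   | no r
  rewrite swap-fixed i x p q | swap-fixed (suc i) x q r | swap-fixed i x p q =
  sym (swap-fixed (suc i) x q r)

act-++ : ∀ ρ τ x → act (ρ ++ τ) x ≡ act ρ (act τ x)
act-++ []      τ x = refl
act-++ (i ∷ ρ) τ x = cong (swap i) (act-++ ρ τ x)

samePerm-cong : ∀ α β → SamePerm ρ τ → SamePerm (α ++ ρ ++ β) (α ++ τ ++ β)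
samePerm-cong {ρ} {τ} α β p x = begin
  act (α ++ ρ ++ β) x        ≡⟨ act-++ α (ρ ++ β) x ⟩
  act α (act (ρ ++ β) x)     ≡⟨ cong (act α) (act-++ ρ β x) ⟩
  act α (act ρ (act β x))    ≡⟨ cong (act α) (p (act β x)) ⟩
  act α (act τ (act β x))    ≡⟨ cong (act α) (act-++ τ β x) ⟨
  act α (act (τ ++ β) x)     ≡⟨ act-++ α (τ ++ β) x ⟨
  act (α ++ τ ++ β) x        ∎
  where open ≡-Reasoning

Far : ℕ → ℕ → Set
Far x y = suc x < y ⊎ suc y < x

samePerm-far : Far x y → SamePerm (x ∷ y ∷ []) (y ∷ x ∷ [])
samePerm-far {x} {y} (inj₁ p) z = swap-comm x y z p
samePerm-far {x} {y} (inj₂ p) z = sym (swap-comm y x z p)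

CKstep⇒SamePerm : CKstep ρ τ → SamePerm ρ τ
CKstep⇒SamePerm (ck₁ α β x y z y<x x<z) = samePerm-cong {ρ = x ∷ y ∷ z ∷ []} {x ∷ z ∷ y ∷ []} α β
  λ t → cong (swap x) (samePerm-far (inj₁ (≤-<-trans y<x x<z)) t)
CKstep⇒SamePerm (ck₂ α β x y z y<z z<x) = samePerm-cong {ρ = x ∷ y ∷ []} {y ∷ x ∷ []} α (z ∷ β)
  (samePerm-far (inj₂ (≤-<-trans y<z z<x)))
CKstep⇒SamePerm (braid α β i) = samePerm-cong {ρ = i ∷ suc i ∷ i ∷ []} {suc i ∷ i ∷ suc i ∷ []} α β (swap-braid i)

∼⇒SamePerm : ρ ∼ τ → SamePerm ρ τ
∼⇒SamePerm ε            = λ _ → refl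
∼⇒SamePerm (fwd s ◅ ss) = λ t → trans (CKstep⇒SamePerm s t) (∼⇒SamePerm ss t)
∼⇒SamePerm (bwd s ◅ ss) = λ t → trans (sym (CKstep⇒SamePerm s t)) (∼⇒SamePerm ss t)

∼-sym : ρ ∼ τ → τ ∼ ρ
∼-sym = Eq.symmetric CKstep

∼-reflexive : ρ ≡ τ → ρ ∼ τ
∼-reflexive refl = ε

CKstep-cong : ∀ α β → CKstep ρ τ → CKstep (α ++ ρ ++ β) (α ++ τ ++ β)
CKstep-cong α β (ck₁ c d x y z p q)
  rewrite ++-assoc c (x ∷ y ∷ z ∷ d) β | ++-assoc c (x ∷ z ∷ y ∷ d) β
        | sym (++-assoc α c (x ∷ y ∷ z ∷ d ++ β)) | sym (++-assoc α c (x ∷ z ∷ y ∷ d ++ β)) =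
  ck₁ (α ++ c) (d ++ β) x y z p q
CKstep-cong α β (ck₂ c d x y z p q)
  rewrite ++-assoc c (x ∷ y ∷ z ∷ d) β | ++-assoc c (y ∷ x ∷ z ∷ d) β
        | sym (++-assoc α c (x ∷ y ∷ z ∷ d ++ β)) | sym (++-assoc α c (y ∷ x ∷ z ∷ d ++ β)) =
  ck₂ (α ++ c) (d ++ β) x y z p q
CKstep-cong α β (braid c d i)
  rewrite ++-assoc c (i ∷ suc i ∷ i ∷ d) β | ++-assoc c (suc i ∷ i ∷ suc i ∷ d) β
        | sym (++-assoc α c (i ∷ suc i ∷ i ∷ d ++ β)) | sym (++-assoc α c (suc i ∷ i ∷ suc i ∷ d ++ β)) =
  braid (α ++ c) (d ++ β) i

∼-cong : ∀ α β → ρ ∼ τ → (α ++ ρ ++ β) ∼ (α ++ τ ++ β)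
∼-cong α β = Eq.gmap (λ ρ → α ++ ρ ++ β) (CKstep-cong α β)

∼-congˡ : ∀ α → ρ ∼ τ → (α ++ ρ) ∼ (α ++ τ)
∼-congˡ {ρ} {τ} α p =
  subst₂ _∼_ (cong (α ++_) (++-identityʳ ρ)) (cong (α ++_) (++-identityʳ τ)) (∼-cong α [] p)

∼-congʳ : ∀ β → ρ ∼ τ → (ρ ++ β) ∼ (τ ++ β)
∼-congʳ β = ∼-cong [] β

CKstep-All : {P : ℕ → Set} → CKstep ρ τ → All P ρ → All P τ
CKstep-All (ck₁ α β x y z _ _) ps with ++⁻ α ps
... | qs , p ∷ q ∷ r ∷ rs = ++⁺ qs (p ∷ r ∷ q ∷ rs)
CKstep-All (ck₂ α β x y z _ _) ps with ++⁻ α ps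
... | qs , p ∷ q ∷ r ∷ rs = ++⁺ qs (q ∷ p ∷ r ∷ rs)
CKstep-All (braid α β i) ps with ++⁻ α ps
... | qs , p ∷ q ∷ r ∷ rs = ++⁺ qs (q ∷ p ∷ q ∷ rs)

CKstep-All⁻ : {P : ℕ → Set} → CKstep ρ τ → All P τ → All P ρ
CKstep-All⁻ (ck₁ α β x y z _ _) ps with ++⁻ α ps
... | qs , p ∷ r ∷ q ∷ rs = ++⁺ qs (p ∷ q ∷ r ∷ rs)
CKstep-All⁻ (ck₂ α β x y z _ _) ps with ++⁻ α ps
... | qs , q ∷ p ∷ r ∷ rs = ++⁺ qs (p ∷ q ∷ r ∷ rs)
CKstep-All⁻ (braid α β i) ps with ++⁻ α ps
... | qs , p ∷ q ∷ r ∷ rs = ++⁺ qs (q ∷ p ∷ q ∷ rs)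

∼-All : {P : ℕ → Set} → ρ ∼ τ → All P ρ → All P τ
∼-All ε            ps = ps
∼-All (fwd s ◅ ss) ps = ∼-All ss (CKstep-All s ps)
∼-All (bwd s ◅ ss) ps = ∼-All ss (CKstep-All⁻ s ps)

∼-∈ : ρ ∼ τ → x ∈ τ → x ∈ ρ
∼-∈ p = All.lookup (∼-All p (All.tabulate id))

CKstep-length : CKstep ρ τ → length ρ ≡ length τ
CKstep-length (ck₁ α β x y z _ _) = trans (length-++ α) (sym (length-++ α))
CKstep-length (ck₂ α β x y z _ _) = trans (length-++ α) (sym (length-++ α))
CKstep-length (braid α β i)       = trans (length-++ α) (sym (length-++ α))

∼-length : ρ ∼ τ → length ρ ≡ length τ
∼-length ε            = refl
∼-length (fwd s ◅ ss) = trans (CKstep-length s) (∼-length ss)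
∼-length (bwd s ◅ ss) = trans (sym (CKstep-length s)) (∼-length ss)

∼-[] : ρ ∼ [] → ρ ≡ []
∼-[] {[]}    _ = refl
∼-[] {_ ∷ _} p with ∼-length p
... | ()

-- Reducedness without a fixed permutation: prefixes, factors and emitted words represent other
-- permutations than the word they come from.
Red : List ℕ → Set
Red ρ = Word ρ × (∀ τ → Word τ → SamePerm τ ρ → length ρ ≤ length τ)

Reduced⇒Red : ∀ u → Reduced u ρ → Red ρ
Reduced⇒Red _ (wρ , ρ≈u , min) = wρ , λ τ wτ τ≈ρ → min τ wτ (λ t → trans (τ≈ρ t) (ρ≈u t))

Reduced-∼ : ∀ u → ρ ∼ τ → Reduced u ρ → Reduced u τ
Reduced-∼ _ p (wρ , ρ≈u , min) =
  ∼-All p wρ , (λ t → trans (∼⇒SamePerm (∼-sym p) t) (ρ≈u t)) ,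
  λ υ wυ υ≈u → subst (_≤ length υ) (∼-length p) (min υ wυ υ≈u)

Red-∼ : ρ ∼ τ → Red ρ → Red τ
Red-∼ p (wρ , min) =
  ∼-All p wρ , λ υ wυ υ≈τ →
    subst (_≤ length υ) (∼-length p) (min υ wυ (λ t → trans (υ≈τ t) (∼⇒SamePerm (∼-sym p) t)))

-- A shorter word for the factor would shorten the whole word.
Red-factor : ∀ α β → Red (α ++ ρ ++ β) → Red ρ
Red-factor {ρ} α β (w , min) = wρ , λ τ wτ τ≈ρ →
  +-cancelʳ-≤ (length β) _ _ (+-cancelˡ-≤ (length α) _ _ (begin
    length α + (length ρ + length β)  ≡⟨ len ρ ⟨
    length (α ++ ρ ++ β)              ≤⟨ min _ (++⁺ wα (++⁺ wτ wβ)) (samePerm-cong α β τ≈ρ) ⟩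
    length (α ++ τ ++ β)              ≡⟨ len τ ⟩
    length α + (length τ + length β)  ∎))
  where
  open ≤-Reasoning
  len : ∀ τ → length (α ++ τ ++ β) ≡ length α + (length τ + length β)
  len τ = trans (length-++ α) (cong (length α +_) (length-++ τ))
  wα = proj₁ (++⁻ α w)
  wρ = proj₁ (++⁻ ρ (proj₂ (++⁻ α w)))
  wβ = proj₂ (++⁻ ρ (proj₂ (++⁻ α w)))

Red-prefix : ∀ ρ β → Red (ρ ++ β) → Red ρ
Red-prefix ρ β = Red-factor [] β

Red-suffix : ∀ α → Red (α ++ ρ) → Red ρ
Red-suffix {ρ} α r = Red-factor α [] (subst (λ β → Red (α ++ β)) (sym (++-identityʳ ρ)) r)

-- x commutes with everything in between, so the two copies of x cancel.
¬Red-cancel : ∀ w {τ} → All (Far x) w → ¬ Red (x ∷ w ++ x ∷ τ)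
¬Red-cancel {x} w {τ} far (_ ∷ ws , min) = <⇒≱ shorter (min (w ++ τ) word same)
  where
  shift : ∀ w → All (Far x) w → SamePerm (x ∷ w) (w ++ [ x ])
  shift []      []       t = refl
  shift (y ∷ w) (f ∷ fs) t =
    trans (samePerm-far f (act w t)) (cong (swap y) (shift w fs t))
  word : Word (w ++ τ)
  word with ++⁻ w ws
  ... | p , _ ∷ q = ++⁺ p q
  same : SamePerm (w ++ τ) (x ∷ w ++ x ∷ τ)
  same t = begin
    act (w ++ τ) t                          ≡⟨ act-++ w τ t ⟩
    act w (act τ t)                         ≡⟨ swap-involutive x _ ⟨
    swap x (swap x (act w (act τ t)))       ≡⟨ cong (swap x) (shift w far (act τ t)) ⟩
    swap x (act (w ++ [ x ]) (act τ t))     ≡⟨ cong (swap x) (act-++ w [ x ] (act τ t)) ⟩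
    swap x (act w (swap x (act τ t)))       ≡⟨ cong (swap x) (act-++ w (x ∷ τ) t) ⟨
    act (x ∷ w ++ x ∷ τ) t                  ∎
    where open ≡-Reasoning
  shorter : length (w ++ τ) < length (x ∷ w ++ x ∷ τ)
  shorter = s≤s (subst₂ _≤_ (sym (length-++ w)) (sym (length-++ w)) (+-monoʳ-≤ (length w) (n≤1+n _)))

-- Columns and letters passing through them

Column : List ℕ → Set
Column = AllPairs _>_

-- Pass B x m C: the letter x enters the column B (a decreasing word) from the
-- right and leaves the column C behind; it is either absorbed (m = nothing)
-- or pushes out a letter m = just y to the left, so that B x ∼ y C.
data Pass : List ℕ → ℕ → Maybe ℕ → List ℕ → Set where
  absorb : Pass [] x nothing [ x ]
  bump   : b < x → Pass (b ∷ B) x (just b) (x ∷ B)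
  twist  : Pass (suc y ∷ y ∷ B) (suc y) (just y) (suc y ∷ y ∷ B)
  skip   : x < b → Pass B x m C → Pass (b ∷ B) x m (b ∷ C)

pass-skip⁻ : Pass (h ∷ B) x m C → x < h → Σ (List ℕ) λ C′ → C ≡ h ∷ C′ × Pass B x m C′
pass-skip⁻ (bump h<x)  x<h = ⊥-elim (<-asym h<x x<h)
pass-skip⁻ twist       x<h = ⊥-elim (<-irrefl refl x<h)
pass-skip⁻ (skip _ p)  _   = _ , refl , p

pass-bump⁻ : Pass (h ∷ B) x m C → h < x → m ≡ just h × C ≡ x ∷ B
pass-bump⁻ (bump _)     _   = refl , refl
pass-bump⁻ twist        h<x = ⊥-elim (<-irrefl refl h<x)
pass-bump⁻ (skip x<h _) h<x = ⊥-elim (<-asym h<x x<h)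

pass-twist⁻ : Pass (h ∷ B) h m C →
  Σ ℕ λ y → Σ (List ℕ) λ B′ → h ≡ suc y × B ≡ y ∷ B′ × m ≡ just y × C ≡ h ∷ B
pass-twist⁻ (bump h<h)   = ⊥-elim (<-irrefl refl h<h)
pass-twist⁻ twist        = _ , _ , refl , refl , refl , refl
pass-twist⁻ (skip h<h _) = ⊥-elim (<-irrefl refl h<h)

pass-functional : Pass B x m C → Pass B x m′ C′ → m ≡ m′ × C ≡ C′
pass-functional absorb       absorb     = refl , refl
pass-functional (bump b<x)   q with pass-bump⁻ q b<x
... | refl , refl = refl , refl
pass-functional twist        q with pass-twist⁻ q
... | _ , _ , refl , refl , refl , refl = refl , refl
pass-functional (skip x<h p) q with pass-skip⁻ q x<h
... | _ , refl , p′ with pass-functional p p′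
...   | refl , refl = refl , refl

pass-All : Pass B x m C → All P B → P x → All P C
pass-All absorb     ps       px = px ∷ []
pass-All (bump _)   (_ ∷ ps) px = px ∷ ps
pass-All twist      ps       px = ps
pass-All (skip _ p) (q ∷ ps) px = q ∷ pass-All p ps px

pass-Column : Pass B x m C → Column B → Column C
pass-Column absorb       _        = [] ∷ []
pass-Column (bump b<x)   (p ∷ ps) = All.map (λ q → <-trans q b<x) p ∷ ps
pass-Column twist        ps       = ps
pass-Column (skip x<h p) (q ∷ ps) = pass-All p q x<h ∷ pass-Column p ps

pass-absorb : Pass B x nothing C → C ≡ B ++ [ x ]
pass-absorb absorb     = refl
pass-absorb (skip _ p) = cong (_ ∷_) (pass-absorb p)

pass-emitted-∈ : Pass B x (just y) C → y ∈ B
pass-emitted-∈ (bump _)   = here refl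
pass-emitted-∈ twist      = there (here refl)
pass-emitted-∈ (skip _ p) = there (pass-emitted-∈ p)

pass-emitted-< : Pass B x (just y) C → y < x
pass-emitted-< (bump b<x) = b<x
pass-emitted-< twist      = n<1+n _
pass-emitted-< (skip _ p) = pass-emitted-< p

pass-head : Pass B x (just y) C → Σ ℕ λ h → Σ (List ℕ) λ C′ → C ≡ h ∷ C′ × y < h
pass-head (bump b<x)   = _ , _ , refl , b<x
pass-head twist        = _ , _ , refl , n<1+n _
pass-head (skip x<h p) = _ , _ , refl , <-trans (pass-emitted-< p) x<h

-- The second letter of the resulting column tells which rule was applied: it is below `y` or
-- missing for `bump`, equal to `y` for `twist`, above `y` for `skip`.
pass-injective : Column B → Column B′ → Pass B x (just y) C → Pass B′ x′ (just y) C → B ≡ B′ × x ≡ x′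
pass-injective _ _ (bump _) (bump _) = refl , refl
pass-injective ((p ∷ _) ∷ _) _ (bump _) twist = ⊥-elim (<-irrefl refl p)
pass-injective (p ∷ _) _ (bump _) (skip _ q) with pass-head q
... | _ , _ , refl , y<h = ⊥-elim (<-asym (All.head p) y<h)
pass-injective _ ((p ∷ _) ∷ _) twist (bump _) = ⊥-elim (<-irrefl refl p)
pass-injective _ _ twist twist = refl , refl
pass-injective _ _ twist (skip _ q) with pass-head q
... | _ , _ , refl , y<y = ⊥-elim (<-irrefl refl y<y)
pass-injective _ (p ∷ _) (skip _ q) (bump _) with pass-head q
... | _ , _ , refl , y<h = ⊥-elim (<-asym (All.head p) y<h)
pass-injective _ _ (skip _ q) twist with pass-head q
... | _ , _ , refl , y<y = ⊥-elim (<-irrefl refl y<y)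
pass-injective (_ ∷ d) (_ ∷ d′) (skip _ p) (skip _ q) with pass-injective d d′ p q
... | refl , refl = refl , refl

-- Once `x` has entered, it is a letter of `C` below `y`. So `y` pushes out some letter, and this
-- letter is at least `x`, while `x′ < x`.
ascent-emits : Pass B x m C → Pass C y m′ D → x < y → Σ ℕ λ y′ → m′ ≡ just y′ × (∀ {x′} → m ≡ just x′ → x′ < y′)
ascent-emits absorb q x<y with pass-bump⁻ q x<y
... | refl , refl = _ , refl , λ ()
ascent-emits (bump b<x) q x<y with pass-bump⁻ q x<y
... | refl , refl = _ , refl , λ { refl → b<x }
ascent-emits twist q x<y with pass-bump⁻ q x<y
... | refl , refl = _ , refl , λ { refl → n<1+n _ }
ascent-emits (skip x<h p) (bump _) x<y = _ , refl , λ { refl → <-trans (pass-emitted-< p) x<h }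
ascent-emits (skip x<h p) twist _ = _ , refl , λ { refl → <-≤-trans (pass-emitted-< p) (≤-pred x<h) }
ascent-emits (skip _ p) (skip _ q) x<y = ascent-emits p q x<y

descent-absorbs : Pass B x nothing C → Pass C y m D → y < x → m ≡ nothing
descent-absorbs absorb q y<x with pass-skip⁻ q y<x
... | _ , refl , absorb = refl
descent-absorbs (skip x<h p) q y<x with pass-skip⁻ q (<-trans y<x x<h)
... | _ , refl , q′ = descent-absorbs p q′ y<x

-- The smaller letter `y` passes over `x` and acts only on the part of the column behind it.
descent-emits : Column B → Pass B x (just x′) C → Pass C y (just y′) D → y < x → y′ < x′
descent-emits (d ∷ _) (bump _) q y<x with pass-skip⁻ q y<x
... | _ , refl , q′ = All.lookup d (pass-emitted-∈ q′)
descent-emits _ twist q y<x with pass-skip⁻ q y<x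
... | _ , refl , q′ = <-≤-trans (pass-emitted-< q′) (≤-pred y<x)
descent-emits (_ ∷ d) (skip x<h p) q y<x with pass-skip⁻ q (<-trans y<x x<h)
... | _ , refl , q′ = descent-emits d p q′ y<x

-- Invariance of passing under Coxeter-Knuth moves

-- The three kinds of moves are kept together because passing through a column can turn a Knuth move
-- into a braid move, and a braid move into a Knuth move.
data Triple : List ℕ → List ℕ → Set where
  ck₁   : y < x → x < z → Triple (x ∷ y ∷ z ∷ []) (x ∷ z ∷ y ∷ [])
  ck₂   : y < z → z < x → Triple (x ∷ y ∷ z ∷ []) (y ∷ x ∷ z ∷ [])
  braid : Triple (i ∷ suc i ∷ i ∷ []) (suc i ∷ i ∷ suc i ∷ [])

infixr 5 _⊕_
_⊕_ : Maybe ℕ → List ℕ → List ℕ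
nothing ⊕ w = w
just x  ⊕ w = x ∷ w

Related : List ℕ → List ℕ → Set
Related e f = e ≡ f ⊎ Triple e f ⊎ Triple f e

related-tail : (∀ {t} → m ≡ just t → t < x) → x < z → Related (x ∷ m ⊕ z ∷ []) (x ∷ z ∷ m ⊕ [])
related-tail {nothing} _   _   = inj₁ refl
related-tail {just _}  t<x x<z = inj₂ (inj₁ (ck₁ (t<x refl) x<z))

related-descent : Column B → a < b → Pass B b m₁ C → Pass C a m₂ D → b ≤ z →
  Related (m₁ ⊕ m₂ ⊕ z ∷ []) (m₁ ⊕ z ∷ m₂ ⊕ [])
related-descent {m₁ = nothing} d a<b p q b≤z with descent-absorbs p q a<b
... | refl = inj₁ refl
related-descent {m₁ = just _} {m₂ = nothing} d a<b p q b≤z = inj₁ refl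
related-descent {m₁ = just _} {m₂ = just _}  d a<b p q b≤z =
  inj₂ (inj₁ (ck₁ (descent-emits d p q a<b) (<-≤-trans (pass-emitted-< p) b≤z)))

related-ascent : a < b → Pass B a m₁ C → Pass C b m₂ D → (∀ {t} → m₂ ≡ just t → t < x) →
  Related (x ∷ m₁ ⊕ m₂ ⊕ []) (m₁ ⊕ x ∷ m₂ ⊕ [])
related-ascent {m₁ = nothing} a<b p q t<x = inj₁ refl
related-ascent {m₁ = just _}  a<b p q t<x with ascent-emits p q a<b
... | _ , refl , lt = inj₂ (inj₁ (ck₂ (lt refl) (t<x refl)))

-- Induction on the column. If the greatest incoming letter is below the head `h`, all three letters
-- skip `h`; otherwise that letter twists or bumps `h`, and what remains are passages of the smaller
-- letters through the tail. The other two moves follow the same pattern.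
ck₁-invariant : Column B → a < b → b < c →
  Pass B b m₁ C → Pass C a m₂ C′ → Pass C′ c m₃ D →
  ∀ {C″ D″} → Pass C c n₂ C″ → Pass C″ a n₃ D″ →
  D ≡ D″ × Related (m₁ ⊕ m₂ ⊕ m₃ ⊕ []) (m₁ ⊕ n₂ ⊕ n₃ ⊕ [])
ck₁-invariant _ a<b b<c absorb q r q′ r′ with pass-skip⁻ q a<b | pass-bump⁻ q′ b<c
... | _ , refl , absorb | refl , refl with pass-bump⁻ r b<c | pass-skip⁻ r′ (<-trans a<b b<c)
... | refl , refl | _ , refl , absorb = refl , inj₁ refl
ck₁-invariant (d ∷ _) a<b b<c (bump h<b) q r q′ r′ with pass-skip⁻ q a<b | pass-bump⁻ q′ b<c
... | _ , refl , s | refl , refl with pass-bump⁻ r b<c | pass-skip⁻ r′ (<-trans a<b b<c)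
... | refl , refl | _ , refl , s′ with pass-functional s s′
... | refl , refl = refl , related-tail (λ { refl → All.lookup d (pass-emitted-∈ s) }) h<b
ck₁-invariant d a<b b<c twist q r q′ r′ with pass-skip⁻ q a<b | pass-bump⁻ q′ b<c
... | _ , refl , s | refl , refl with pass-bump⁻ r b<c | pass-skip⁻ r′ (<-trans a<b b<c)
... | refl , refl | _ , refl , s′ with pass-functional s s′
... | refl , refl = refl , related-tail (λ { refl → <-≤-trans (pass-emitted-< s) (≤-pred a<b) }) (n<1+n _)
ck₁-invariant {B = h ∷ _} {c = c} (d ∷ ds) a<b b<c (skip b<h p) q r q′ r′
  with pass-skip⁻ q (<-trans a<b b<h)
... | _ , refl , s with <-cmp c h
...   | tri< c<h _ _ with pass-skip⁻ r c<h | pass-skip⁻ q′ c<h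
...     | _ , refl , t | _ , refl , s′ with pass-skip⁻ r′ (<-trans a<b b<h)
...       | _ , refl , t′ with ck₁-invariant ds a<b b<c p s t s′ t′
...         | refl , rel = refl , rel
ck₁-invariant (d ∷ ds) a<b b<c (skip b<h p) q r q′ r′ | _ , refl , s | tri≈ _ refl _
  with pass-twist⁻ r | pass-twist⁻ q′
... | _ , _ , refl , refl , refl , refl | _ , _ , refl , refl , refl , refl with pass-skip⁻ r′ (<-trans a<b b<h)
...   | _ , refl , s′ with pass-functional s s′
...     | refl , refl = refl , related-descent ds a<b p s (≤-pred b<c)
ck₁-invariant (d ∷ ds) a<b b<c (skip b<h p) q r q′ r′ | _ , refl , s | tri> _ _ h<c
  with pass-bump⁻ r h<c | pass-bump⁻ q′ h<c
... | refl , refl | refl , refl with pass-skip⁻ r′ (<-trans a<b b<c)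
...   | _ , refl , s′ with pass-functional s s′
...     | refl , refl = refl , related-descent ds a<b p s (<⇒≤ b<h)

ck₂-invariant : Column B → a < b → b < c →
  Pass B c m₁ C → Pass C a m₂ C′ → Pass C′ b m₃ D →
  ∀ {C‴ C″ D″} → Pass B a n₁ C‴ → Pass C‴ c n₂ C″ → Pass C″ b n₃ D″ →
  D ≡ D″ × Related (m₁ ⊕ m₂ ⊕ m₃ ⊕ []) (n₁ ⊕ n₂ ⊕ n₃ ⊕ [])
ck₂-invariant {B = []} _ a<b b<c absorb q r absorb q′ r′
  with pass-skip⁻ q (<-trans a<b b<c) | pass-bump⁻ q′ (<-trans a<b b<c)
... | _ , refl , absorb | refl , refl with pass-skip⁻ r b<c | pass-skip⁻ r′ b<c
... | _ , refl , r₁ | _ , refl , absorb with pass-bump⁻ r₁ a<b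
... | refl , refl = refl , inj₁ refl
ck₂-invariant {B = h ∷ _} {a} {b} {c} (d ∷ ds) a<b b<c p q r p′ q′ r′ with <-cmp c h
... | tri< c<h _ _
  with pass-skip⁻ p c<h | pass-skip⁻ p′ (<-trans (<-trans a<b b<c) c<h)
... | _ , refl , p₁ | _ , refl , p₁′
  with pass-skip⁻ q (<-trans (<-trans a<b b<c) c<h) | pass-skip⁻ q′ c<h
... | _ , refl , q₁ | _ , refl , q₁′
  with pass-skip⁻ r (<-trans b<c c<h) | pass-skip⁻ r′ (<-trans b<c c<h)
... | _ , refl , r₁ | _ , refl , r₁′ with ck₂-invariant ds a<b b<c p₁ q₁ r₁ p₁′ q₁′ r₁′
... | refl , rel = refl , rel
ck₂-invariant {B = h ∷ _} (d ∷ ds) a<b b<c p q r p′ q′ r′ | tri≈ _ refl _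
  with pass-twist⁻ p | pass-skip⁻ p′ (<-trans a<b b<c)
... | _ , _ , refl , refl , refl , refl | _ , refl , q₁′
  with pass-skip⁻ q (<-trans a<b b<c)
... | _ , refl , q₁ with pass-functional q₁ q₁′
... | refl , refl with pass-skip⁻ r b<c | pass-twist⁻ q′
... | _ , refl , r₁ | _ , _ , refl , refl , refl , refl with pass-skip⁻ r′ b<c
... | _ , refl , r₁′ with pass-functional r₁ r₁′
... | refl , refl = refl , related-ascent a<b q₁ r₁ λ { refl → <-≤-trans (pass-emitted-< r₁) (≤-pred b<c) }
ck₂-invariant {B = h ∷ T} {a} (d ∷ ds) a<b b<c p q r p′ q′ r′ | tri> _ _ h<c
  with pass-bump⁻ p h<c
... | refl , refl with pass-skip⁻ q (<-trans a<b b<c)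
... | _ , refl , q₁ with pass-skip⁻ r b<c
... | _ , refl , r₁ with <-cmp a h
... | tri< a<h _ _ with pass-skip⁻ p′ a<h
...   | _ , refl , q₁′ with pass-functional q₁ q₁′ | pass-bump⁻ q′ h<c
...     | refl , refl | refl , refl with pass-skip⁻ r′ b<c
...       | _ , refl , r₁′ with pass-functional r₁ r₁′
...         | refl , refl = refl , related-ascent a<b q₁ r₁
                λ { refl → All.lookup (pass-All q₁ d a<h) (pass-emitted-∈ r₁) }
ck₂-invariant {B = h ∷ T} (d ∷ ds) a<b b<c p q r p′ q′ r′ | tri> _ _ h<c
  | refl , refl | _ , refl , q₁ | _ , refl , r₁ | tri≈ _ refl _
  with pass-twist⁻ p′
... | _ , _ , refl , refl , refl , refl with pass-bump⁻ q₁ (n<1+n _) | pass-bump⁻ q′ h<c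
... | refl , refl | refl , refl with pass-bump⁻ r₁ a<b | pass-skip⁻ r′ b<c
... | refl , refl | _ , refl , r₁′ with pass-bump⁻ r₁′ (<-trans (n<1+n _) a<b)
-- With `a` equal to the head `h`, the emitted letters are `h`, `h-1`, `h` in one order of insertion
-- and `h-1`, `h`, `h-1` in the other.
... | refl , refl = refl , inj₂ (inj₂ braid)
ck₂-invariant {B = h ∷ T} (d ∷ ds) a<b b<c p q r p′ q′ r′ | tri> _ _ h<c
  | refl , refl | _ , refl , q₁ | _ , refl , r₁ | tri> _ _ h<a
  with pass-bump⁻ p′ h<a
... | refl , refl with pass-bump⁻ q′ (<-trans a<b b<c)
... | refl , refl with pass-skip⁻ r′ b<c
ck₂-invariant {B = h ∷ []} (d ∷ ds) a<b b<c p q r p′ q′ r′ | tri> _ _ h<c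
  | refl , refl | _ , refl , absorb | _ , refl , r₁ | tri> _ _ h<a | refl , refl | refl , refl | _ , refl , absorb
  with pass-bump⁻ r₁ a<b
... | refl , refl = refl , inj₁ refl
ck₂-invariant {B = h ∷ t ∷ T} ((t<h ∷ _) ∷ ds) a<b b<c p q r p′ q′ r′ | tri> _ _ h<c
  | refl , refl | _ , refl , q₁ | _ , refl , r₁ | tri> _ _ h<a | refl , refl | refl , refl | _ , refl , r₁′
  with pass-bump⁻ q₁ (<-trans t<h h<a) | pass-bump⁻ r₁′ (<-trans t<h (<-trans h<a a<b))
... | refl , refl | refl , refl with pass-bump⁻ r₁ a<b
... | refl , refl = refl , inj₂ (inj₁ (ck₁ t<h h<a))

braid-invariant : Column B →
  Pass B i m₁ C → Pass C (suc i) m₂ C′ → Pass C′ i m₃ D →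
  ∀ {C‴ C″ D″} → Pass B (suc i) n₁ C‴ → Pass C‴ i n₂ C″ → Pass C″ (suc i) n₃ D″ →
  D ≡ D″ × Related (m₁ ⊕ m₂ ⊕ m₃ ⊕ []) (n₁ ⊕ n₂ ⊕ n₃ ⊕ [])
braid-invariant {B = []} _ absorb q r absorb q′ r′ with pass-bump⁻ q (n<1+n _) | pass-skip⁻ q′ (n<1+n _)
... | refl , refl | _ , refl , absorb with pass-skip⁻ r (n<1+n _) | pass-twist⁻ r′
... | _ , refl , absorb | _ , _ , refl , refl , refl , refl = refl , inj₁ refl
braid-invariant {B = h ∷ T} {i = i} (d ∷ ds) p q r p′ q′ r′ with <-cmp (suc i) h
... | tri< s<h _ _ with pass-skip⁻ p (<-trans (n<1+n _) s<h) | pass-skip⁻ p′ s<h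
... | _ , refl , p₁ | _ , refl , p₁′ with pass-skip⁻ q s<h | pass-skip⁻ q′ (<-trans (n<1+n _) s<h)
... | _ , refl , q₁ | _ , refl , q₁′ with pass-skip⁻ r (<-trans (n<1+n _) s<h) | pass-skip⁻ r′ s<h
... | _ , refl , r₁ | _ , refl , r₁′ with braid-invariant ds p₁ q₁ r₁ p₁′ q₁′ r₁′
... | refl , rel = refl , rel
braid-invariant {B = h ∷ T} (d ∷ ds) p q r p′ q′ r′ | tri≈ _ refl _
  with pass-twist⁻ p′ | pass-skip⁻ p (n<1+n _)
... | _ , _ , refl , refl , refl , refl | _ , refl , p₁ with pass-skip⁻ q′ (n<1+n _)
... | _ , refl , q₁′ with pass-twist⁻ q₁′ | pass-twist⁻ r′
... | _ , _ , refl , refl , refl , refl | _ , _ , refl , refl , refl , refl with pass-twist⁻ p₁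
... | _ , _ , refl , refl , refl , refl with pass-twist⁻ q
... | _ , _ , refl , refl , refl , refl with pass-skip⁻ r (n<1+n _)
... | _ , refl , r₁ with pass-twist⁻ r₁
... | _ , _ , refl , refl , refl , refl = refl , inj₂ (inj₁ braid)
braid-invariant {B = h ∷ T} {i = i} (d ∷ ds) p q r p′ q′ r′ | tri> _ _ h<s
  with pass-bump⁻ p′ h<s
... | refl , refl with pass-skip⁻ q′ (n<1+n _)
... | _ , refl , q₁′ with pass-twist⁻ r′
... | _ , _ , refl , refl , refl , refl with <-cmp i h
... | tri< i<h _ _ = ⊥-elim (<-irrefl refl (<-≤-trans i<h (≤-pred h<s)))
... | tri≈ _ refl _ with pass-twist⁻ p
... | _ , _ , refl , refl , refl , refl with pass-bump⁻ q (n<1+n _) | pass-bump⁻ q₁′ (n<1+n _)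
... | refl , refl | refl , refl with pass-skip⁻ r (n<1+n _)
... | _ , refl , r₁ with pass-bump⁻ r₁ (n<1+n _)
... | refl , refl = refl , inj₂ (inj₁ braid)
braid-invariant {B = h ∷ T} {i = i} (d ∷ ds) p q r p′ q′ r′ | tri> _ _ h<s
  | refl , refl | _ , refl , q₁′ | _ , _ , refl , refl , refl , refl | tri> _ _ h<i
  with pass-bump⁻ p h<i
... | refl , refl with pass-bump⁻ q (n<1+n _)
... | refl , refl with pass-skip⁻ r (n<1+n _)
... | _ , refl , r₁ with pass-functional r₁ q₁′
... | refl , refl = refl , flip (related-tail (λ { refl → All.lookup d (pass-emitted-∈ r₁) }) h<i)
  where
  flip : Related e f → Related f e
  flip (inj₁ refl)     = inj₁ refl
  flip (inj₂ (inj₁ t)) = inj₂ (inj₂ t)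
  flip (inj₂ (inj₂ t)) = inj₂ (inj₁ t)

-- Words passing through columns

data Passes : List ℕ → List ℕ → List ℕ → List ℕ → Set where
  []   : Passes B [] [] B
  keep : Pass B x nothing C → Passes C w e D → Passes B (x ∷ w) e D
  emit : Pass B x (just y) C → Passes C w e D → Passes B (x ∷ w) (y ∷ e) D

-- Passage without absorption. Only this kind can be undone: each emitted letter, with the column
-- left behind, gives back the letter that pushed it out.
data Emits : List ℕ → List ℕ → List ℕ → List ℕ → Set where
  []  : Emits B [] [] B
  _∷_ : Pass B x (just y) C → Emits C w e D → Emits B (x ∷ w) (y ∷ e) D

passes-∷⁻ : Passes B (x ∷ w) e D →
  Σ (Maybe ℕ) λ m → Σ (List ℕ) λ C → Σ (List ℕ) λ f → Pass B x m C × Passes C w f D × e ≡ m ⊕ f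
passes-∷⁻ (keep p ps) = _ , _ , _ , p , ps , refl
passes-∷⁻ (emit p ps) = _ , _ , _ , p , ps , refl

passes-++ : Passes B w e C → Passes C v f D → Passes B (w ++ v) (e ++ f) D
passes-++ []          qs = qs
passes-++ (keep p ps) qs = keep p (passes-++ ps qs)
passes-++ (emit p ps) qs = emit p (passes-++ ps qs)

passes-++⁻ : ∀ w → Passes B (w ++ v) e D →
  Σ (List ℕ) λ C → Σ (List ℕ) λ e₁ → Σ (List ℕ) λ e₂ → e ≡ e₁ ++ e₂ × Passes B w e₁ C × Passes C v e₂ D
passes-++⁻ []      ps          = _ , _ , _ , refl , [] , ps
passes-++⁻ (x ∷ w) (keep p ps) with passes-++⁻ w ps
... | _ , _ , _ , eq , qs , rs = _ , _ , _ , eq , keep p qs , rs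
passes-++⁻ (x ∷ w) (emit p ps) with passes-++⁻ w ps
... | _ , _ , _ , eq , qs , rs = _ , _ , _ , cong (_ ∷_) eq , emit p qs , rs

passes-functional : Passes B w e C → Passes B w f D → e ≡ f × C ≡ D
passes-functional []          []          = refl , refl
passes-functional (keep p ps) (keep q qs) with pass-functional p q
... | refl , refl = passes-functional ps qs
passes-functional (keep p ps) (emit q qs) with pass-functional p q
... | () , _
passes-functional (emit p ps) (keep q qs) with pass-functional p q
... | () , _
passes-functional (emit p ps) (emit q qs) with pass-functional p q
... | refl , refl with passes-functional ps qs
...   | refl , refl = refl , refl

passes-Column : Passes B w e C → Column B → Column C
passes-Column []          d = d
passes-Column (keep p ps) d = passes-Column ps (pass-Column p d)
passes-Column (emit p ps) d = passes-Column ps (pass-Column p d)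

passes-length : Passes B w e C → length e ≤ length w
passes-length []          = z≤n
passes-length (keep p ps) = m≤n⇒m≤1+n (passes-length ps)
passes-length (emit p ps) = s≤s (passes-length ps)

emits⇒passes : Emits B w e C → Passes B w e C
emits⇒passes []       = []
emits⇒passes (p ∷ ps) = emit p (emits⇒passes ps)

passes⇒emits : Passes B w e C → length e ≡ length w → Emits B w e C
passes⇒emits []          eq = []
passes⇒emits (keep p ps) eq = ⊥-elim (<-irrefl eq (s≤s (passes-length ps)))
passes⇒emits (emit p ps) eq = p ∷ passes⇒emits ps (suc-injective eq)

emits-Column : Emits B w e C → Column B → Column C
emits-Column = passes-Column ∘ emits⇒passes

emits-length : Emits B w e C → length e ≡ length w
emits-length []       = refl
emits-length (_ ∷ ps) = cong suc (emits-length ps)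

emits-++ : Emits B w e C → Emits C v f D → Emits B (w ++ v) (e ++ f) D
emits-++ []       qs = qs
emits-++ (p ∷ ps) qs = p ∷ emits-++ ps qs

emits-++⁻ : ∀ e → Emits B w (e ++ f) D →
  Σ (List ℕ) λ C → Σ (List ℕ) λ w₁ → Σ (List ℕ) λ w₂ → w ≡ w₁ ++ w₂ × Emits B w₁ e C × Emits C w₂ f D
emits-++⁻ []      ps       = _ , _ , _ , refl , [] , ps
emits-++⁻ (x ∷ e) (p ∷ ps) with emits-++⁻ e ps
... | _ , _ , _ , eq , qs , rs = _ , _ , _ , cong (_ ∷_) eq , p ∷ qs , rs

emits-injective : Column B → Column B′ → Emits B w e C → Emits B′ v e C → B ≡ B′ × w ≡ v
emits-injective d d′ []       []       = refl , refl
emits-injective d d′ (p ∷ ps) (q ∷ qs) with emits-injective (pass-Column p d) (pass-Column q d′) ps qs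
... | refl , refl with pass-injective d d′ p q
...   | refl , refl = refl , refl

∼-slide : Column (b ∷ B) → b < x → (b ∷ B ++ [ x ]) ∼ (b ∷ x ∷ B)
∼-slide {B = []}    _              b<x = ε
∼-slide {B = t ∷ B} ((t<b ∷ _) ∷ d) b<x =
  ∼-congˡ [ _ ] (∼-slide d (<-trans t<b b<x)) ◅◅ (fwd (ck₁ [] B _ t _ t<b b<x) ◅ ε)

pass-∼ : Column B → Pass B x m C → (B ++ [ x ]) ∼ (m ⊕ C)
pass-∼ _       absorb     = ε
pass-∼ d       (bump b<x) = ∼-slide d b<x
pass-∼ (_ ∷ d) (twist {y} {B}) =
  ∼-congˡ [ suc y ] (∼-slide d (n<1+n y)) ◅◅ (bwd (braid [] B y) ◅ ε)
pass-∼ (_ ∷ d) (skip {m = nothing} _ p) = ∼-congˡ [ _ ] (pass-∼ d p)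
pass-∼ (q ∷ d) (skip {m = just y} x<h p) with pass-head p | pass-All p q x<h
... | c , C , refl , y<c | c<h ∷ _ =
  ∼-congˡ [ _ ] (pass-∼ d p) ◅◅ (fwd (ck₂ [] C _ y c y<c c<h) ◅ ε)

passes-∼ : Column B → Passes B w e C → (B ++ w) ∼ (e ++ C)
passes-∼ {B} d [] = ∼-reflexive (++-identityʳ B)
passes-∼ {B} {x ∷ w} d (keep {C = C} p ps) =
  ∼-reflexive (sym (++-assoc B [ x ] w)) ◅◅ ∼-congʳ w (pass-∼ d p) ◅◅ passes-∼ (pass-Column p d) ps
passes-∼ {B} {x ∷ w} d (emit {y = y} p ps) =
  ∼-reflexive (sym (++-assoc B [ x ] w)) ◅◅ ∼-congʳ w (pass-∼ d p) ◅◅ ∼-congˡ [ y ] (passes-∼ (pass-Column p d) ps)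

column-far : suc a < h → Column (a ∷ B) → All (Far h) (a ∷ B)
column-far lt (d ∷ _) = inj₂ lt ∷ All.map (λ q → inj₂ (<-trans (s≤s q) lt)) d

-- The one case without a rule is `x = h` with `h-1` absent from the column. Then `h` commutes with
-- everything behind it and the two copies of `h` would cancel.
pass-total : Column B → Red (B ++ [ x ]) → Σ (Maybe ℕ) λ m → Σ (List ℕ) λ C → Pass B x m C
pass-total {[]}    _ _ = _ , _ , absorb
pass-total {h ∷ B} {x} (d ∷ ds) r with <-cmp x h
... | tri> _ _ h<x = _ , _ , bump h<x
... | tri< x<h _ _ with pass-total ds (Red-suffix [ h ] r)
...   | _ , _ , p = _ , _ , skip x<h p
pass-total {h ∷ []}    _ r | tri≈ _ refl _ = ⊥-elim (¬Red-cancel [] [] r)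
pass-total {h ∷ t ∷ B} ((t<h ∷ _) ∷ ds) r | tri≈ _ refl _ with m≤n⇒m<n∨m≡n t<h
... | inj₂ refl = _ , _ , twist
... | inj₁ lt   = ⊥-elim (¬Red-cancel (t ∷ B) (column-far lt ds) r)

passes-total : Column B → Red (B ++ w) → Σ (List ℕ) λ e → Σ (List ℕ) λ C → Passes B w e C
passes-total {w = []} d r = _ , _ , []
passes-total {B} {x ∷ w} d r with pass-total d (Red-prefix (B ++ [ x ]) w r′)
  where r′ = subst Red (sym (++-assoc B [ x ] w)) r
... | nothing , C , p with passes-total (pass-Column p d) (Red-∼ (∼-congʳ w (pass-∼ d p)) (subst Red (sym (++-assoc B [ x ] w)) r))
...   | _ , _ , ps = _ , _ , keep p ps
passes-total {B} {x ∷ w} d r | just y , C , p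
  with passes-total (pass-Column p d) (Red-suffix [ y ] (Red-∼ (∼-congʳ w (pass-∼ d p)) (subst Red (sym (++-assoc B [ x ] w)) r)))
...   | _ , _ , ps = _ , _ , emit p ps

passes-triple⁻ : Passes B (x ∷ y ∷ z ∷ []) e D →
  Σ (Maybe ℕ) λ m₁ → Σ (Maybe ℕ) λ m₂ → Σ (Maybe ℕ) λ m₃ → Σ (List ℕ) λ C₁ → Σ (List ℕ) λ C₂ →
  Pass B x m₁ C₁ × Pass C₁ y m₂ C₂ × Pass C₂ z m₃ D × e ≡ m₁ ⊕ m₂ ⊕ m₃ ⊕ []
passes-triple⁻ ps with passes-∷⁻ ps
... | _ , _ , _ , p , qs , refl with passes-∷⁻ qs
... | _ , _ , _ , q , rs , refl with passes-∷⁻ rs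
... | _ , _ , _ , r , [] , refl = _ , _ , _ , _ , _ , p , q , r , refl

triple-invariant : Column B → Triple w v → Passes B w e C → Passes B v f D → C ≡ D × Related e f
triple-invariant d (ck₁ y<x x<z) ps qs with passes-triple⁻ ps | passes-triple⁻ qs
... | _ , _ , _ , _ , _ , p , q , r , refl | _ , _ , _ , _ , _ , p′ , q′ , r′ , refl with pass-functional p p′
... | refl , refl = ck₁-invariant d y<x x<z p q r q′ r′
triple-invariant d (ck₂ y<z z<x) ps qs with passes-triple⁻ ps | passes-triple⁻ qs
... | _ , _ , _ , _ , _ , p , q , r , refl | _ , _ , _ , _ , _ , p′ , q′ , r′ , refl =
  ck₂-invariant d y<z z<x p q r p′ q′ r′
triple-invariant d braid ps qs with passes-triple⁻ ps | passes-triple⁻ qs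
... | _ , _ , _ , _ , _ , p , q , r , refl | _ , _ , _ , _ , _ , p′ , q′ , r′ , refl =
  braid-invariant d p q r p′ q′ r′

triple-step : Triple w v → ∀ α β → CKstep (α ++ w ++ β) (α ++ v ++ β)
triple-step (ck₁ p q) α β = ck₁ α β _ _ _ p q
triple-step (ck₂ p q) α β = ck₂ α β _ _ _ p q
triple-step braid     α β = braid α β _

step-triple : CKstep ρ τ → Σ (List ℕ) λ α → Σ (List ℕ) λ β → Σ (List ℕ) λ w → Σ (List ℕ) λ v →
  ρ ≡ α ++ w ++ β × τ ≡ α ++ v ++ β × Triple w v
step-triple (ck₁ α β x y z p q) = α , β , _ , _ , refl , refl , ck₁ p q
step-triple (ck₂ α β x y z p q) = α , β , _ , _ , refl , refl , ck₂ p q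
step-triple (braid α β i)       = α , β , _ , _ , refl , refl , braid

related-∼ : ∀ α β → Related e f → (α ++ e ++ β) ∼ (α ++ f ++ β)
related-∼ α β (inj₁ refl)     = ε
related-∼ α β (inj₂ (inj₁ t)) = fwd (triple-step t α β) ◅ ε
related-∼ α β (inj₂ (inj₂ t)) = bwd (triple-step t α β) ◅ ε

step-invariant : CKstep ρ τ → Passes [] ρ e C → Passes [] τ f D → C ≡ D × e ∼ f
step-invariant s ps qs with step-triple s
... | α , β , w , v , refl , refl , t with passes-++⁻ α ps | passes-++⁻ α qs
... | _ , e₁ , _ , refl , ps₁ , ps₂ | _ , _ , _ , refl , qs₁ , qs₂ with passes-functional ps₁ qs₁
... | refl , refl with passes-++⁻ w ps₂ | passes-++⁻ v qs₂
... | _ , _ , e₂ , refl , ps₃ , ps₄ | _ , _ , _ , refl , qs₃ , qs₄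
  with triple-invariant (passes-Column ps₁ []) t ps₃ qs₃
... | refl , rel with passes-functional ps₄ qs₄
... | refl , refl = refl , related-∼ e₁ e₂ rel

passes-invariant : ρ ∼ τ → Red ρ → Passes [] ρ e C → Σ (List ℕ) λ f → Passes [] τ f C × e ∼ f
passes-invariant ε            r ps = _ , ps , ε
passes-invariant (fwd s ◅ ss) r ps with passes-total [] (Red-∼ (fwd s ◅ ε) r)
... | _ , _ , qs with step-invariant s ps qs
... | refl , e∼f with passes-invariant ss (Red-∼ (fwd s ◅ ε) r) qs
... | _ , rs , f∼g = _ , rs , e∼f ◅◅ f∼g
passes-invariant (bwd s ◅ ss) r ps with passes-total [] (Red-∼ (bwd s ◅ ε) r)
... | _ , _ , qs with step-invariant s qs ps
... | refl , f∼e with passes-invariant ss (Red-∼ (bwd s ◅ ε) r) qs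
... | _ , rs , f∼g = _ , rs , ∼-sym f∼e ◅◅ f∼g

-- Unwinding along Coxeter-Knuth moves

Neighbour : List ℕ → List ℕ → Set
Neighbour w v = Triple w v ⊎ Triple v w

triple-functional : Triple w v → Triple w τ → v ≡ τ
triple-functional (ck₁ _ _) (ck₁ _ _) = refl
triple-functional (ck₁ _ p) (ck₂ _ q) = ⊥-elim (<-asym p q)
triple-functional (ck₁ p _) braid     = ⊥-elim (<-asym p (n<1+n _))
triple-functional (ck₂ _ p) (ck₁ _ q) = ⊥-elim (<-asym p q)
triple-functional (ck₂ _ _) (ck₂ _ _) = refl
triple-functional (ck₂ _ p) braid     = ⊥-elim (<-irrefl refl p)
triple-functional braid (ck₁ p _)     = ⊥-elim (<-asym p (n<1+n _))
triple-functional braid (ck₂ _ p)     = ⊥-elim (<-irrefl refl p)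
triple-functional braid braid         = refl

triple-injective : Triple v w → Triple τ w → v ≡ τ
triple-injective (ck₁ _ _) (ck₁ _ _) = refl
triple-injective (ck₁ p _) (ck₂ q _) = ⊥-elim (<-asym p q)
triple-injective (ck₁ _ p) braid     = ⊥-elim (<-asym p (n<1+n _))
triple-injective (ck₂ p _) (ck₁ q _) = ⊥-elim (<-asym p q)
triple-injective (ck₂ _ _) (ck₂ _ _) = refl
triple-injective (ck₂ p q) braid     = ⊥-elim (<-irrefl refl p)
triple-injective braid (ck₁ _ p)     = ⊥-elim (<-asym p (n<1+n _))
triple-injective braid (ck₂ p _)     = ⊥-elim (<-irrefl refl p)
triple-injective braid braid         = refl

triple-asym : Triple w v → Triple τ w → ⊥
triple-asym (ck₁ p q) (ck₁ p′ q′) = <-asym q p′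
triple-asym (ck₁ p q) (ck₂ p′ q′) = <-asym p (<-trans p′ q′)
triple-asym (ck₁ p q) braid       = <-irrefl refl q
triple-asym (ck₂ p q) (ck₁ p′ q′) = <-asym (<-trans p q) q′
triple-asym (ck₂ p q) (ck₂ p′ q′) = <-asym q p′
triple-asym (ck₂ p q) braid       = <-irrefl refl q
triple-asym braid (ck₁ p q)       = <-irrefl refl p
triple-asym braid (ck₂ p q)       = <-irrefl refl p

neighbour-unique : Neighbour w v → Neighbour w τ → v ≡ τ
neighbour-unique (inj₁ s) (inj₁ t) = triple-functional s t
neighbour-unique (inj₁ s) (inj₂ t) = ⊥-elim (triple-asym s t)
neighbour-unique (inj₂ s) (inj₁ t) = ⊥-elim (triple-asym t s)
neighbour-unique (inj₂ s) (inj₂ t) = triple-injective s t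

triple-irrefl : ¬ Triple w w
triple-irrefl t = triple-asym t t

-- For a reduced triple, to be non-monotone is the same as to have a neighbour. Being bent depends
-- only on ascents and descents, and these carry over from the emitted triple to the incoming one.
data Bent : List ℕ → Set where
  peak   : x < y → z < y → Bent (x ∷ y ∷ z ∷ [])
  valley : y < x → y < z → Bent (x ∷ y ∷ z ∷ [])

neighbour-bent : Neighbour w v → Bent w
neighbour-bent (inj₁ (ck₁ p q)) = valley p (<-trans p q)
neighbour-bent (inj₁ (ck₂ p q)) = valley (<-trans p q) p
neighbour-bent (inj₁ braid)     = peak (n<1+n _) (n<1+n _)
neighbour-bent (inj₂ (ck₁ p q)) = peak q (<-trans p q)
neighbour-bent (inj₂ (ck₂ p q)) = peak (<-trans p q) q
neighbour-bent (inj₂ braid)     = valley (n<1+n _) (n<1+n _)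

bent-neighbour : Red w → Bent w → Σ (List ℕ) λ v → Neighbour w v
bent-neighbour r (peak {x} {y} {z} x<y z<y) with <-cmp x z
... | tri< x<z _ _ = _ , inj₂ (ck₂ x<z z<y)
... | tri> _ _ z<x = _ , inj₂ (ck₁ z<x x<y)
... | tri≈ _ refl _ with m≤n⇒m<n∨m≡n x<y
...   | inj₂ refl = _ , inj₁ braid
...   | inj₁ lt   = ⊥-elim (¬Red-cancel [ y ] (inj₁ lt ∷ []) r)
bent-neighbour r (valley {y} {x} {z} y<x y<z) with <-cmp x z
... | tri< x<z _ _ = _ , inj₁ (ck₁ y<x x<z)
... | tri> _ _ z<x = _ , inj₁ (ck₂ y<z z<x)
... | tri≈ _ refl _ with m≤n⇒m<n∨m≡n y<x
...   | inj₂ refl = _ , inj₂ braid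
...   | inj₁ lt   = ⊥-elim (¬Red-cancel [ y ] (inj₂ lt ∷ []) r)

emits-ascent : Column B → Pass B x (just x′) C → Pass C y (just y′) D → x ≢ y → x′ < y′ → x < y
emits-ascent {x = x} {y = y} d p q x≢y lt with <-cmp x y
... | tri< x<y _ _  = x<y
... | tri≈ _ x≡y _  = ⊥-elim (x≢y x≡y)
... | tri> _ _ y<x  = ⊥-elim (<-asym lt (descent-emits d p q y<x))

emits-descent : Pass B x (just x′) C → Pass C y (just y′) D → x ≢ y → y′ < x′ → y < x
emits-descent {x = x} {y = y} p q x≢y lt with <-cmp x y
... | tri> _ _ y<x  = y<x
... | tri≈ _ x≡y _  = ⊥-elim (x≢y x≡y)
... | tri< x<y _ _ with ascent-emits p q x<y
...   | _ , refl , lt′ = ⊥-elim (<-asym lt (lt′ refl))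

Red-≢ : Red (x ∷ y ∷ w) → x ≢ y
Red-≢ r refl = ¬Red-cancel [] [] r

emits-bent : Column B → Red w → Emits B w e C → Bent e → Bent w
emits-bent d r (p ∷ q ∷ s ∷ []) (peak lt gt) =
  peak (emits-ascent d p q (Red-≢ r) lt) (emits-descent q s (Red-≢ (Red-suffix [ _ ] r)) gt)
emits-bent d r (p ∷ q ∷ s ∷ []) (valley gt lt) =
  valley (emits-descent p q (Red-≢ r) gt) (emits-ascent (pass-Column p d) q s (Red-≢ (Red-suffix [ _ ] r)) lt)

neighbour-invariant : Column B → Neighbour w v → Passes B w e C → Passes B v f D → C ≡ D × (e ≡ f ⊎ Neighbour e f)
neighbour-invariant d (inj₁ t) ps qs = triple-invariant d t ps qs
neighbour-invariant d (inj₂ t) ps qs with triple-invariant d t qs ps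
... | eq , inj₁ eq′      = sym eq , inj₁ (sym eq′)
... | eq , inj₂ (inj₁ n) = sym eq , inj₂ (inj₂ n)
... | eq , inj₂ (inj₂ n) = sym eq , inj₂ (inj₁ n)

neighbour-∼ : ∀ α β → Neighbour w v → (α ++ w ++ β) ∼ (α ++ v ++ β)
neighbour-∼ α β n = related-∼ α β (inj₂ n)

neighbour-length : Neighbour w v → length w ≡ length v
neighbour-length (inj₁ (ck₁ _ _)) = refl
neighbour-length (inj₁ (ck₂ _ _)) = refl
neighbour-length (inj₁ braid)     = refl
neighbour-length (inj₂ (ck₁ _ _)) = refl
neighbour-length (inj₂ (ck₂ _ _)) = refl
neighbour-length (inj₂ braid)     = refl

-- Since w has the descents of e, it has a neighbour v as well; what v pushes out
-- is a neighbour of e, and e has only one.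
emits-neighbour : Column B → Red (B ++ w) → Emits B w e C → Neighbour e f → Σ (List ℕ) λ v → Emits B v f C
emits-neighbour {B} {w} d r ps n with bent-neighbour rw (emits-bent d rw ps (neighbour-bent n))
  where rw = Red-suffix B r
... | v , nw with passes-total d (subst (λ v → Red (B ++ v)) (++-identityʳ v)
                    (Red-∼ (neighbour-∼ B [] nw) (subst (λ w → Red (B ++ w)) (sym (++-identityʳ w)) r)))
... | e′ , C′ , qs with neighbour-invariant d nw (emits⇒passes ps) qs
... | refl , inj₂ n′ with neighbour-unique n n′
...   | refl = v , passes⇒emits qs (trans (sym (neighbour-length n)) (trans (emits-length ps) (neighbour-length nw)))
emits-neighbour {B} {w} d r ps n | v , nw | e′ , C′ , qs | refl , inj₁ refl
  with emits-injective d d ps (passes⇒emits qs (trans (emits-length ps) (neighbour-length nw)))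
... | _ , refl with nw
...   | inj₁ t = ⊥-elim (triple-irrefl t)
...   | inj₂ t = ⊥-elim (triple-irrefl t)

step-neighbour : CKstep e f ⊎ CKstep f e → Σ (List ℕ) λ α → Σ (List ℕ) λ β → Σ (List ℕ) λ w → Σ (List ℕ) λ v →
  e ≡ α ++ w ++ β × f ≡ α ++ v ++ β × Neighbour w v
step-neighbour (inj₁ s) with step-triple s
... | α , β , w , v , eq , eq′ , t = α , β , w , v , eq , eq′ , inj₁ t
step-neighbour (inj₂ s) with step-triple s
... | α , β , w , v , eq , eq′ , t = α , β , v , w , eq′ , eq , inj₂ t

passes-Red : Column B → Passes B w e C → Red (B ++ w ++ v) → Red (C ++ v)
passes-Red {B} {w} {e} {C} {v} d ps r = Red-suffix e (subst Red (++-assoc e C v)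
  (Red-∼ (∼-congʳ v (passes-∼ d ps)) (subst Red (sym (++-assoc B w v)) r)))

emits-step : Column B → Red (B ++ w) → Emits B w e C → CKstep e f ⊎ CKstep f e → Σ (List ℕ) λ v → Emits B v f C
emits-step d r ps s with step-neighbour s
... | α , β , g , g′ , refl , refl , n with emits-++⁻ α ps
... | M , w₁ , w₂ , refl , ps₁ , ps₂ with emits-++⁻ g ps₂
... | M₂ , w₃ , w₄ , refl , ps₃ , ps₄
  = let v , qs = emits-neighbour (emits-Column ps₁ d) red ps₃ n
    in  w₁ ++ v ++ w₄ , emits-++ ps₁ (emits-++ qs ps₄)
  where
  red : Red (M ++ w₃)
  red = Red-prefix (M ++ w₃) w₄ (subst Red (sym (++-assoc M w₃ w₄)) (passes-Red d (emits⇒passes ps₁) r))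

emits-red : Column B → Emits B w e C → Red (e ++ C) → Red (B ++ w)
emits-red d ps = Red-∼ (∼-sym (passes-∼ d (emits⇒passes ps)))

emits-invariant : e ∼ f → Column B → Red (e ++ C) → Emits B w e C → Σ (List ℕ) λ v → Emits B v f C
emits-invariant ε            d r ps = _ , ps
emits-invariant {C = C} (fwd s ◅ ss) d r ps with emits-step d (emits-red d ps r) ps (inj₁ s)
... | _ , qs = emits-invariant ss d (Red-∼ (∼-congʳ C (fwd s ◅ ε)) r) qs
emits-invariant {C = C} (bwd s ◅ ss) d r ps with emits-step d (emits-red d ps r) ps (inj₂ s)
... | _ , qs = emits-invariant ss d (Red-∼ (∼-congʳ C (bwd s ◅ ε)) r) qs

-- The left key of a class

data Ins (k : ℕ) : List ℕ → List ℕ → Set where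
  here  : Ins k B (k ∷ B)
  there : Ins k B C → Ins k (b ∷ B) (b ∷ C)

ins-⊆ : Ins k B C → B ⊆ C
ins-⊆ here      p           = there p
ins-⊆ (there s) (here refl) = here refl
ins-⊆ (there s) (there p)   = there (ins-⊆ s p)

ins-∈ : Ins k B C → k ∈ C
ins-∈ here      = here refl
ins-∈ (there s) = there (ins-∈ s)

ins-∈⁻ : Ins k B C → i ∈ C → i ≡ k ⊎ i ∈ B
ins-∈⁻ here      (here eq)   = inj₁ eq
ins-∈⁻ here      (there p)   = inj₂ p
ins-∈⁻ (there s) (here refl) = inj₂ (here refl)
ins-∈⁻ (there s) (there p) with ins-∈⁻ s p
... | inj₁ eq = inj₁ eq
... | inj₂ q  = inj₂ (there q)

ins-All : Ins k B C → P k → All P B → All P C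
ins-All s pk ps = All.tabulate λ i∈C → case (ins-∈⁻ s i∈C)
  where
  case : i ≡ _ ⊎ i ∈ _ → _
  case (inj₁ refl) = pk
  case (inj₂ i∈B)  = All.lookup ps i∈B

ins-∉ : Ins k B C → Column C → k ∉ B
ins-∉ here      (d ∷ _)  p           = <-irrefl refl (All.lookup d p)
ins-∉ (there s) (d ∷ _)  (here refl) = <-irrefl refl (All.lookup d (ins-∈ s))
ins-∉ (there s) (_ ∷ ds) (there p)   = ins-∉ s ds p

ins-max : Ins k B C → Column C → All (k >_) B → C ≡ k ∷ B
ins-max here      _       _         = refl
ins-max (there s) (d ∷ _) (b<k ∷ _) = ⊥-elim (<-asym b<k (All.lookup d (ins-∈ s)))

ins-∷ʳ : ∀ B → Ins x B (B ++ [ x ])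
ins-∷ʳ []      = here
ins-∷ʳ (b ∷ B) = there (ins-∷ʳ B)

pass-entered-∈ : Pass B x (just y) C → x ∈ C
pass-entered-∈ (bump _)   = here refl
pass-entered-∈ twist      = here refl
pass-entered-∈ (skip _ p) = there (pass-entered-∈ p)

-- Seen from the left, `y` takes the place of its successor in `C`: as `x` is a letter of `C`, it is
-- the least one above `y`.
pass-gap : Column B → Pass B x (just y) C → i ∈ C → i ≤ y ⊎ x ≤ i
pass-gap (d ∷ _)       (bump _)     (here refl)         = inj₂ ≤-refl
pass-gap (d ∷ _)       (bump _)     (there p)           = inj₁ (<⇒≤ (All.lookup d p))
pass-gap _             twist        (here refl)         = inj₂ ≤-refl
pass-gap _             twist        (there (here refl)) = inj₁ ≤-refl
pass-gap (_ ∷ d ∷ _)   twist        (there (there p))   = inj₁ (<⇒≤ (All.lookup d p))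
pass-gap _             (skip x<h _) (here refl)         = inj₂ (<⇒≤ x<h)
pass-gap (_ ∷ d)       (skip _ p)   (there q)           = pass-gap d p q

pass-∈⁻ : Pass B x (just y) C → i ∈ C → i ≢ x → i ∈ B
pass-∈⁻ (bump _)   (here refl) i≢x = ⊥-elim (i≢x refl)
pass-∈⁻ (bump _)   (there p)   _   = there p
pass-∈⁻ twist      p           _   = p
pass-∈⁻ (skip _ _) (here refl) _   = here refl
pass-∈⁻ (skip _ p) (there q)   i≢x = there (pass-∈⁻ p q i≢x)

pass-∈ : Pass B x (just y) C → i ∈ B → i ≡ y ⊎ i ∈ C
pass-∈ (bump _)   (here eq)   = inj₁ eq
pass-∈ (bump _)   (there p)   = inj₂ (there p)
pass-∈ twist      p           = inj₂ p
pass-∈ (skip _ _) (here refl) = inj₂ (here refl)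
pass-∈ (skip _ p) (there q) with pass-∈ p q
... | inj₁ eq = inj₁ eq
... | inj₂ r  = inj₂ (there r)

-- Together with the converse below: either membership occurs only for `twist`, which leaves both
-- letters in both columns.
entered⇒emitted : Column B → Pass B x (just y) C → x ∈ B → y ∈ C
entered⇒emitted (d ∷ _) (bump y<x)   (here refl) = ⊥-elim (<-irrefl refl y<x)
entered⇒emitted (d ∷ _) (bump y<x)   (there p)   = ⊥-elim (<-asym y<x (All.lookup d p))
entered⇒emitted _       twist        p           = there (here refl)
entered⇒emitted _       (skip x<h _) (here refl) = ⊥-elim (<-irrefl refl x<h)
entered⇒emitted (_ ∷ d) (skip _ p)   (there q)   = there (entered⇒emitted d p q)

emitted⇒entered : Column B → Pass B x (just y) C → y ∈ C → x ∈ B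
emitted⇒entered (d ∷ _) (bump y<x)   (here refl) = ⊥-elim (<-irrefl refl y<x)
emitted⇒entered (d ∷ _) (bump y<x)   (there p)   = ⊥-elim (<-irrefl refl (All.lookup d p))
emitted⇒entered _       twist        p           = here refl
emitted⇒entered (_ ∷ d) (skip x<h p) (here refl) = ⊥-elim (<-asym x<h (pass-emitted-< p))
emitted⇒entered (_ ∷ d) (skip _ p)   (there q)   = there (emitted⇒entered d p q)

-- If k′ lies between y and x, then y replaces k′ instead of x, which is why k
-- is x in that case.
pass-insert : Column B → Pass B x (just y) C → Ins k′ C C′ → Column C′ → (y ∈ C′ → suc y ∈ C′) →
  Σ ℕ λ k → Σ (List ℕ) λ B′ → Σ ℕ λ x′ →
  Pass B′ x′ (just y) C′ × Ins k B B′ × Column B′ × (k ≡ k′ ⊎ (y ≤ k′ × k′ < x × k ≡ x))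
pass-insert (d ∷ ds) (bump y<x) here ((x<k ∷ k>) ∷ _) _ =
  _ , _ , _ , skip x<k (bump y<x) , here , (<-trans y<x x<k ∷ k>) ∷ d ∷ ds , inj₁ refl
pass-insert {y = y} {k′ = k′} (d ∷ ds) (bump y<x) (there s) (x> ∷ ds′) ok with <-cmp k′ y
... | tri< k<y _ _ = _ , _ , _ , bump y<x , there s , ins-All s k<y d ∷ ds′ , inj₁ refl
... | tri> _ _ y<k with ins-max s ds′ (All.map (λ p → <-trans p y<k) d)
...   | refl = _ , _ , _ , skip k<x (bump y<k) , here , (y<x ∷ All.map (λ p → <-trans p y<x) d) ∷ d ∷ ds ,
               inj₂ (<⇒≤ y<k , k<x , refl)
  where k<x = All.lookup x> (ins-∈ s)
pass-insert {y = y} {k′ = k′} (d ∷ ds) (bump y<x) (there s) (x> ∷ ds′) ok | tri≈ _ refl _ with ins-max s ds′ d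
... | refl with ok (there (here refl))
...   | there (here eq) = ⊥-elim (1+n≢n eq)
...   | there (there p) = ⊥-elim (<-asym (n<1+n _) (All.lookup d p))
...   | here refl = _ , _ , _ , twist , here , (n<1+n _ ∷ All.map (λ p → <-trans p (n<1+n _)) d) ∷ d ∷ ds ,
                    inj₂ (≤-refl , n<1+n _ , refl)
pass-insert _ twist here ds@((s<k ∷ _) ∷ _) _ = _ , _ , _ , skip s<k twist , here , ds , inj₁ refl
pass-insert _ twist (there here) ((k<s ∷ _) ∷ (y<k ∷ _) ∷ _) _ = ⊥-elim (<-irrefl refl (<-≤-trans k<s y<k))
pass-insert _ twist (there (there s)) ds _ = _ , _ , _ , twist , there (there s) , ds , inj₁ refl
pass-insert d@(d₁ ∷ _) (skip x<h p) here ((h<k ∷ _) ∷ _) _ =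
  _ , _ , _ , skip (<-trans x<h h<k) (skip x<h p) , here ,
  (h<k ∷ All.map (λ q → <-trans q h<k) d₁) ∷ d , inj₁ refl
pass-insert {y = y} (d ∷ ds) (skip {b = h} x<h p) (there s) (d′ ∷ ds′) ok with pass-insert ds p s ds′ ok′
  where
  ok′ : y ∈ _ → suc y ∈ _
  ok′ q with ok (there q)
  ... | there r  = r
  ... | here refl = ⊥-elim (<-irrefl refl (<-≤-trans (pass-emitted-< p) (≤-pred x<h)))
... | k , B′ , x′ , q , t , ds″ , c =
  _ , _ , _ , skip (All.lookup d′ (pass-entered-∈ q)) q , there t , ins-All t (bound c) d ∷ ds″ , c
  where
  bound : _ → k < h
  bound (inj₁ refl)           = All.lookup d′ (ins-∈ s)
  bound (inj₂ (_ , _ , refl)) = x<h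

-- Left B y C: the letter y, inserted into the column C from the left, turns it
-- into B; the letter pushed out to the right, if any, is forgotten.
data Left : List ℕ → ℕ → List ℕ → Set where
  push : Pass B x (just y) C → Left B y C
  grow : All (y >_) C → Left (y ∷ C) y C

data Lefts : List ℕ → List ℕ → List ℕ → Set where
  []  : Lefts B [] B
  _∷_ : Left B y C → Lefts C w D → Lefts B (y ∷ w) D

lefts-++ : Lefts B w C → Lefts C v D → Lefts B (w ++ v) D
lefts-++ []       ms = ms
lefts-++ (l ∷ ls) ms = l ∷ lefts-++ ls ms

emits⇒lefts : Emits B w e C → Lefts B e C
emits⇒lefts []       = []
emits⇒lefts (p ∷ ps) = push p ∷ emits⇒lefts ps

column⇒lefts : Column B → Lefts B B []
column⇒lefts []       = []
column⇒lefts (d ∷ ds) = grow d ∷ column⇒lefts ds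

left-Column : Left B y C → Column B → Column C
left-Column (push p) d       = pass-Column p d
left-Column (grow _) (_ ∷ d) = d

-- The only letter that can leave the larger column is `x`. If `x` survives in `B⁰`, it lies in `C⁰`
-- and is the successor of `y` in both columns; its survival means that `y` is in `C⁰`, so the
-- larger column is twisted as well and keeps `x`.
left-⊆ : Column B⁰ → Column B → Left B⁰ y C⁰ → Pass B x (just y) C → C⁰ ⊆ C → B⁰ ⊆ B
left-⊆ {y = y} {x = x} d⁰ d l p sub {i} i∈B⁰ with i ≟ x
left-⊆ d⁰ d (push q) p sub i∈B⁰ | no i≢x with pass-∈ q i∈B⁰
... | inj₁ refl = pass-emitted-∈ p
... | inj₂ i∈C⁰ = pass-∈⁻ p (sub i∈C⁰) i≢x
left-⊆ d⁰ d (grow _) p sub (here refl) | no i≢x = pass-emitted-∈ p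
left-⊆ d⁰ d (grow _) p sub (there q)   | no i≢x = pass-∈⁻ p (sub q) i≢x
left-⊆ d⁰ d (grow y>) p sub (here refl) | yes refl = ⊥-elim (<-irrefl refl (pass-emitted-< p))
left-⊆ d⁰ d (grow y>) p sub (there q)   | yes refl = ⊥-elim (<-asym (All.lookup y> q) (pass-emitted-< p))
left-⊆ {y = y} {x = x} d⁰ d (push {x = x⁰} q) p sub x∈B⁰ | yes refl with pass-∈ q x∈B⁰
... | inj₁ refl = ⊥-elim (<-irrefl refl (pass-emitted-< p))
... | inj₂ x∈C⁰ with pass-gap d⁰ q x∈C⁰ | pass-gap d p (sub (pass-entered-∈ q))
...   | inj₁ x≤y  | _         = ⊥-elim (<⇒≱ (pass-emitted-< p) x≤y)
...   | inj₂ _    | inj₁ x⁰≤y = ⊥-elim (<⇒≱ (pass-emitted-< q) x⁰≤y)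
...   | inj₂ x⁰≤x | inj₂ x≤x⁰ with ≤-antisym x⁰≤x x≤x⁰
...     | refl = emitted⇒entered d p (sub (entered⇒emitted d⁰ q x∈B⁰))

-- Below the extra letter the two columns agree, so `y` replaces the same letter in both or twists
-- both. If the extra letter has become `x`, the letters of `B` below it are at most `y`, and those
-- other than `y` were below the old extra letter.
left-low : Column B⁰ → Column B → Left B⁰ y C⁰ → Pass B x (just y) C → C⁰ ⊆ C →
  (∀ {i} → i ∈ C → i < k′ → i ∈ C⁰) → (k ≡ k′ ⊎ (y ≤ k′ × k′ < x × k ≡ x)) →
  ∀ {i} → i ∈ B → i < k → i ∈ B⁰
left-low d⁰ d l p sub low c i∈B i<k with pass-∈ p i∈B
left-low d⁰ d (push q) p sub low c i∈B i<k | inj₁ refl = pass-emitted-∈ q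
left-low d⁰ d (grow _) p sub low c i∈B i<k | inj₁ refl = here refl
left-low d⁰ d (grow _) p sub low (inj₁ refl) i∈B i<k | inj₂ i∈C = there (low i∈C i<k)
left-low d⁰ d (push {x = x⁰} q) p sub low (inj₁ refl) {i} i∈B i<k | inj₂ i∈C with i ≟ x⁰
... | no i≢x⁰ = pass-∈⁻ q (low i∈C i<k) i≢x⁰
... | yes refl with pass-gap d p i∈C
...   | inj₁ i≤y = ⊥-elim (<⇒≱ (pass-emitted-< q) i≤y)
...   | inj₂ x≤i with pass-gap d⁰ q (low (pass-entered-∈ p) (≤-<-trans x≤i i<k))
...     | inj₁ x≤y = ⊥-elim (<⇒≱ (pass-emitted-< p) x≤y)
...     | inj₂ i≤x with ≤-antisym x≤i i≤x
...       | refl = emitted⇒entered d⁰ q (low (entered⇒emitted d p i∈B) (<-trans (pass-emitted-< p) i<k))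
left-low d⁰ d l p sub low (inj₂ (y≤k′ , k′<x , refl)) {i} i∈B i<x | inj₂ i∈C with pass-gap d p i∈C
... | inj₂ x≤i = ⊥-elim (<⇒≱ i<x x≤i)
... | inj₁ i≤y with m≤n⇒m<n∨m≡n i≤y
left-low d⁰ d (push q) p sub low (inj₂ _) i∈B i<x | inj₂ i∈C | inj₁ i≤y | inj₂ refl = pass-emitted-∈ q
left-low d⁰ d (grow _) p sub low (inj₂ _) i∈B i<x | inj₂ i∈C | inj₁ i≤y | inj₂ refl = here refl
left-low d⁰ d (push q) p sub low (inj₂ (y≤k′ , _)) i∈B i<x | inj₂ i∈C | inj₁ i≤y | inj₁ i<y =
  pass-∈⁻ q (low i∈C (<-≤-trans i<y y≤k′)) λ { refl → <-asym i<y (pass-emitted-< q) }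
left-low d⁰ d (grow _) p sub low (inj₂ (y≤k′ , _)) i∈B i<x | inj₂ i∈C | inj₁ i≤y | inj₁ i<y =
  there (low i∈C (<-≤-trans i<y y≤k′))

lefts-⊆ : Column B⁰ → Column B → Lefts B⁰ e [] → Emits B w e C → B⁰ ⊆ B
lefts-⊆ d⁰ d []       []       ()
lefts-⊆ d⁰ d (l ∷ ls) (p ∷ ps) = left-⊆ d⁰ d l p (lefts-⊆ (left-Column l d⁰) (pass-Column p d) ls ps)

column-split : Column B → y ∈ B → suc y ∈ B ⊎ Σ (List ℕ) λ W → Σ (List ℕ) λ Z → B ≡ W ++ y ∷ Z × All (Far y) W
column-split _        (here refl) = inj₂ ([] , _ , refl , [])
column-split {h ∷ B} (d ∷ ds) (there p) with column-split ds p | m≤n⇒m<n∨m≡n (All.lookup d p)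
... | inj₁ q | _ = inj₁ (there q)
... | inj₂ _ | inj₂ refl = inj₁ (here refl)
... | inj₂ (W , Z , refl , far) | inj₁ lt = inj₂ (h ∷ W , Z , refl , inj₁ lt ∷ far)

-- If `suc y` is missing, all letters of the column in front of `y` commute with `y`, and the two
-- copies of `y` cancel.
Red-front : Column B → Red (y ∷ B) → y ∈ B → suc y ∈ B
Red-front d r p with column-split d p
... | inj₁ q = q
... | inj₂ (W , Z , refl , far) = ⊥-elim (¬Red-cancel W far r)

-- One extra letter in the final column is carried back through a whole unwinding. The small column
-- `B⁰`, built by the same letters from the left, runs alongside to record which letters below the
-- extra one are old.
emits-insert : Column B⁰ → Column B → Lefts B⁰ e [] → Emits B w e A →
  Ins k A A′ → Column A′ → (∀ {i} → i ∈ A → ¬ i < k) → Red (e ++ A′) →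
  Σ ℕ λ k′ → Σ (List ℕ) λ B′ → Σ (List ℕ) λ v →
  Emits B′ v e A′ × Ins k′ B B′ × Column B′ × (∀ {i} → i ∈ B → i < k′ → i ∈ B⁰)
emits-insert d⁰ d []       []       s d′ low r = _ , _ , _ , [] , s , d′ , λ p q → ⊥-elim (low p q)
emits-insert {e = y ∷ e} {A′ = A′} d⁰ d (l ∷ ls) (p ∷ ps) s d′ low r
  with emits-insert (left-Column l d⁰) (pass-Column p d) ls ps s d′ low (Red-suffix [ y ] r)
... | k₁ , C′ , v , qs , t , dC , low₁ with pass-insert d p t dC (Red-front dC red)
  where
  red : Red (y ∷ C′)
  red = Red-prefix (y ∷ C′) v (Red-∼ (∼-congˡ [ y ] (∼-sym (passes-∼ dC (emits⇒passes qs)))) r)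
... | k₂ , B′ , x′ , q , t′ , dB , c =
  k₂ , B′ , x′ ∷ v , q ∷ qs , t′ , dB ,
  left-low d⁰ d l p (lefts-⊆ (left-Column l d⁰) (pass-Column p d) ls ps) low₁ c

hd : List (List ℕ) → List ℕ
hd []      = []
hd (D ∷ _) = D

-- Key ρ Ds: the columns of the left key of the class of ρ.  The first of them
-- is the column D for which ρ ∼ D w with D as long as the column A that ρ
-- leaves behind; the others are those of the word e pushed out by ρ.
data Key : List ℕ → List (List ℕ) → Set where
  []  : Key [] []
  key : Passes [] (x ∷ ρ) e A → Column D → Emits D w e A → Key e Ds → Key (x ∷ ρ) (D ∷ Ds)

-- Col ρ x j: on appending x to ρ, the new box lies in column j (counted from 0).
data Col : List ℕ → ℕ → ℕ → Set where
  stop : Passes [] ρ e A → Pass A x nothing B → Col ρ x 0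
  go   : Passes [] ρ e A → Pass A x (just y) B → Col e y j → Col ρ x (suc j)

data Add : List (List ℕ) → ℕ → ℕ → List (List ℕ) → Set where
  new   : Add [] 0 k ([ k ] ∷ [])
  now   : Ins k D D′ → Column D′ → (∀ {i} → i ∈ D → i < k → i ∈ hd Ds) → Add (D ∷ Ds) 0 k (D′ ∷ Ds)
  later : Add Ds j k Ds′ → Add (D ∷ Ds) (suc j) k (D ∷ Ds′)

passes-Red-emitted : Column B → Passes B w e C → Red (B ++ w) → Red (e ++ C)
passes-Red-emitted d ps = Red-∼ (passes-∼ d ps)

-- Rewriting `e` as `e₂ A₂` makes two consecutive key columns comparable: this word, inserted from
-- the left, builds `hd Ds` out of the empty column and `D` out of `A`.
key-lefts : Key e Ds → Red (e ++ A) → Column D → Emits D w e A →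
  Σ (List ℕ) λ f → Σ (List ℕ) λ v → e ∼ f × Column (hd Ds) × Lefts (hd Ds) f [] × Emits D v f A
key-lefts [] r d es = _ , _ , ε , [] , [] , es
key-lefts {A = A} (key {e = e₂} {A = A₂} ps d₂ es₂ _) r d es =
  let v , es′ = emits-invariant (passes-∼ [] ps) d r es
  in  e₂ ++ A₂ , v , passes-∼ [] ps , d₂ , lefts-++ (emits⇒lefts es₂) (column⇒lefts (passes-Column ps [])) , es′

key-⊆ : Key e Ds → Red (e ++ A) → Column D → Emits D w e A → hd Ds ⊆ D
key-⊆ k r d es with key-lefts k r d es
... | _ , _ , _ , d₂ , ls , es′ = lefts-⊆ d₂ d ls es′

column-∷ʳ : Pass A x nothing A′ → Column A → All (_> x) A
column-∷ʳ absorb       _       = []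
column-∷ʳ (skip x<h p) (_ ∷ d) = x<h ∷ column-∷ʳ p d

-- An absorbed letter is smaller than all of `A`. So no letter of `A` lies below the extra letter,
-- and the condition on low letters holds vacuously at the start of the unwinding.
key-absorb : Key e Ds → Red (e ++ A′) → Red (e ++ A) → Column A → Column D → Emits D w e A → Pass A x nothing A′ →
  Σ ℕ λ k → Σ (List ℕ) λ D′ → Σ (List ℕ) λ v →
  Emits D′ v e A′ × Ins k D D′ × Column D′ × (∀ {i} → i ∈ D → i < k → i ∈ hd Ds)
key-absorb {e} {A′ = A′} {A} k r r₀ dA d es p =
  let f , v , e∼f , d₂ , ls , es′ = key-lefts k r₀ d es
      k′ , D′ , v′ , es″ , s , dD , low =
        emits-insert d₂ d ls es′ ins (pass-Column p dA) (λ i∈A → <-asym (All.lookup (column-∷ʳ p dA) i∈A))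
          (Red-∼ (∼-congʳ A′ e∼f) r)
      v″ , es‴ = emits-invariant (∼-sym e∼f) dD (Red-∼ (∼-congʳ A′ e∼f) r) es″
  in  k′ , D′ , v″ , es‴ , s , dD , low
  where
  ins : Ins _ A A′
  ins = subst (Ins _ A) (sym (pass-absorb p)) (ins-∷ʳ A)

-- If the letter is absorbed, `e` and hence all later columns stay, and `D` gains an element. If it
-- pushes out `y`, it prolongs the unwinding that starts at `D`, so `D` stays and the question moves
-- on to `y` appended to `e`.
key-grow : Key ρ Ds → Red (ρ ++ [ x ]) →
  Σ ℕ λ j → Σ ℕ λ k → Σ (List (List ℕ)) λ Ds′ → Col ρ x j × Key (ρ ++ [ x ]) Ds′ × Add Ds j k Ds′
key-grow [] r = 0 , _ , _ , stop [] absorb , key (keep absorb []) ([] ∷ []) [] [] , new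
key-grow {x ∷ ρ} {x = z} (key {e = e} {A = A} {w = w} ps d es k) r
  with pass-total {x = z} (passes-Column ps []) (passes-Red [] ps r)
... | nothing , A′ , p =
  let ps′ = subst (λ f → Passes [] (x ∷ ρ ++ [ z ]) f A′) (++-identityʳ e) (passes-++ ps (keep p []))
      k′ , D′ , v , es′ , s , dD , low =
        key-absorb k (passes-Red-emitted [] ps′ r) (passes-Red-emitted [] ps (Red-prefix (x ∷ ρ) [ z ] r))
          (passes-Column ps []) d es p
  in  0 , k′ , _ , stop ps p , key ps′ dD es′ k , now s dD low
... | just y , A′ , p =
  let ps′ = passes-++ ps (emit p [])
      j , k′ , Ds′ , c , k″ , a = key-grow k (Red-prefix (e ++ [ y ]) A′ (passes-Red-emitted [] ps′ r))
  in  suc j , k′ , _ , go ps p c , key ps′ d (emits-++ es (p ∷ [])) k″ , later a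

key-extend : Key ρ Ds → ∀ τ → Red (ρ ++ τ) → Σ (List (List ℕ)) λ Ds′ → Key (ρ ++ τ) Ds′
key-extend {ρ} k [] r = _ , subst (λ ρ → Key ρ _) (sym (++-identityʳ ρ)) k
key-extend {ρ} k (x ∷ τ) r =
  let r′ = subst Red (sym (++-assoc ρ [ x ] τ)) r
      _ , _ , _ , _ , k′ , _ = key-grow k (Red-prefix (ρ ++ [ x ]) τ r′)
      Ds′ , k″ = key-extend k′ τ r′
  in  Ds′ , subst (λ ρ → Key ρ Ds′) (++-assoc ρ [ x ] τ) k″

key-total : Red ρ → Σ (List (List ℕ)) λ Ds → Key ρ Ds
key-total {ρ} = key-extend [] ρ

key-unique : ρ ∼ τ → Red ρ → Key ρ Ds → Key τ Es → Ds ≡ Es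
key-unique p r []                 []                     = refl
key-unique p r []                 (key _ _ _ _) with ∼-length p
... | ()
key-unique p r (key _ _ _ _) [] with ∼-length p
... | ()
key-unique p r (key ps d es k) (key ps′ d′ es′ k′) with passes-invariant p r ps
... | _ , qs , e∼f with passes-functional qs ps′
... | refl , refl with emits-invariant e∼f d (passes-Red-emitted [] ps r) es
... | _ , fs with emits-injective d d′ fs es′
... | refl , _ = cong (_ ∷_) (key-unique e∼f (Red-prefix _ _ (passes-Red-emitted [] ps r)) k k′)

Nested : List (List ℕ) → Set
Nested []       = ⊤
Nested (D ∷ Ds) = hd Ds ⊆ D × Nested Ds

key-nested : Key ρ Ds → Red ρ → Nested Ds
key-nested []              r = tt
key-nested (key ps d es k) r =
  key-⊆ k (passes-Red-emitted [] ps r) d es , key-nested k (Red-prefix _ _ (passes-Red-emitted [] ps r))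

-- Counting stops at the first column without `i`; for nested columns this still counts every column
-- that contains `i`.
height : List (List ℕ) → ℕ → ℕ
height []       i = 0
height (D ∷ Ds) i with i ∈? D
... | yes _ = suc (height Ds i)
... | no _  = 0

height-∈ : i ∈ D → height (D ∷ Ds) i ≡ suc (height Ds i)
height-∈ {i} {D} p with i ∈? D
... | yes _ = refl
... | no q  = ⊥-elim (q p)

height-∉ : i ∉ D → height (D ∷ Ds) i ≡ 0
height-∉ {i} {D} p with i ∈? D
... | yes q = ⊥-elim (p q)
... | no _  = refl

height-suc⁻ : ∀ Ds → height Ds i ≡ suc j → i ∈ hd Ds
height-suc⁻ {i} (D ∷ Ds) eq with i ∈? D
... | yes p = p
... | no _ with eq
... | ()

height-0⁻ : ∀ Ds → height Ds i ≡ 0 → i ∉ hd Ds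
height-0⁻ (D ∷ Ds) eq p with trans (sym (height-∈ {Ds = Ds} p)) eq
... | ()

height-∉-hd : ∀ Ds → i ∉ hd Ds → height Ds i ≡ 0
height-∉-hd []       p = refl
height-∉-hd (D ∷ Ds) p = height-∉ p

add-∈ : Nested Ds′ → Add Ds j k Ds′ → k ∈ hd Ds′
add-∈ n         new         = here refl
add-∈ n         (now s _ _) = ins-∈ s
add-∈ (sub , n) (later a)   = sub (add-∈ n a)

add-height : Nested Ds → Nested Ds′ → Add Ds j k Ds′ → height Ds k ≡ j × height Ds′ k ≡ suc j
add-height n n′ new = refl , height-∈ (here refl)
add-height {Ds = D ∷ Ds} (sub , n) n′ (now s d _) =
  height-∉ (ins-∉ s d) , trans (height-∈ (ins-∈ s)) (cong suc (height-∉-hd Ds (ins-∉ s d ∘ sub)))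
add-height (sub , n) (sub′ , n′) (later a) with add-height n n′ a | sub′ (add-∈ n′ a)
... | eq , eq′ | p = trans (height-∈ p) (cong suc eq) , trans (height-∈ p) (cong suc eq′)

add-other : Add Ds j k Ds′ → i ≢ k → height Ds′ i ≡ height Ds i
add-other {k = k} {i = i} new i≢k = height-∉ λ { (here eq) → i≢k eq }
add-other {Ds = D ∷ Ds} {k = k} {Ds′ = D′ ∷ _} {i = i} (now s _ _) i≢k with i ∈? D | i ∈? D′
... | yes p | yes q = refl
... | no p  | no q  = refl
... | yes p | no q  = ⊥-elim (q (ins-⊆ s p))
... | no p  | yes q with ins-∈⁻ s q
...   | inj₁ eq = ⊥-elim (i≢k eq)
...   | inj₂ r  = ⊥-elim (p r)
add-other {Ds = D ∷ Ds} {i = i} (later a) i≢k with i ∈? D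
... | yes _ = cong suc (add-other a i≢k)
... | no _  = refl

-- A row of length `suc j` has its index in the enlarged column but not in the next one, whereas
-- below `k` the enlarged column had nothing outside the next.
add-low : Add Ds j k Ds′ → i < k → height Ds i ≢ suc j
add-low new i<k ()
add-low {Ds = D ∷ Ds} {i = i} (now s _ low) i<k eq with i ∈? D
... | no _  with eq
...   | ()
add-low {Ds = D ∷ Ds} (now s _ low) i<k eq | yes p = height-0⁻ Ds (suc-injective eq) (low p i<k)
add-low {Ds = D ∷ Ds} {i = i} (later a) i<k eq with i ∈? D
... | yes _ = add-low a i<k (suc-injective eq)
... | no _  with eq
...   | ()

col-functional : Col ρ x i → Col ρ x j → i ≡ j
col-functional (stop ps p) (stop qs q) = refl
col-functional (stop ps p) (go qs q _) with passes-functional ps qs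
... | refl , refl with pass-functional p q
...   | () , _
col-functional (go ps p _) (stop qs q) with passes-functional ps qs
... | refl , refl with pass-functional p q
...   | () , _
col-functional (go ps p c) (go qs q d) with passes-functional ps qs
... | refl , refl with pass-functional p q
...   | refl , refl = cong suc (col-functional c d)

passes-snoc : Passes [] ρ e A → Pass A x nothing B → Passes [] (ρ ++ [ x ]) e B
passes-snoc {ρ} {e} {x = x} {B = B} ps p =
  subst (λ f → Passes [] (ρ ++ [ x ]) f B) (++-identityʳ e) (passes-++ ps (keep p []))

col-ascent : Col ρ x i → Col (ρ ++ [ x ]) y j → x < y → i < j
col-ascent (stop ps p) (go qs q _) x<y = s≤s z≤n
col-ascent (stop ps p) (stop qs q) x<y with passes-functional (passes-snoc ps p) qs
... | refl , refl with ascent-emits p q x<y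
...   | _ , () , _
col-ascent (go ps p c) (stop qs q) x<y with passes-functional (passes-++ ps (emit p [])) qs
... | refl , refl with ascent-emits p q x<y
...   | _ , () , _
col-ascent (go ps p c) (go qs q d) x<y with passes-functional (passes-++ ps (emit p [])) qs
... | refl , refl with ascent-emits p q x<y
...   | _ , refl , lt = s≤s (col-ascent c d (lt refl))

col-descent : Col ρ x i → Col (ρ ++ [ x ]) y j → y < x → j ≤ i
col-descent _           (stop _ _)  y<x = z≤n
col-descent (stop ps p) (go qs q _) y<x with passes-functional (passes-snoc ps p) qs
... | refl , refl with descent-absorbs p q y<x
...   | ()
col-descent (go ps p c) (go qs q d) y<x with passes-functional (passes-++ ps (emit p [])) qs
... | refl , refl = s≤s (col-descent c d (descent-emits (passes-Column ps []) p q y<x))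

-- An absorbed `x` is the last letter of the column left by `ρ x`. Otherwise the emitted letter is
-- recovered one column further on, and the step that emitted it is injective.
col-unique : Red (ρ ++ [ x ]) → (ρ ++ [ x ]) ∼ (τ ++ [ y ]) → Col ρ x j → Col τ y j → x ≡ y × ρ ∼ τ
col-unique r eq (stop ps p) (stop qs q) with passes-invariant eq r (passes-snoc ps p)
... | _ , ps′ , e∼f with passes-functional ps′ (passes-snoc qs q)
... | refl , B≡B with ∷ʳ-injective _ _ (trans (sym (pass-absorb p)) (trans B≡B (pass-absorb q)))
... | refl , refl = refl , passes-∼ [] ps ◅◅ ∼-congʳ _ e∼f ◅◅ ∼-sym (passes-∼ [] qs)
col-unique r eq (go ps p c) (go qs q d) with passes-invariant eq r (passes-++ ps (emit p []))
... | _ , ps′ , e∼f with passes-functional ps′ (passes-++ qs (emit q []))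
... | refl , refl
  with col-unique (Red-prefix _ _ (passes-Red-emitted [] (passes-++ ps (emit p [])) r)) e∼f c d
... | refl , e∼f′ with pass-injective (passes-Column ps []) (passes-Column qs []) p q
... | refl , refl = refl , passes-∼ [] ps ◅◅ ∼-congʳ _ e∼f′ ◅◅ ∼-sym (passes-∼ [] qs)

-- Removal of a box

column-passes : ∀ B → Column (B ++ C) → Passes B C [] (B ++ C)
column-passes {[]}    B d = subst (λ D → Passes B [] [] D) (sym (++-identityʳ B)) []
column-passes {x ∷ C} B d =
  subst (Passes B (x ∷ C) []) (++-assoc B [ x ] C)
    (keep (absorbed B d) (column-passes (B ++ [ x ]) (subst Column (sym (++-assoc B [ x ] C)) d)))
  where
  absorbed : ∀ B → Column (B ++ x ∷ C) → Pass B x nothing (B ++ [ x ])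
  absorbed []      _        = absorb
  absorbed (b ∷ B) (p ∷ ds) = skip (All.lookup p (∈-++⁺ʳ B (here refl))) (absorbed B ds)

pass-emit-length : Pass B x (just y) C → length B ≡ length C
pass-emit-length (bump _)   = refl
pass-emit-length twist      = refl
pass-emit-length (skip _ p) = cong suc (pass-emit-length p)

emits-column-length : Emits B w e C → length B ≡ length C
emits-column-length []       = refl
emits-column-length (p ∷ ps) = trans (pass-emit-length p) (emits-column-length ps)

LastAbsorbed : List ℕ → List ℕ → List ℕ → Set
LastAbsorbed C w D = Σ (List ℕ) λ w₁ → Σ ℕ λ z → Σ (List ℕ) λ e₁ → Σ (List ℕ) λ M →
  w ≡ w₁ ++ [ z ] × Passes C w₁ e₁ M × Pass M z nothing D

last-absorbed-∷ : Column (x ∷ w) → Pass B x nothing C → Passes C w e D → LastAbsorbed B (x ∷ w) D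
last-absorbed-∷ _ p [] = [] , _ , _ , _ , refl , [] , p
last-absorbed-∷ ((y<x ∷ _) ∷ _) p (emit q qs) with descent-absorbs p q y<x
... | ()
last-absorbed-∷ (_ ∷ d) p (keep q qs) with last-absorbed-∷ d q qs
... | w₁ , z , _ , _ , eq , rs , r = _ ∷ w₁ , z , _ , _ , cong (_ ∷_) eq , keep p rs , r

-- Along a decreasing word absorption persists: after one absorbed letter all later ones are
-- absorbed. So the last letter is absorbed as soon as the column grows at all.
last-absorbed : Column w → Passes C w e D → length D ≡ length C ⊎ LastAbsorbed C w D
last-absorbed d       []          = inj₁ refl
last-absorbed d       (keep p ps) = inj₂ (last-absorbed-∷ d p ps)
last-absorbed (_ ∷ d) (emit p ps) with last-absorbed d ps
... | inj₁ eq = inj₁ (trans eq (sym (pass-emit-length p)))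
... | inj₂ (w₁ , z , _ , _ , eq , rs , r) = inj₂ (_ ∷ w₁ , z , _ , _ , cong (_ ∷_) eq , emit p rs , r)

column-⊆-tail : Column (b ∷ B) → (b ∷ B) ⊆ (b ∷ C) → B ⊆ C
column-⊆-tail (d ∷ _) sub p with sub (there p)
... | here refl = ⊥-elim (<-irrefl refl (All.lookup d p))
... | there q   = q

column-⊆-skip : Column (b ∷ B) → Column (c ∷ C) → b ≢ c → (b ∷ B) ⊆ (c ∷ C) → (b ∷ B) ⊆ C
column-⊆-skip dB dC b≢c sub (here refl) with sub (here refl)
... | here eq = ⊥-elim (b≢c eq)
... | there q = q
column-⊆-skip dB@(b> ∷ _) dC@(c> ∷ _) b≢c sub (there p) with sub (there p)
... | there q   = q
... | here refl with sub (here refl)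
...   | here eq  = ⊥-elim (b≢c eq)
...   | there q  = ⊥-elim (<-asym (All.lookup b> p) (All.lookup c> q))

column-length-≤ : Column B → Column C → B ⊆ C → length B ≤ length C
column-length-≤ {[]}            dB dC sub = z≤n
column-length-≤ {b ∷ B} {[]}    dB dC sub with sub (here refl)
... | ()
column-length-≤ {b ∷ B} {c ∷ C} dB@(_ ∷ dB′) dC@(_ ∷ dC′) sub with b ≟ c
... | yes refl = s≤s (column-length-≤ dB′ dC′ (column-⊆-tail dB sub))
... | no b≢c   = m≤n⇒m≤1+n (column-length-≤ dB dC′ (column-⊆-skip dB dC b≢c sub))

column-length-< : Column B → Column C → B ⊆ C → i ∈ C → i ∉ B → length B < length C
column-length-< {[]} {c ∷ C}    dB dC sub i∈C i∉B = s≤s z≤n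
column-length-< {b ∷ B} {c ∷ C} dB@(_ ∷ dB′) dC@(_ ∷ dC′) sub i∈C i∉B with b ≟ c
... | no b≢c   = s≤s (column-length-≤ dB dC′ (column-⊆-skip dB dC b≢c sub))
column-length-< {b ∷ B} dB dC sub (here refl) i∉B | yes refl = ⊥-elim (i∉B (here refl))
column-length-< {b ∷ B} dB@(_ ∷ dB′) dC@(_ ∷ dC′) sub (there p) i∉B | yes refl =
  s≤s (column-length-< dB′ dC′ (column-⊆-tail dB sub) p (i∉B ∘ there))

key-column : Key ρ Ds → Column (hd Ds)
key-column []            = []
key-column (key _ d _ _) = d

key-length : Key ρ Ds → Passes [] ρ e A → length (hd Ds) ≡ length A
key-length []               []  = refl
key-length (key ps d es _)  qs with passes-functional ps qs
... | refl , refl = emits-column-length es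

-- For `j = 0` the row `i` ends in the first column, so `D` is longer than the next key column.
-- Passing `A` after `e` must then enlarge the column left by `e`, and the last letter of `A` is
-- absorbed. For larger `j` a last letter `y` of `e` is split off; in the unwinding, the letter that
-- pushes out `y` comes last.
key-remove : Red ρ → Key ρ Ds → height Ds i ≡ suc j →
  Σ (List ℕ) λ ρ′ → Σ ℕ λ x → (ρ′ ++ [ x ]) ∼ ρ × Col ρ′ x j
key-remove {i = i} r (key {D = D} ps d es k) eq with i ∈? D
... | no _ with eq
...   | ()
key-remove {i = i} {j = zero} r (key {e = e} {A = A} {D = D} {Ds = Ds} ps d es k) eq | yes i∈D
  with passes-invariant (passes-∼ [] ps) r ps
... | _ , qs , _ with passes-++⁻ e qs
... | C , _ , _ , _ , qs₁ , qs₂ with last-absorbed (passes-Column ps []) qs₂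
... | inj₂ (w₁ , z , _ , M , A≡ , rs , p) =
  e ++ w₁ , z ,
  ∼-reflexive (trans (++-assoc e w₁ [ z ]) (cong (e ++_) (sym A≡))) ◅◅ ∼-sym (passes-∼ [] ps) ,
  stop (passes-++ qs₁ rs) p
... | inj₁ len = ⊥-elim (<-irrefl
  (trans (key-length k qs₁) (trans (sym len) (sym (emits-column-length es))))
  (column-length-< (key-column k) d (key-⊆ k (passes-Red-emitted [] ps r) d es) i∈D i∉))
  where
  i∉ : i ∉ hd Ds
  i∉ = height-0⁻ Ds (suc-injective eq)
key-remove {i = i} {j = suc j} r (key {e = e} {A = A} {D = D} ps d es k) eq | yes i∈D
  with key-remove (Red-prefix e A (passes-Red-emitted [] ps r)) k (suc-injective eq)
... | τ , y , τy∼e , c with emits-invariant (∼-sym τy∼e) d (passes-Red-emitted [] ps r) es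
... | _ , es′ with emits-++⁻ τ es′
... | _ , v₁ , (x ∷ []) , refl , es₁ , (p ∷ []) =
  D ++ v₁ , x ,
  ∼-reflexive (++-assoc D v₁ [ x ]) ◅◅ passes-∼ d (emits⇒passes es′) ◅◅ ∼-congʳ A τy∼e ◅◅ ∼-sym (passes-∼ [] ps) ,
  go (passes-++ (column-passes [] d) (emits⇒passes es₁)) p c

-- Every letter pushes out a smaller one. This smaller letter belongs to `B` or entered earlier, and
-- then it pushed out a still smaller one.
emits-above : Emits B w e C → x ∈ w → Σ ℕ λ k → k ∈ B × k < x
emits-above (p ∷ ps) (here refl) = _ , pass-emitted-∈ p , pass-emitted-< p
emits-above {B = B} (_∷_ {x = z} p ps) (there q) with emits-above ps q
... | k , k∈C , k<x with k ≟ z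
...   | no k≢z  = k , pass-∈⁻ p k∈C k≢z , k<x
...   | yes refl = _ , pass-emitted-∈ p , <-trans (pass-emitted-< p) k<x

key-∼ : (ps : Passes [] ρ e A) → Column D → Emits D w e A → ρ ∼ (D ++ w)
key-∼ ps d es = passes-∼ [] ps ◅◅ ∼-sym (passes-∼ d (emits⇒passes es))

key-letter : Key ρ Ds → x ∈ ρ → Σ ℕ λ k → k ≤ x × Σ ℕ λ j → height Ds k ≡ suc j
key-letter (key {D = D} ps d es k) x∈ρ with ∈-++⁻ D (∼-∈ (∼-sym (key-∼ ps d es)) x∈ρ)
... | inj₁ p = _ , ≤-refl , _ , height-∈ p
... | inj₂ p with emits-above es p
...   | k′ , k∈D , k<x = k′ , <⇒≤ k<x , _ , height-∈ k∈D

key-letter⁻ : Key ρ Ds → height Ds i ≡ suc j → i ∈ ρ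
key-letter⁻ {Ds = Ds} K@(key ps d es k) eq = ∼-∈ (key-∼ ps d es) (∈-++⁺ˡ (height-suc⁻ Ds eq))

-- The diagram of a reduced word

abstract
  -- The proof argument only guarantees that the key columns exist; `ht-cong` makes the value
  -- independent of it and constant on classes.
  ht : Red ρ → ℕ → ℕ
  ht r = height (proj₁ (key-total r))

  ht-cong : ρ ∼ τ → (r : Red ρ) (s : Red τ) → ∀ i → ht r i ≡ ht s i
  ht-cong p r s i = cong (λ Ds → height Ds i) (key-unique p r (proj₂ (key-total r)) (proj₂ (key-total s)))

  ht-[] : (r : Red []) → ∀ i → ht r i ≡ 0
  ht-[] r i = refl

-- `Col` counts columns from 0, so the new box is in column `suc j` of the diagram. The field `low`
-- is the source of condition (c) of key tableaux.
record Growth {ρ x} (r : Red ρ) (s : Red (ρ ++ [ x ])) (j : ℕ) : Set where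
  field
    col    : Col ρ x j
    row    : ℕ
    before : ht r row ≡ j
    after  : ht s row ≡ suc j
    other  : ∀ {i} → i ≢ row → ht s i ≡ ht r i
    low    : ∀ {i} → i < row → ht r i ≢ suc j

abstract
  growth : (r : Red ρ) (s : Red (ρ ++ [ x ])) → Σ ℕ (Growth r s)
  growth r s =
    let Ds , K = key-total r
        Es , L = key-total s
        j , k , Ds′ , c , K′ , a = key-grow K s
        Ds′≡Es = key-unique ε s K′ L
        a′ = subst (Add Ds j k) Ds′≡Es a
        b , af = add-height (key-nested K r) (key-nested L s) a′
    in  j , record { col = c ; row = k ; before = b ; after = af ; other = add-other a′ ; low = add-low a′ }

  ht-remove : (r : Red ρ) → ht r i ≡ suc j → Σ (List ℕ) λ ρ′ → Σ ℕ λ x → (ρ′ ++ [ x ]) ∼ ρ × Col ρ′ x j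
  ht-remove r = key-remove r (proj₂ (key-total r))

  ht-letter : (r : Red ρ) → x ∈ ρ → Σ ℕ λ k → k ≤ x × 0 < ht r k
  ht-letter r x∈ρ with key-letter (proj₂ (key-total r)) x∈ρ
  ... | k , k≤x , j , eq = k , k≤x , subst (0 <_) (sym eq) (s≤s z≤n)

  ht-letter⁻ : (r : Red ρ) → 0 < ht r i → i ∈ ρ
  ht-letter⁻ {i = i} r lt with ht r i in eq
  ... | suc j = key-letter⁻ (proj₂ (key-total r)) eq
  ... | zero with lt
  ...   | ()

-- Strips and increasing words

growth-≤ : ∀ {r : Red ρ} {s : Red (ρ ++ [ x ])} → Growth r s j → ∀ i → ht r i ≤ ht s i
growth-≤ g i with i ≟ Growth.row g
... | yes refl = subst₂ _≤_ (sym (Growth.before g)) (sym (Growth.after g)) (n≤1+n _)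
... | no i≢k   = ≤-reflexive (sym (Growth.other g i≢k))

growth-box : ∀ {r : Red ρ} {s : Red (ρ ++ [ x ])} (g : Growth r s j) → ht r i < c → c ≤ ht s i → i ≡ Growth.row g × c ≡ suc j
growth-box {i = i} g lt le with i ≟ Growth.row g
... | no i≢k   = ⊥-elim (<⇒≱ lt (subst (_ ≤_) (Growth.other g i≢k) le))
... | yes refl = refl , ≤-antisym (subst (_ ≤_) (Growth.after g) le) (subst (_< _) (Growth.before g) lt)

Red-split : ∀ ρ x τ → Red (ρ ++ x ∷ τ) → Red (ρ ++ [ x ])
Red-split ρ x τ r = Red-prefix (ρ ++ [ x ]) τ (subst Red (sym (++-assoc ρ [ x ] τ)) r)

Red-assoc : ∀ ρ x τ → Red (ρ ++ x ∷ τ) → Red ((ρ ++ [ x ]) ++ τ)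
Red-assoc ρ x τ = subst Red (sym (++-assoc ρ [ x ] τ))

ht-assoc : ∀ ρ x τ (r : Red (ρ ++ x ∷ τ)) i → ht (Red-assoc ρ x τ r) i ≡ ht r i
ht-assoc ρ x τ r = ht-cong (∼-reflexive (++-assoc ρ [ x ] τ)) (Red-assoc ρ x τ r) r

ht-mono : ∀ τ (r : Red ρ) (s : Red (ρ ++ τ)) i → ht r i ≤ ht s i
ht-mono {ρ} []      r s i = ≤-reflexive (ht-cong (∼-reflexive (sym (++-identityʳ ρ))) r s i)
ht-mono {ρ} (x ∷ τ) r s i = begin
  ht r i                    ≤⟨ growth-≤ (proj₂ (growth r (Red-split ρ x τ s))) i ⟩
  ht (Red-split ρ x τ s) i  ≤⟨ ht-mono τ (Red-split ρ x τ s) (Red-assoc ρ x τ s) i ⟩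
  ht (Red-assoc ρ x τ s) i  ≡⟨ ht-assoc ρ x τ s i ⟩
  ht s i                    ∎
  where open ≤-Reasoning

-- Conditions (b) and (c) of key tableaux for the boxes of a single entry, which
-- are those of a outside b.
record Strip (b a : ℕ → ℕ) : Set where
  field
    sub  : ∀ i → b i ≤ a i
    one  : ∀ {i k c} → b i < c → c ≤ a i → b k < c → c ≤ a k → i ≡ k
    cond : ∀ {i k c} → i < k → b k < c → c ≤ a k → c ≤ b i → c < b i

strip-resp : ∀ {a a′ b b′ : ℕ → ℕ} → (∀ i → a i ≡ a′ i) → (∀ i → b i ≡ b′ i) → Strip b a → Strip b′ a′
strip-resp {a} {a′} {b} {b′} p q s = record
  { sub  = λ i → subst₂ _≤_ (q i) (p i) (sub i)
  ; one  = λ {i} {k} {c} h₁ h₂ h₃ h₄ → one (subst (_< c) (sym (q i)) h₁) (subst (c ≤_) (sym (p i)) h₂)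
             (subst (_< c) (sym (q k)) h₃) (subst (c ≤_) (sym (p k)) h₄)
  ; cond = λ {i} {k} {c} i<k h₁ h₂ h₃ → subst (c <_) (q i) (cond i<k (subst (_< c) (sym (q k)) h₁)
             (subst (c ≤_) (sym (p k)) h₂) (subst (c ≤_) (sym (q i)) h₃))
  }
  where open Strip s

strip-refl : ∀ {a : ℕ → ℕ} → Strip a a
strip-refl = record
  { sub  = λ _ → ≤-refl
  ; one  = λ h₁ h₂ → ⊥-elim (<⇒≱ h₁ h₂)
  ; cond = λ _ h₁ h₂ → ⊥-elim (<⇒≱ h₁ h₂)
  }

-- The columns of the boxes added by an increasing word increase strictly, so
-- no box of the strip lies to the left of the first one.
increasing-strip′ : (r : Red ρ) (s : Red (ρ ++ x ∷ w)) → Col ρ x j → Increasing (x ∷ w) →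
  Strip (ht r) (ht s) × (∀ {i c} → ht r i < c → c ≤ ht s i → j < c)
increasing-strip′ {ρ} {x} {[]} r s c [-] with growth r s
... | j′ , g with col-functional (Growth.col g) c
... | refl = record
  { sub  = growth-≤ g
  ; one  = λ h₁ h₂ h₃ h₄ → trans (proj₁ (growth-box g h₁ h₂)) (sym (proj₁ (growth-box g h₃ h₄)))
  ; cond = λ i<k h₁ h₂ h₃ → low i<k (growth-box g h₁ h₂) h₃
  } , λ h₁ h₂ → ≤-reflexive (sym (proj₂ (growth-box g h₁ h₂)))
  where
  low : ∀ {i k c} → i < k → k ≡ Growth.row g × c ≡ suc j′ → c ≤ ht r i → c < ht r i
  low i<k (refl , refl) c≤ = ≤∧≢⇒< c≤ (≢-sym (Growth.low g i<k))
increasing-strip′ {ρ} {x} {y ∷ w} {j} r s c (x<y ∷ inc) with growth r (Red-split ρ x (y ∷ w) s)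
... | j′ , g with col-functional (Growth.col g) c
... | refl = record
  { sub  = λ i → ≤-trans (growth-≤ g i) (Strip.sub st i)
  ; one  = one
  ; cond = cond
  } , bound
  where
  t : Red (ρ ++ [ x ])
  t = Red-split ρ x (y ∷ w) s
  s′ : Red ((ρ ++ [ x ]) ++ y ∷ w)
  s′ = Red-assoc ρ x (y ∷ w) s
  next : Σ ℕ λ j₁ → Col (ρ ++ [ x ]) y j₁
  next = let j₁ , g₁ = growth t (Red-split (ρ ++ [ x ]) y w s′) in j₁ , Growth.col g₁
  j₁ = proj₁ next
  j<j₁ : j < j₁
  j<j₁ = col-ascent c (proj₂ next) x<y
  rec = increasing-strip′ t s′ (proj₂ next) inc
  st : Strip (ht t) (ht s)
  st = strip-resp (ht-assoc ρ x (y ∷ w) s) (λ _ → refl) (proj₁ rec)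
  bound₁ : ∀ {i c} → ht t i < c → c ≤ ht s i → j₁ < c
  bound₁ h₁ h₂ = proj₂ rec h₁ (subst (_ ≤_) (sym (ht-assoc ρ x (y ∷ w) s _)) h₂)
  split : ∀ {i c} → ht r i < c → c ≤ ht s i → (i ≡ Growth.row g × c ≡ suc j) ⊎ ht t i < c
  split {i} {c} h₁ h₂ with c ≤? ht t i
  ... | yes le = inj₁ (growth-box g h₁ le)
  ... | no ≰   = inj₂ (≰⇒> ≰)
  bound : ∀ {i c} → ht r i < c → c ≤ ht s i → j < c
  bound h₁ h₂ with split h₁ h₂
  ... | inj₁ (refl , refl) = ≤-refl
  ... | inj₂ h             = <-trans j<j₁ (bound₁ h h₂)
  one : ∀ {i k c} → ht r i < c → c ≤ ht s i → ht r k < c → c ≤ ht s k → i ≡ k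
  one h₁ h₂ h₃ h₄ with split h₁ h₂ | split h₃ h₄
  ... | inj₁ (refl , refl) | inj₁ (refl , _)    = refl
  ... | inj₂ h             | inj₂ h′            = Strip.one st h h₂ h′ h₄
  ... | inj₁ (refl , refl) | inj₂ h′            = ⊥-elim (<⇒≱ (bound₁ h′ h₄) j<j₁)
  ... | inj₂ h             | inj₁ (refl , refl) = ⊥-elim (<⇒≱ (bound₁ h h₂) j<j₁)
  cond : ∀ {i k c} → i < k → ht r k < c → c ≤ ht s k → c ≤ ht r i → c < ht r i
  cond {i} i<k h₁ h₂ h₃ with split h₁ h₂
  ... | inj₁ (refl , refl) = ≤∧≢⇒< h₃ (≢-sym (Growth.low g i<k))
  ... | inj₂ h with i ≟ Growth.row g
  ...   | no i≢k = subst (_ <_) (Growth.other g i≢k) (Strip.cond st i<k h h₂ (≤-trans h₃ (growth-≤ g i)))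
  -- Later boxes lie in columns beyond `suc j`, but the row of the first box had only length `j`.
  ...   | yes refl = ⊥-elim (<⇒≱ (<-trans j<j₁ (bound₁ h h₂)) (subst (_ ≤_) (Growth.before g) h₃))

increasing-strip : ∀ w (r : Red ρ) (s : Red (ρ ++ w)) → Increasing w → Strip (ht r) (ht s)
increasing-strip {ρ} [] r s _ =
  strip-resp (ht-cong (∼-reflexive (sym (++-identityʳ ρ))) r s) (λ _ → refl) strip-refl
increasing-strip {ρ} (x ∷ w) r s inc =
  proj₁ (increasing-strip′ r s (Growth.col (proj₂ (growth r (Red-split ρ x w s)))) inc)

increasing-strip-last : ∀ w (r : Red ρ) (s : Red (ρ ++ w ++ [ x ])) → Increasing (w ++ [ x ]) → Col (ρ ++ w) x j →
  ∀ {i c} → ht r i < c → c ≤ ht s i → c ≤ suc j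
increasing-strip-last {ρ} {x} {j} [] r s inc c h₁ h₂ with growth r s
... | j′ , g with col-functional (Growth.col g) (subst (λ ρ → Col ρ x j) (++-identityʳ ρ) c)
... | refl = ≤-reflexive (proj₂ (growth-box g h₁ h₂))
increasing-strip-last {ρ} {x} {j} (y ∷ w) r s inc c {i} {d} h₁ h₂ with d ≤? ht (Red-split ρ y (w ++ [ x ]) s) i
... | no ≰ = increasing-strip-last w (Red-split ρ y (w ++ [ x ]) s) (Red-assoc ρ y (w ++ [ x ]) s) (Linked.tail inc)
  (subst (λ ρ → Col ρ x j) (sym (++-assoc ρ [ y ] w)) c) (≰⇒> ≰) (subst (d ≤_) (sym (ht-assoc ρ y (w ++ [ x ]) s i)) h₂)
... | yes le with growth r (Red-split ρ y (w ++ [ x ]) s)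
...   | j₀ , g with growth-box g h₁ le
...     | refl , refl = proj₂ (increasing-strip′ r s (Growth.col g) inc) h₃ h₄
  where
  s₁ : Red ((ρ ++ y ∷ w) ++ [ x ])
  s₁ = subst Red (sym (++-assoc ρ (y ∷ w) [ x ])) s
  r₁ : Red (ρ ++ y ∷ w)
  r₁ = Red-prefix (ρ ++ y ∷ w) [ x ] s₁
  last : Σ ℕ (Growth r₁ s₁)
  last = growth r₁ s₁
  gl = proj₂ last
  j≡ : proj₁ last ≡ j
  j≡ = col-functional (Growth.col gl) c
  h₃ : ht r (Growth.row gl) < suc j
  h₃ = s≤s (≤-trans (ht-mono (y ∷ w) r r₁ _) (≤-reflexive (trans (Growth.before gl) j≡)))
  h₄ : suc j ≤ ht s (Growth.row gl)
  h₄ = ≤-reflexive (trans (sym (trans (Growth.after gl) (cong suc j≡)))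
    (ht-cong (∼-reflexive (++-assoc ρ (y ∷ w) [ x ])) s₁ s _))

ht-grows : ∀ w (r : Red ρ) (s : Red (ρ ++ w ++ [ x ])) → Σ ℕ λ i → ht r i < ht s i
ht-grows {ρ} {x} w r s = Growth.row g , (begin-strict
  ht r (Growth.row g)   ≤⟨ ht-mono w r r₁ _ ⟩
  ht r₁ (Growth.row g)  ≡⟨ Growth.before g ⟩
  proj₁ last            <⟨ n<1+n _ ⟩
  suc (proj₁ last)      ≡⟨ Growth.after g ⟨
  ht s₁ (Growth.row g)  ≡⟨ ht-cong (∼-reflexive (++-assoc ρ w [ x ])) s₁ s _ ⟩
  ht s (Growth.row g)   ∎)
  where
  open ≤-Reasoning
  s₁ : Red ((ρ ++ w) ++ [ x ])
  s₁ = subst Red (sym (++-assoc ρ w [ x ])) s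
  r₁ : Red (ρ ++ w)
  r₁ = Red-prefix (ρ ++ w) [ x ] s₁
  last : Σ ℕ (Growth r₁ s₁)
  last = growth r₁ s₁
  g = proj₂ last

-- Increasing words that realise a given strip

increasing-init : ∀ w → Increasing (w ++ [ x ]) → Increasing w
increasing-init []          _         = []
increasing-init (y ∷ [])    _         = [-]
increasing-init (y ∷ z ∷ w) (p ∷ inc) = p ∷ increasing-init (z ∷ w) inc

increasing-∷ʳ : ∀ w → Increasing w → (∀ v y → w ≡ v ∷ʳ y → y < x) → Increasing (w ++ [ x ])
increasing-∷ʳ []          _         _ = [-]
increasing-∷ʳ (y ∷ [])    _         h = h [] y refl ∷ [-]
increasing-∷ʳ (y ∷ z ∷ w) (p ∷ inc) h = p ∷ increasing-∷ʳ (z ∷ w) inc λ v t eq → h (y ∷ v) t (cong (y ∷_) eq)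

-- The last letter of an increasing word adds the rightmost box of the strip, so its column can be
-- read off from the two diagrams alone. Used in both directions, this gives equality.
last-column-≤ : ∀ v w (r : Red ρ) (s : Red τ) (r₁ : Red (ρ ++ v ++ [ x ])) (s₁ : Red (τ ++ w ++ [ y ])) →
  Increasing (w ++ [ y ]) → Col (ρ ++ v) x i → Col (τ ++ w) y j →
  (∀ i → ht r i ≡ ht s i) → (∀ i → ht r₁ i ≡ ht s₁ i) → i ≤ j
last-column-≤ {ρ} {x = x} {i = i} v w r s r₁ s₁ inc c d eq eq₁ =
  ≤-pred (increasing-strip-last w s s₁ inc d h₁ h₂)
  where
  r₃ : Red ((ρ ++ v) ++ [ x ])
  r₃ = subst Red (sym (++-assoc ρ v [ x ])) r₁
  r₂ : Red (ρ ++ v)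
  r₂ = Red-prefix (ρ ++ v) [ x ] r₃
  last : Σ ℕ (Growth r₂ r₃)
  last = growth r₂ r₃
  g = proj₂ last
  i≡ : proj₁ last ≡ i
  i≡ = col-functional (Growth.col g) c
  h₁ : ht s (Growth.row g) < suc i
  h₁ = s≤s (≤-trans (≤-reflexive (sym (eq _))) (≤-trans (ht-mono v r r₂ _) (≤-reflexive (trans (Growth.before g) i≡))))
  h₂ : suc i ≤ ht s₁ (Growth.row g)
  h₂ = ≤-reflexive (trans (sym (trans (Growth.after g) (cong suc i≡)))
    (trans (ht-cong (∼-reflexive (++-assoc ρ v [ x ])) r₃ r₁ _) (eq₁ _)))

-- The last letters of both words have the same column, hence by `col-unique` they are equal and the
-- remaining words are equivalent. A word cannot end before the other, since a further letter would
-- enlarge the diagram.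
strip-unique : ∀ {v} → Reverse v → ∀ w (r : Red ρ) (s : Red τ) → Red (ρ ++ v) → (ρ ++ v) ∼ (τ ++ w) →
  Increasing v → Increasing w → (∀ i → ht r i ≡ ht s i) → v ≡ w × ρ ∼ τ
strip-unique {ρ} {τ} {v} rev w r s r₁ p incv incw eq with initLast w
strip-unique {ρ} {τ} [] _ r s r₁ p incv incw eq | [] =
  refl , ∼-reflexive (sym (++-identityʳ ρ)) ◅◅ p ◅◅ ∼-reflexive (++-identityʳ τ)
strip-unique {ρ} {τ} [] _ r s r₁ p incv incw eq | w ∷ʳ′ y =
  let s₁ = Red-∼ p r₁
      i , lt = ht-grows w s s₁
  in  ⊥-elim (<-irrefl (trans (sym (eq i)) (ht-cong (∼-reflexive (sym (++-identityʳ ρ)) ◅◅ p) r s₁ i)) lt)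
strip-unique {ρ} {τ} (v ∶ _ ∶ʳ x) _ r s r₁ p incv incw eq | [] =
  let i , lt = ht-grows v r r₁
  in  ⊥-elim (<-irrefl (trans (eq i) (ht-cong (∼-reflexive (sym (++-identityʳ τ)) ◅◅ ∼-sym p) s r₁ i)) lt)
strip-unique {ρ} {τ} (v ∶ rev ∶ʳ x) _ r s r₁ p incv incw eq | w ∷ʳ′ y = result
  where
  s₁ : Red (τ ++ w ++ [ y ])
  s₁ = Red-∼ p r₁
  r₂ : Red ((ρ ++ v) ++ [ x ])
  r₂ = subst Red (sym (++-assoc ρ v [ x ])) r₁
  s₂ : Red ((τ ++ w) ++ [ y ])
  s₂ = subst Red (sym (++-assoc τ w [ y ])) s₁
  r₃ = Red-prefix (ρ ++ v) [ x ] r₂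
  s₃ = Red-prefix (τ ++ w) [ y ] s₂
  col₁ : Σ ℕ (Col (ρ ++ v) x)
  col₁ = let j , g = growth r₃ r₂ in j , Growth.col g
  col₂ : Σ ℕ (Col (τ ++ w) y)
  col₂ = let j , g = growth s₃ s₂ in j , Growth.col g
  col₁≡col₂ : proj₁ col₁ ≡ proj₁ col₂
  col₁≡col₂ = ≤-antisym
    (last-column-≤ v w r s r₁ s₁ incw (proj₂ col₁) (proj₂ col₂) eq (ht-cong p r₁ s₁))
    (last-column-≤ w v s r s₁ r₁ incv (proj₂ col₂) (proj₂ col₁) (sym ∘ eq) (ht-cong (∼-sym p) s₁ r₁))
  unique : x ≡ y × (ρ ++ v) ∼ (τ ++ w)
  unique = col-unique r₂
    (∼-reflexive (++-assoc ρ v [ x ]) ◅◅ p ◅◅ ∼-reflexive (sym (++-assoc τ w [ y ])))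
    (subst (Col (ρ ++ v) x) col₁≡col₂ (proj₂ col₁)) (proj₂ col₂)
  result : v ∷ʳ x ≡ w ∷ʳ y × ρ ∼ τ
  result with strip-unique rev w r s r₃ (proj₂ unique) (increasing-init v incv) (increasing-init w incw) eq
  ... | v≡w , ρ∼τ = cong₂ _∷ʳ_ v≡w (proj₁ unique) , ρ∼τ

-- Search for the rightmost box outside `b`. For a diagram `ht r` it suffices to let `L` be the word
-- itself, because nonempty rows are letters of the word.
topColumn : (a b : ℕ → ℕ) (L : List ℕ) → (∀ {i} → i ∈ L → a i ≤ b i) ⊎
  Σ ℕ λ k → b k < a k × (∀ {i} → i ∈ L → b i < a i → a i ≤ a k)
topColumn a b [] = inj₁ λ ()
topColumn a b (l ∷ L) with a l ≤? b l | topColumn a b L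
... | yes le | inj₁ all          = inj₁ λ { (here refl) → le ; (there p) → all p }
... | yes le | inj₂ (k , lt , m) = inj₂ (k , lt , λ { (here refl) lt′ → ⊥-elim (<⇒≱ lt′ le) ; (there p) → m p })
... | no ≰   | inj₁ all          = inj₂ (l , ≰⇒> ≰ , λ { (here refl) _ → ≤-refl ; (there p) lt′ → ⊥-elim (<⇒≱ lt′ (all p)) })
... | no ≰   | inj₂ (k , lt , m) with ≤-total (a l) (a k)
...   | inj₁ l≤k = inj₂ (k , lt , λ { (here refl) _ → l≤k ; (there p) → m p })
...   | inj₂ k≤l = inj₂ (l , ≰⇒> ≰ , λ { (here refl) _ → ≤-refl ; (there p) lt′ → ≤-trans (m p lt′) k≤l })

growth-column : ∀ {r : Red ρ} {s : Red (ρ ++ [ x ])} {r′ : Red τ} {s′ : Red (τ ++ [ y ])} →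
  Growth r s i → Growth r′ s′ j → (∀ i → ht r i ≡ ht r′ i) → (∀ i → ht s i ≡ ht s′ i) → i ≡ j
growth-column {r = r} {s} {r′} {s′} g g′ eq eq′ with Growth.row g ≟ Growth.row g′
... | yes p = trans (sym (Growth.before g)) (trans (eq _) (trans (cong (ht r′) p) (Growth.before g′)))
... | no ¬p = ⊥-elim (1+n≢n (begin
  suc _                 ≡⟨ Growth.after g ⟨
  ht s (Growth.row g)   ≡⟨ eq′ _ ⟩
  ht s′ (Growth.row g)  ≡⟨ Growth.other g′ ¬p ⟩
  ht r′ (Growth.row g)  ≡⟨ eq _ ⟨
  ht r (Growth.row g)   ≡⟨ Growth.before g ⟩
  _                     ∎))
  where open ≡-Reasoning

-- The word is built from its last letter: the rightmost box of the strip is removed, and what is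
-- left is a smaller strip. `ht-remove` provides a letter for the column of this box; that it also
-- vacates the right row and that the letters increase is due to conditions (c) and (b).
strip-exists : ∀ n {b} (r : Red ρ) → length ρ ≡ n → Strip b (ht r) →
  Σ (List ℕ) λ τ → Σ (List ℕ) λ w → Σ (Red τ) λ s → Increasing w × (τ ++ w) ∼ ρ × (∀ i → ht s i ≡ b i)
strip-exists {ρ} n {b} r len st with topColumn (ht r) b ρ
... | inj₁ all = ρ , [] , r , [] , ∼-reflexive (++-identityʳ ρ) , λ i → ≤-antisym (le i) (Strip.sub st i)
  where
  le : ∀ i → ht r i ≤ b i
  le i with ht r i in eq
  ... | zero  = z≤n
  ... | suc j = subst (_≤ b i) eq (all (ht-letter⁻ r (subst (0 <_) (sym eq) (s≤s z≤n))))
strip-exists {ρ} n {b} r len st | inj₂ (k , lt , max) with ht r k in eqk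
strip-exists {ρ} n {b} r len st | inj₂ (k , () , max) | zero
... | suc j = remove n len (ht-remove r eqk)
  where
  remove : ∀ n → length ρ ≡ n → (Σ (List ℕ) λ ρ′ → Σ ℕ λ x → (ρ′ ++ [ x ]) ∼ ρ × Col ρ′ x j) →
    Σ (List ℕ) λ τ → Σ (List ℕ) λ w → Σ (Red τ) λ s → Increasing w × (τ ++ w) ∼ ρ × (∀ i → ht s i ≡ b i)
  remove zero len (ρ′ , x , p , _) =
    ⊥-elim (1+n≢0 (trans (+-comm 1 _) (trans (sym (length-++ ρ′)) (trans (∼-length p) len))))
  remove (suc n) len (ρ′ , x , p , c) =
    let τ , w , t , inc , q , eq = strip-exists n r′ len′ st′
    in  τ , w ∷ʳ x , t , increasing-∷ʳ w inc (ascent t q eq) ,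
        ∼-reflexive (sym (++-assoc τ w [ x ])) ◅◅ ∼-congʳ [ x ] q ◅◅ p , eq
    where
    s : Red (ρ′ ++ [ x ])
    s = Red-∼ (∼-sym p) r
    r′ : Red ρ′
    r′ = Red-prefix ρ′ [ x ] s
    len′ : length ρ′ ≡ n
    len′ = suc-injective (trans (+-comm 1 _) (trans (sym (length-++ ρ′)) (trans (∼-length p) len)))
    s≡r : ∀ i → ht s i ≡ ht r i
    s≡r = ht-cong p s r
    gr : Growth r′ s j
    gr = let j′ , g = growth r′ s in subst (Growth r′ s) (col-functional (Growth.col g) c) g
    le : ∀ i → ht r′ i ≤ ht r i
    le i = subst (ht r′ i ≤_) (s≡r i) (growth-≤ gr i)
    -- Condition (c) of key tableaux: the removed box is the lowest one that
    -- ends a row of length j + 1.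
    row≡k : Growth.row gr ≡ k
    row≡k with <-cmp (Growth.row gr) k
    ... | tri≈ _ eq _ = eq
    ... | tri> _ _ k<row = ⊥-elim (Growth.low gr k<row
      (trans (sym (Growth.other gr (<⇒≢ k<row))) (trans (s≡r k) eqk)))
    ... | tri< row<k _ _ with suc j ≤? b (Growth.row gr)
    ...   | yes h = ⊥-elim (<⇒≱ (Strip.cond st row<k lt (≤-reflexive (sym eqk)) h)
        (≤-trans (Strip.sub st _) (≤-reflexive (trans (sym (s≡r _)) (Growth.after gr)))))
    ...   | no h  = Strip.one st (≰⇒> h) (≤-reflexive (trans (sym (Growth.after gr)) (s≡r _))) lt (≤-reflexive (sym eqk))
    r′k : ht r′ k ≡ j
    r′k = trans (cong (ht r′) (sym row≡k)) (Growth.before gr)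
    sub′ : ∀ i → b i ≤ ht r′ i
    sub′ i with i ≟ k
    ... | yes refl = ≤-trans (≤-pred lt) (≤-reflexive (sym r′k))
    ... | no i≢k   = subst (b i ≤_) (trans (sym (s≡r i)) (Growth.other gr λ eq → i≢k (trans eq row≡k))) (Strip.sub st i)
    st′ : Strip b (ht r′)
    st′ = record
      { sub  = sub′
      ; one  = λ {i} {k} h₁ h₂ h₃ h₄ → Strip.one st h₁ (≤-trans h₂ (le i)) h₃ (≤-trans h₄ (le k))
      ; cond = λ {i} {k} i<k h₁ h₂ → Strip.cond st i<k h₁ (≤-trans h₂ (le k))
      }
    -- Equal letters would cancel. A descent would put the box of `x` no further right than that of
    -- `y`, although the box of `y` lies strictly to the left.
    ascent : ∀ {τ w} (t : Red τ) → (τ ++ w) ∼ ρ′ → (∀ i → ht t i ≡ b i) → ∀ v y → w ≡ v ∷ʳ y → y < x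
    ascent {τ} t q eq v y refl with <-cmp y x
    ... | tri< y<x _ _ = y<x
    ... | tri≈ _ refl _ = ⊥-elim (Red-≢ (Red-suffix (τ ++ v) (subst Red (assoc₂ y) xred)) refl)
      where
      xred : Red ((τ ++ v ∷ʳ y) ++ [ x ])
      xred = Red-∼ (∼-congʳ [ x ] (∼-sym q)) s
      assoc₂ : ∀ y → (τ ++ v ∷ʳ y) ++ [ x ] ≡ (τ ++ v) ++ y ∷ x ∷ []
      assoc₂ y = trans (cong (_++ [ x ]) (sym (++-assoc τ v [ y ]))) (++-assoc (τ ++ v) [ y ] [ x ])
    ... | tri> _ _ x<y = ⊥-elim (<⇒≱ j₁<j (col-descent (Growth.col g₁) (Growth.col g₂) x<y))
      where
      t₁ : Red ((τ ++ v) ++ [ y ])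
      t₁ = Red-∼ (∼-reflexive (sym (++-assoc τ v [ y ]))) (Red-∼ (∼-sym q) r′)
      t₀ : Red (τ ++ v)
      t₀ = Red-prefix (τ ++ v) [ y ] t₁
      q₁ : ((τ ++ v) ++ [ y ]) ∼ ρ′
      q₁ = ∼-reflexive (++-assoc τ v [ y ]) ◅◅ q
      t₂ : Red (((τ ++ v) ++ [ y ]) ++ [ x ])
      t₂ = Red-∼ (∼-congʳ [ x ] (∼-sym q₁)) s
      j₁ = proj₁ (growth t₀ t₁)
      g₁ = proj₂ (growth t₀ t₁)
      g₂ : Growth t₁ t₂ j
      g₂ = let j′ , g = growth t₁ t₂
           in  subst (Growth t₁ t₂) (growth-column g gr (ht-cong q₁ t₁ r′) (ht-cong (∼-congʳ [ x ] q₁) t₂ s)) g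
      k₁ = Growth.row g₁
      r′k₁ : ht r′ k₁ ≡ suc j₁
      r′k₁ = trans (sym (ht-cong q₁ t₁ r′ k₁)) (Growth.after g₁)
      b<k₁ : b k₁ < suc j₁
      b<k₁ = s≤s (≤-trans (≤-reflexive (sym (eq k₁))) (≤-trans (ht-mono v t t₀ k₁) (≤-reflexive (Growth.before g₁))))
      k₁≤r : suc j₁ ≤ ht r k₁
      k₁≤r = ≤-trans (≤-reflexive (sym r′k₁)) (le k₁)
      j₁≤j : j₁ ≤ j
      j₁≤j = ≤-pred (≤-trans k₁≤r (max (ht-letter⁻ r (≤-trans (s≤s z≤n) k₁≤r)) (<-≤-trans b<k₁ k₁≤r)))
      -- If the columns agreed, (b) would place both boxes in row `k`, which is one box shorter once
      -- the box of `x` is gone.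
      j₁<j : j₁ < j
      j₁<j = ≤∧≢⇒< j₁≤j λ j₁≡j → 1+n≢n {j₁} (trans (sym r′k₁) (trans
        (cong (ht r′) (Strip.one st b<k₁ k₁≤r (subst (λ j → b k < suc j) (sym j₁≡j) lt)
          (≤-reflexive (trans (cong suc j₁≡j) (sym eqk)))))
        (trans r′k (sym j₁≡j))))

-- Factorizations and chains of diagrams

private
  variable
    fs gs rs : List (List ℕ)

factWord-∷ : ∀ w fs → factWord (w ∷ fs) ≡ factWord fs ++ w
factWord-∷ w fs = begin
  concat (reverse (w ∷ fs))                ≡⟨ cong concat (unfold-reverse w fs) ⟩
  concat (reverse fs ∷ʳ w)                 ≡⟨ concat-++ (reverse fs) [ w ] ⟨
  concat (reverse fs) ++ (w ++ [])         ≡⟨ cong (concat (reverse fs) ++_) (++-identityʳ w) ⟩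
  concat (reverse fs) ++ w                 ∎
  where open ≡-Reasoning

Red-tail : Red (factWord (w ∷ fs)) → Red (factWord fs)
Red-tail {w} {fs} r = Red-prefix (factWord fs) w (subst Red (factWord-∷ w fs) r)

Red-drop : ∀ fs → Red (factWord fs) → ∀ j → Red (prefixWord fs j)
Red-drop fs       r zero    = r
Red-drop []       r (suc j) = r
Red-drop (w ∷ fs) r (suc j) = Red-drop fs (Red-tail {w} {fs} r) j

-- heights fs r j is the diagram of the weak insertion tableau of the prefix
-- of the word of fs that consists of all factors with index above j.
heights : ∀ fs → Red (factWord fs) → ℕ → ℕ → ℕ
heights fs r j = ht (Red-drop fs r j)

heights-strip : All Increasing fs → (r : Red (factWord fs)) → ∀ j → Strip (heights fs r (suc j)) (heights fs r j)
heights-strip {[]}     _            r zero    = strip-refl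
heights-strip {[]}     _            r (suc j) = strip-refl
heights-strip {w ∷ fs} (inc ∷ incs) r (suc j) = heights-strip incs (Red-tail {w} {fs} r) j
heights-strip {w ∷ fs} (inc ∷ incs) r zero =
  strip-resp (ht-cong (∼-reflexive (sym (factWord-∷ w fs))) r₁ r) (λ _ → refl)
    (increasing-strip w (Red-tail {w} {fs} r) r₁ inc)
  where r₁ = subst Red (factWord-∷ w fs) r

heights-antitone : All Increasing fs → (r : Red (factWord fs)) → i ≤ j → ∀ k → heights fs r j k ≤ heights fs r i k
heights-antitone {i = i} {j} incs r i≤j k with m≤n⇒m<n∨m≡n i≤j
... | inj₂ refl = ≤-refl
heights-antitone {j = suc j} incs r i≤j k | inj₁ (s≤s i≤j′) =
  ≤-trans (Strip.sub (heights-strip incs r j) k) (heights-antitone incs r i≤j′ k)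

heights-end : ∀ fs (r : Red (factWord fs)) → length fs ≤ j → ∀ k → heights fs r j k ≡ 0
heights-end {zero}  []       r _        k = ht-[] r k
heights-end {suc j} []       r _        k = ht-[] r k
heights-end {suc j} (w ∷ fs) r (s≤s le) k = heights-end fs (Red-tail {w} {fs} r) le k

ht-0⇒[] : (r : Red ρ) → (∀ i → ht r i ≡ 0) → ρ ≡ []
ht-0⇒[] {[]}    r eq = refl
ht-0⇒[] {x ∷ ρ} r eq with ht-letter r (here refl)
... | k , _ , lt = ⊥-elim (<-irrefl (sym (eq k)) lt)

-- One factor per strip, the rightmost first. Beyond `n` the chain is empty, and an empty diagram
-- forces an empty word.
chain-exists : ∀ n {a : ℕ → ℕ → ℕ} (r : Red ρ) → (∀ i → ht r i ≡ a 0 i) →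
  (∀ j → Strip (a (suc j)) (a j)) → (∀ j i → n ≤ j → a j i ≡ 0) →
  Σ (List (List ℕ)) λ fs → Σ (Red (factWord fs)) λ s →
  All Increasing fs × factWord fs ∼ ρ × (∀ j i → heights fs s j i ≡ a j i)
chain-exists {ρ} zero {a} r eq st end with ht-0⇒[] r (λ i → trans (eq i) (end 0 i z≤n))
... | refl = [] , r , [] , ε , λ j i → trans (heights-end {j} [] r z≤n i) (sym (end j i z≤n))
chain-exists {ρ} (suc n) {a} r eq st end
  with strip-exists (length ρ) r refl (strip-resp (sym ∘ eq) (λ _ → refl) (st 0))
... | τ , w , t , inc , p , eq₁
  with chain-exists n {a ∘ suc} t eq₁ (st ∘ suc) (λ j i le → end (suc j) i (s≤s le))
... | fs , s , incs , q , eqs = w ∷ fs , s′ , inc ∷ incs , q′ , all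
  where
  q′ : factWord (w ∷ fs) ∼ ρ
  q′ = ∼-reflexive (factWord-∷ w fs) ◅◅ ∼-congʳ w q ◅◅ p
  s′ : Red (factWord (w ∷ fs))
  s′ = Red-∼ (∼-sym q′) r
  drop-irrelevant : ∀ fs (s s′ : Red (factWord fs)) j i → heights fs s j i ≡ heights fs s′ j i
  drop-irrelevant fs       s s′ zero    i = ht-cong ε s s′ i
  drop-irrelevant []       s s′ (suc j) i = ht-cong ε s s′ i
  drop-irrelevant (w ∷ fs) s s′ (suc j) i = drop-irrelevant fs (Red-tail {w} {fs} s) (Red-tail {w} {fs} s′) j i
  all : ∀ j i → heights (w ∷ fs) s′ j i ≡ a j i
  all zero    i = trans (ht-cong q′ s′ r i) (eq i)
  all (suc j) i = trans (drop-irrelevant fs (Red-tail {w} {fs} s′) s j i) (eqs j i)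

trim-∷ : List ℕ → List (List ℕ) → List (List ℕ)
trim-∷ []      []       = []
trim-∷ []      (f ∷ fs) = [] ∷ f ∷ fs
trim-∷ (x ∷ w) fs       = (x ∷ w) ∷ fs

-- A chain yields as many factors as its length bound, possibly with empty ones at the left end;
-- `trim` selects the canonical representative.
trim : List (List ℕ) → List (List ℕ)
trim []       = []
trim (w ∷ fs) = trim-∷ w (trim fs)

trim-empty : ∀ fs → factWord fs ≡ [] → trim fs ≡ []
trim-empty []       eq = refl
trim-empty (w ∷ fs) eq with ++-conicalʳ (factWord fs) w (trans (sym (factWord-∷ w fs)) eq)
... | refl = cong (trim-∷ []) (trim-empty fs (++-conicalˡ (factWord fs) [] (trans (sym (factWord-∷ [] fs)) eq)))

trim-∷-++ : ∀ w fs → (Σ (List (List ℕ)) λ gs → trim-∷ w fs ≡ gs ++ [ [] ]) → Σ (List (List ℕ)) λ gs → fs ≡ gs ++ [ [] ]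
trim-∷-++ []      []       ([] , ())
trim-∷-++ []      []       (_ ∷ _ , ())
trim-∷-++ []      (f ∷ fs) ([] , ())
trim-∷-++ []      (f ∷ fs) (_ ∷ gs , eq) = gs , ∷-injectiveʳ eq
trim-∷-++ (x ∷ w) fs       ([] , ())
trim-∷-++ (x ∷ w) fs       (_ ∷ gs , eq) = gs , ∷-injectiveʳ eq

trim-noTrailing : ∀ fs → NoTrailingEmpty (trim fs)
trim-noTrailing []       ([] , ())
trim-noTrailing []       (_ ∷ _ , ())
trim-noTrailing (w ∷ fs) p = trim-noTrailing fs (trim-∷-++ w (trim fs) p)

noTrailing-tail : NoTrailingEmpty (w ∷ fs) → NoTrailingEmpty fs
noTrailing-tail {w} h (gs , eq) = h (w ∷ gs , cong (w ∷_) eq)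

noTrailing-trim : ∀ fs → NoTrailingEmpty fs → trim fs ≡ fs
noTrailing-trim []             h = refl
noTrailing-trim ((x ∷ w) ∷ fs) h = cong ((x ∷ w) ∷_) (noTrailing-trim fs (noTrailing-tail h))
noTrailing-trim ([] ∷ [])      h = ⊥-elim (h ([] , refl))
noTrailing-trim ([] ∷ f ∷ fs)  h = cong (trim-∷ []) (noTrailing-trim (f ∷ fs) (noTrailing-tail h))

prefixWord-trim : ∀ fs j → prefixWord (trim fs) j ≡ prefixWord fs j
prefixWord-trim [] j = refl
prefixWord-trim (w ∷ fs) (suc j) = trans (lemma w (trim fs)) (prefixWord-trim fs j)
  where
  lemma : ∀ w fs → prefixWord (trim-∷ w fs) (suc j) ≡ prefixWord fs j
  lemma []      []       = cong factWord (sym (drop-[] j))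
  lemma []      (f ∷ fs) = refl
  lemma (x ∷ w) fs       = refl
prefixWord-trim (w ∷ fs) zero = begin
  factWord (trim-∷ w (trim fs))  ≡⟨ lemma w (trim fs) ⟩
  factWord (trim fs) ++ w        ≡⟨ cong (_++ w) (prefixWord-trim fs 0) ⟩
  factWord fs ++ w               ≡⟨ factWord-∷ w fs ⟨
  factWord (w ∷ fs)              ∎
  where
  open ≡-Reasoning
  lemma : ∀ w fs → factWord (trim-∷ w fs) ≡ factWord fs ++ w
  lemma []      []       = refl
  lemma []      (f ∷ fs) = factWord-∷ [] (f ∷ fs)
  lemma (x ∷ w) fs       = factWord-∷ (x ∷ w) fs

trim-All : {Q : List ℕ → Set} → All Q fs → All Q (trim fs)
trim-All [] = []
trim-All {w ∷ fs} (p ∷ ps) = lemma w (trim fs) p (trim-All ps)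
  where
  lemma : {Q : List ℕ → Set} → ∀ w fs → Q w → All Q fs → All Q (trim-∷ w fs)
  lemma []      []       p ps = []
  lemma []      (_ ∷ _)  p ps = p ∷ ps
  lemma (x ∷ w) fs       p ps = p ∷ ps

-- Repeated use of `strip-unique`. The lists may differ in length, so equality can hold only after
-- trimming.
chain-unique : ∀ fs gs (r : Red (factWord fs)) (s : Red (factWord gs)) → All Increasing fs → All Increasing gs →
  factWord fs ∼ factWord gs → (∀ j i → heights fs r j i ≡ heights gs s j i) → trim fs ≡ trim gs
chain-unique [] gs r s _ _ p eq = sym (trim-empty gs (∼-[] (∼-sym p)))
chain-unique (f ∷ fs) [] r s _ _ p eq = trim-empty (f ∷ fs) (∼-[] p)
chain-unique (f ∷ fs) (g ∷ gs) r s (incf ∷ incfs) (incg ∷ incgs) p eq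
  with strip-unique (reverseView f) g (Red-tail {f} {fs} r) (Red-tail {g} {gs} s) (subst Red (factWord-∷ f fs) r)
         (subst₂ _∼_ (factWord-∷ f fs) (factWord-∷ g gs) p) incf incg (eq 1)
... | refl , q = cong (trim-∷ f) (chain-unique fs gs _ _ incfs incgs q (λ j → eq (suc j)))

-- Weak descent tableaux

private
  variable
    hs : List (ℕ × List ℕ)
    n p q : ℕ

suc≤ᵇ-true : x < y → (suc x ≤ᵇ y) ≡ true
suc≤ᵇ-true {x} {y} lt with suc x ≤ᵇ y in eq
... | true  = refl
... | false = ⊥-elim (subst T eq (≤⇒≤ᵇ lt))

suc≤ᵇ-false : y ≤ x → (suc x ≤ᵇ y) ≡ false
suc≤ᵇ-false {y} {x} le with suc x ≤ᵇ y in eq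
... | false = refl
... | true  = ⊥-elim (<⇒≱ (≤ᵇ⇒≤ (suc x) y (subst T (sym eq) tt)) le)

Run : List ℕ → Set
Run w = Increasing w × Σ ℕ λ x → Σ (List ℕ) λ v → w ≡ x ∷ v

runs-head : ∀ x w → Σ (List ℕ) λ v → Σ (List (List ℕ)) λ rs → runs (x ∷ w) ≡ (x ∷ v) ∷ rs
runs-head x w with runs w
... | []           = _ , _ , refl
... | [] ∷ rs      = _ , _ , refl
... | (y ∷ r) ∷ rs with suc x ≤ᵇ y
...   | true  = _ , _ , refl
...   | false = _ , _ , refl

runs-concat : ∀ w → concat (runs w) ≡ w
runs-concat [] = refl
runs-concat (x ∷ w) with runs w | runs-concat w
... | []           | eq = cong (x ∷_) eq
... | [] ∷ rs      | eq = cong (x ∷_) eq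
... | (y ∷ r) ∷ rs | eq with suc x ≤ᵇ y
...   | true  = cong (x ∷_) eq
...   | false = cong (x ∷_) eq

runs-Run : ∀ w → All Run (runs w)
runs-Run [] = []
runs-Run (x ∷ w) with runs w | runs-Run w
... | []           | _ = ([-] , _ , _ , refl) ∷ []
... | [] ∷ rs      | (_ , _ , _ , ()) ∷ _
... | (y ∷ r) ∷ rs | (inc , run) ∷ ps with suc x ≤ᵇ y in eq
...   | true  = (≤ᵇ⇒≤ (suc x) y (subst T (sym eq) tt) ∷ inc , _ , _ , refl) ∷ ps
...   | false = ([-] , _ , _ , refl) ∷ (inc , run) ∷ ps

StartsBelow : List ℕ → List ℕ → Set
StartsBelow []      v = ⊤
StartsBelow (y ∷ _) v = All (y ≤_) v

runs-++ : ∀ x v w → Increasing (x ∷ v) → StartsBelow w (x ∷ v) → runs ((x ∷ v) ++ w) ≡ (x ∷ v) ∷ runs w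
runs-++ x [] [] _ _ = refl
runs-++ x [] (y ∷ w) _ (y≤x ∷ _) with runs (y ∷ w) | runs-head y w
... | _ | _ , _ , refl rewrite suc≤ᵇ-false y≤x = refl
runs-++ x (z ∷ v) w (x<z ∷ inc) below with runs ((z ∷ v) ++ w) | runs-++ z v w inc (tail w below)
  where
  tail : ∀ w → StartsBelow w (x ∷ z ∷ v) → StartsBelow w (z ∷ v)
  tail []      _        = tt
  tail (_ ∷ _) (_ ∷ ps) = ps
... | _ | refl rewrite suc≤ᵇ-true x<z = refl

-- What the minimum in `placeRows` guarantees: positive row indices that fall strictly from below
-- `p`, and no run in a row above its first letter.
data Placed : ℕ → List (ℕ × List ℕ) → Set where
  []    : Placed p []
  place : 1 ≤ q → q < p → Run w → q ≤ headℕ w → Placed q hs → Placed p ((q , w) ∷ hs)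

hsWord : List (ℕ × List ℕ) → List ℕ
hsWord hs = concat (L.map proj₂ hs)

placeRows-Placed : ∀ p rs → All Run rs → placeRows p rs ≡ just hs → Placed p hs × L.map proj₂ hs ≡ rs
placeRows-Placed p [] _ refl = [] , refl
placeRows-Placed p (r ∷ rs) (run ∷ ps) eq with headℕ r ⊓ (p ∸ 1) in eq′
... | suc q with placeRows (suc q) rs in eq″
placeRows-Placed p (r ∷ rs) (run ∷ ps) refl | suc q | just hs with placeRows-Placed (suc q) rs ps eq″
... | pl , eqs = place (s≤s z≤n) (below p (≤-trans (≤-reflexive (sym eq′)) (m⊓n≤n (headℕ r) (p ∸ 1)))) run
                   (≤-trans (≤-reflexive (sym eq′)) (m⊓n≤m (headℕ r) (p ∸ 1))) pl , cong (r ∷_) eqs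
  where
  below : ∀ p → suc q ≤ p ∸ 1 → suc q < p
  below (suc p) le = s≤s le

wdtRows-Placed : ∀ w → wdtRows w ≡ just hs → Σ ℕ λ p → Placed p hs × hsWord hs ≡ w
wdtRows-Placed w eq with runs w | runs-Run w | runs-concat w
wdtRows-Placed w refl | [] | _ | eqc = 0 , [] , eqc
... | r ∷ rs | rr | eqc with placeRows-Placed (suc (headℕ r)) (r ∷ rs) rr eq
...   | pl , eqs = _ , pl , trans (cong concat eqs) eqc

Exact : List (ℕ × List ℕ) → Set
Exact = All (λ h → headℕ (proj₂ h) ≡ proj₁ h)

run-≥ : Increasing (x ∷ w) → All (x ≤_) (x ∷ w)
run-≥ [-]       = ≤-refl ∷ []
run-≥ (p ∷ inc) = ≤-refl ∷ All.map (≤-trans (<⇒≤ p)) (run-≥ inc)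

hsWord-below : Placed p hs → Exact hs → All (p ≤_) w → StartsBelow (hsWord hs) w
hsWord-below []                                            _          _  = tt
hsWord-below (place _ q<p (_ , x , v , refl) _ _) (refl ∷ _) ps = All.map (≤-trans (<⇒≤ q<p)) ps

-- When first letters equal row indices, the next run starts below every letter of the previous one,
-- so a descent separates them and no two rows merge into one run.
runs-exact : Placed p hs → Exact hs → runs (hsWord hs) ≡ L.map proj₂ hs
runs-exact [] _ = refl
runs-exact (place {hs = hs} _ _ (inc , x , v , refl) _ pl) (refl ∷ ex) =
  trans (runs-++ x v (hsWord hs) inc (hsWord-below pl ex (run-≥ inc))) (cong ((x ∷ v) ∷_) (runs-exact pl ex))

placeRows-exact : Placed p hs → Exact hs → placeRows p (L.map proj₂ hs) ≡ just hs
placeRows-exact [] _ = refl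
placeRows-exact {suc p} (place {q = suc q} {w = w} {hs = hs} _ (s≤s q<p) (inc , x , v , refl) _ pl) (refl ∷ ex)
  rewrite m≤n⇒m⊓n≡m q<p | placeRows-exact pl ex = refl

wdtRows-exact : Placed p hs → Exact hs → wdtRows (hsWord hs) ≡ just hs
wdtRows-exact {hs = hs} pl ex with runs (hsWord hs) | runs-exact pl ex
wdtRows-exact []                          ex         | _ | refl = refl
wdtRows-exact (place 1≤q _ run@(_ , _ , _ , refl) le pl) (refl ∷ ex) | _ | refl =
  placeRows-exact (place 1≤q (n<1+n _) run le pl) (refl ∷ ex)

rowAt-≡ : ∀ j w hs → rowAt j ((j , w) ∷ hs) ≡ w
rowAt-≡ j w hs rewrite ≡ᵇ-refl j = refl

rowAt-≢ : ∀ j w hs → q ≢ j → rowAt j ((q , w) ∷ hs) ≡ rowAt j hs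
rowAt-≢ {q} j w hs q≢j rewrite ≡ᵇ-≢ q j q≢j = refl

rowAt-above : Placed p hs → p ≤ j → rowAt j hs ≡ []
rowAt-above [] _ = refl
rowAt-above {j = j} (place {q = q} {w = w} {hs = hs} _ q<p _ _ pl) p≤j =
  trans (rowAt-≢ j w hs (<⇒≢ (<-≤-trans q<p p≤j))) (rowAt-above pl (≤-trans (<⇒≤ q<p) p≤j))

rowAt-run : Placed p hs → ∀ j → rowAt j hs ≡ [] ⊎ (Run (rowAt j hs) × j ≤ headℕ (rowAt j hs))
rowAt-run [] j = inj₁ refl
rowAt-run (place {q = q} {w = w} {hs = hs} _ _ run le pl) j with q ≟ j
... | yes refl rewrite ≡ᵇ-refl q = inj₂ (run , le)
... | no q≢j rewrite ≡ᵇ-≢ q j q≢j = rowAt-run pl j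

factWord-∷ʳ : ∀ fs w → factWord (fs ∷ʳ w) ≡ w ++ factWord fs
factWord-∷ʳ fs w = cong concat (reverse-++ fs [ w ])

factWord-cong : ∀ n {f g : ℕ → List ℕ} → (∀ {i} → i < n → f i ≡ g i) → factWord (applyUpTo f n) ≡ factWord (applyUpTo g n)
factWord-cong zero    eq = refl
factWord-cong (suc n) {f} {g} eq = begin
  factWord (applyUpTo f (suc n))  ≡⟨ cong factWord (applyUpTo-∷ʳ f n) ⟨
  factWord (applyUpTo f n ∷ʳ f n) ≡⟨ factWord-∷ʳ (applyUpTo f n) (f n) ⟩
  f n ++ factWord (applyUpTo f n) ≡⟨ cong₂ _++_ (eq (n<1+n n)) (factWord-cong n (λ lt → eq (m<n⇒m<1+n lt))) ⟩
  g n ++ factWord (applyUpTo g n) ≡⟨ factWord-∷ʳ (applyUpTo g n) (g n) ⟨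
  factWord (applyUpTo g n ∷ʳ g n) ≡⟨ cong factWord (applyUpTo-∷ʳ g n) ⟩
  factWord (applyUpTo g (suc n))  ∎
  where open ≡-Reasoning

factWord-rows : ∀ n → Placed p hs → p ≤ suc n → factWord (applyUpTo (λ i → rowAt (suc i) hs) n) ≡ hsWord hs
factWord-rows zero [] _ = refl
factWord-rows zero (place 1≤q q<p _ _ _) p≤1 = ⊥-elim (<⇒≱ (≤-<-trans 1≤q q<p) p≤1)
factWord-rows {hs = hs} (suc n) pl p≤ = trans (sym (cong factWord (applyUpTo-∷ʳ rowOf n)))
  (trans (factWord-∷ʳ (applyUpTo rowOf n) (rowOf n)) (top pl p≤))
  where
  rowOf : ℕ → List ℕ
  rowOf i = rowAt (suc i) hs
  top : ∀ {p hs} → Placed p hs → p ≤ suc (suc n) →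
    rowAt (suc n) hs ++ factWord (applyUpTo (λ i → rowAt (suc i) hs) n) ≡ hsWord hs
  top [] _ = factWord-rows n [] z≤n
  top (place {q = q} {w = w} {hs = hs} 1≤q q<p run le pl) p≤ with q ≟ suc n
  ... | yes refl = cong₂ _++_ (rowAt-≡ q w hs)
    (trans (factWord-cong n λ {i} i<n → rowAt-≢ (suc i) w hs (>⇒≢ (s≤s i<n))) (factWord-rows n pl ≤-refl))
  ... | no q≢ = trans
    (cong (_++ factWord (applyUpTo (λ i → rowAt (suc i) ((q , w) ∷ hs)) n))
      (rowAt-above (place {p = suc q} 1≤q (n<1+n q) run le pl) q<sn))
    (factWord-rows n (place {p = suc q} 1≤q (n<1+n q) run le pl) q<sn)
    where
    q<sn : q < suc n
    q<sn = ≤∧≢⇒< (≤-pred (≤-trans q<p p≤)) q≢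

placed-top : Placed p ((q , w) ∷ hs) → Placed (suc q) ((q , w) ∷ hs)
placed-top (place 1≤q _ run le pl) = place 1≤q (n<1+n _) run le pl

nth-applyUpTo : ∀ {A : Set} (f : ℕ → A) n i {x} → nth (applyUpTo f n) i ≡ just x → x ≡ f i
nth-applyUpTo f (suc n) zero    refl = refl
nth-applyUpTo f (suc n) (suc i) eq   = nth-applyUpTo (f ∘ suc) n i eq

applyUpTo-nth : ∀ {A : Set} (f : ℕ → A) xs → (∀ i {x} → nth xs i ≡ just x → f i ≡ x) → applyUpTo f (length xs) ≡ xs
applyUpTo-nth f []       eq = refl
applyUpTo-nth f (x ∷ xs) eq = cong₂ _∷_ (eq 0 refl) (applyUpTo-nth (f ∘ suc) xs (λ i → eq (suc i)))

toRowList-factors : Placed p hs →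
  factWord (toRowList hs) ≡ hsWord hs × All Increasing (toRowList hs) × Flagged id (toRowList hs)
toRowList-factors [] = refl , [] , λ { _ _ _ () }
toRowList-factors {hs = hs@((m , r) ∷ rest)} pl =
  factWord-rows m (placed-top pl) ≤-refl , AllP.applyUpTo⁺₂ rowOf m inc , flagged
  where
  rowOf : ℕ → List ℕ
  rowOf i = rowAt (suc i) hs
  inc : ∀ i → Increasing (rowOf i)
  inc i with rowAt-run pl (suc i)
  ... | inj₁ eq            = subst Increasing (sym eq) []
  ... | inj₂ ((inc , _) , _) = inc
  flagged : Flagged id (applyUpTo rowOf m)
  flagged j x xs eq with nth-applyUpTo rowOf m j eq | rowAt-run pl (suc j)
  ... | eq′ | inj₁ eq″ with trans eq′ eq″
  ...   | ()
  flagged j x xs eq | eq′ | inj₂ (_ , le) = subst (suc j ≤_) (cong headℕ (sym eq′)) le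

-- The list holds the rows from `suc n` upwards, each starting with its own index when nonempty.
-- With `n = 0` such a list is the weak descent tableau of its own word.
data Std : ℕ → List (List ℕ) → Set where
  []  : Std n []
  std : Increasing w → (∀ {x v} → w ≡ x ∷ v → x ≡ suc n) → Std (suc n) gs → Std n (w ∷ gs)

row : ℕ → List ℕ → List (ℕ × List ℕ)
row q []      = []
row q (x ∷ w) = [ (q , x ∷ w) ]

rowsFrom : ℕ → List (List ℕ) → List (ℕ × List ℕ)
rowsFrom n []       = []
rowsFrom n (w ∷ gs) = rowsFrom (suc n) gs ++ row (suc n) w

placed-∷ʳ : Placed p hs → All (λ h → q < proj₁ h) hs → 1 ≤ q → q < p → Run w → q ≤ headℕ w → Placed p (hs ∷ʳ (q , w))
placed-∷ʳ []                          []       1≤q q<p run le = place 1≤q q<p run le []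
placed-∷ʳ (place 1≤q′ q′<p run′ le′ pl) (lt ∷ ls) 1≤q q<p run le = place 1≤q′ q′<p run′ le′ (placed-∷ʳ pl ls 1≤q lt run le)

rowsFrom-> : ∀ n gs → All (λ h → n < proj₁ h) (rowsFrom n gs)
rowsFrom-> n []             = []
rowsFrom-> n (w ∷ gs) = ++⁺ (All.map (<-trans (n<1+n n)) (rowsFrom-> (suc n) gs)) (last w)
  where
  last : ∀ w → All (λ h → n < proj₁ h) (row (suc n) w)
  last []      = []
  last (_ ∷ _) = n<1+n n ∷ []

rowsFrom-Placed : Std n gs → Σ ℕ λ p → suc n ≤ p × Placed p (rowsFrom n gs) × Exact (rowsFrom n gs)
rowsFrom-Placed {n} [] = suc n , ≤-refl , [] , []
rowsFrom-Placed {n} {w ∷ gs} (std inc first s) with rowsFrom-Placed s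
... | p , le , pl , ex with w
...   | []    = p , ≤-trans (n≤1+n _) le , subst (Placed p) (sym (++-identityʳ _)) pl , subst Exact (sym (++-identityʳ _)) ex
...   | x ∷ v with first refl
...     | refl = p , ≤-trans (n≤1+n _) le ,
                 placed-∷ʳ pl (rowsFrom-> (suc n) gs) (s≤s z≤n) le (inc , _ , _ , refl) ≤-refl , ++⁺ ex (refl ∷ [])

rowsFrom-word : ∀ n gs → hsWord (rowsFrom n gs) ≡ factWord gs
rowsFrom-word n []       = refl
rowsFrom-word n (w ∷ gs) = begin
  concat (L.map proj₂ (rowsFrom (suc n) gs ++ row (suc n) w))       ≡⟨ cong concat (map-++ proj₂ (rowsFrom (suc n) gs) _) ⟩
  concat (L.map proj₂ (rowsFrom (suc n) gs) ++ L.map proj₂ (row (suc n) w)) ≡⟨ concat-++ (L.map proj₂ (rowsFrom (suc n) gs)) _ ⟨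
  hsWord (rowsFrom (suc n) gs) ++ concat (L.map proj₂ (row (suc n) w)) ≡⟨ cong₂ _++_ (rowsFrom-word (suc n) gs) (last w) ⟩
  factWord gs ++ w                                                  ≡⟨ factWord-∷ w gs ⟨
  factWord (w ∷ gs)                                                 ∎
  where
  open ≡-Reasoning
  last : ∀ w → concat (L.map proj₂ (row (suc n) w)) ≡ w
  last []      = refl
  last (x ∷ w) = cong (x ∷_) (++-identityʳ w)

rowAt-++ˡ : ∀ j hs {hs′} → All (λ h → proj₁ h ≢ j) hs → rowAt j (hs ++ hs′) ≡ rowAt j hs′
rowAt-++ˡ j []             _        = refl
rowAt-++ˡ j ((q , w) ∷ hs) {hs′} (p ∷ ps) = trans (rowAt-≢ j w (hs ++ hs′) p) (rowAt-++ˡ j hs {hs′} ps)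

rowAt-++ʳ : ∀ j hs {hs′} → All (λ h → proj₁ h ≢ j) hs′ → rowAt j (hs ++ hs′) ≡ rowAt j hs
rowAt-++ʳ j [] {hs′} ps = trans (cong (rowAt j) (sym (++-identityʳ hs′))) (rowAt-++ˡ j hs′ ps)
rowAt-++ʳ j ((q , w) ∷ hs) ps with q ≟ j
... | yes refl rewrite ≡ᵇ-refl q = refl
... | no q≢j rewrite ≡ᵇ-≢ q j q≢j = rowAt-++ʳ j hs ps

rowAt-rowsFrom : ∀ n gs i → nth gs i ≡ just w → rowAt (suc (i + n)) (rowsFrom n gs) ≡ w
rowAt-rowsFrom n (w ∷ gs) zero refl =
  trans (rowAt-++ˡ (suc n) (rowsFrom (suc n) gs) (All.map >⇒≢ (rowsFrom-> (suc n) gs))) (last w)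
  where
  last : ∀ w → rowAt (suc n) (row (suc n) w) ≡ w
  last []      = refl
  last (x ∷ w) = rowAt-≡ (suc n) (x ∷ w) []
rowAt-rowsFrom {w} n (v ∷ gs) (suc i) eq =
  trans (rowAt-++ʳ (suc (suc i + n)) (rowsFrom (suc n) gs) (last v))
    (subst (λ j → rowAt (suc j) (rowsFrom (suc n) gs) ≡ w) (+-suc i n) (rowAt-rowsFrom (suc n) gs i eq))
  where
  last : ∀ w → All (λ h → proj₁ h ≢ suc (suc i + n)) (row (suc n) w)
  last []      = []
  last (x ∷ w) = <⇒≢ (s≤s (s≤s (m≤n+m n i))) ∷ []

rowsFrom-top : ∀ n w gs → NoTrailingEmpty (w ∷ gs) →
  Σ (List ℕ) λ v → Σ (List (ℕ × List ℕ)) λ hs → rowsFrom n (w ∷ gs) ≡ (length (w ∷ gs) + n , v) ∷ hs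
rowsFrom-top n []      []       h = ⊥-elim (h ([] , refl))
rowsFrom-top n (x ∷ w) []       h = _ , _ , refl
rowsFrom-top n w       (g ∷ gs) h with rowsFrom-top (suc n) g gs (noTrailing-tail h)
... | v , hs , eq = v , hs ++ row (suc n) w ,
  trans (cong (_++ row (suc n) w) eq) (cong (λ m → (m , v) ∷ hs ++ row (suc n) w) (+-suc (length (g ∷ gs)) n))

toRowList-rowsFrom : ∀ gs → NoTrailingEmpty gs → toRowList (rowsFrom 0 gs) ≡ gs
toRowList-rowsFrom [] h = refl
toRowList-rowsFrom (w ∷ gs) h with rowsFrom-top 0 w gs h
... | v , hs , eq = begin
  toRowList (rowsFrom 0 (w ∷ gs))                           ≡⟨ cong toRowList eq ⟩
  applyUpTo (rowOf ((len + 0 , v) ∷ hs)) (len + 0)              ≡⟨ cong₂ (λ hs m → applyUpTo (rowOf hs) m) (sym eq) (+-identityʳ len) ⟩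
  applyUpTo (rowOf (rowsFrom 0 (w ∷ gs))) len               ≡⟨ applyUpTo-nth _ (w ∷ gs) nths ⟩
  w ∷ gs                                                    ∎
  where
  open ≡-Reasoning
  len = length (w ∷ gs)
  rowOf : List (ℕ × List ℕ) → ℕ → List ℕ
  rowOf hs i = rowAt (suc i) hs
  nths : ∀ i {x} → nth (w ∷ gs) i ≡ just x → rowOf (rowsFrom 0 (w ∷ gs)) i ≡ x
  nths i {x} eq = subst (λ j → rowAt (suc j) (rowsFrom 0 (w ∷ gs)) ≡ x) (+-identityʳ i) (rowAt-rowsFrom 0 (w ∷ gs) i eq)

weakDesTab-std : Std 0 gs → NoTrailingEmpty gs → weakDesTab (factWord gs) ≡ just gs
weakDesTab-std {gs} s h with rowsFrom-Placed s
... | p , _ , pl , ex = begin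
  M.map toRowList (wdtRows (factWord gs))             ≡⟨ cong (M.map toRowList ∘ wdtRows) (rowsFrom-word 0 gs) ⟨
  M.map toRowList (wdtRows (hsWord (rowsFrom 0 gs)))  ≡⟨ cong (M.map toRowList) (wdtRows-exact pl ex) ⟩
  just (toRowList (rowsFrom 0 gs))                    ≡⟨ cong just (toRowList-rowsFrom gs h) ⟩
  just gs                                             ∎
  where open ≡-Reasoning

weakDesTab-factors : ∀ w → weakDesTab w ≡ just gs → factWord gs ≡ w × All Increasing gs × Flagged id gs
weakDesTab-factors w eq with wdtRows w in eq′
weakDesTab-factors w refl | just hs with wdtRows-Placed w eq′
... | p , pl , refl = toRowList-factors pl

-- Yamanouchi words

sumTo : ℕ → (ℕ → ℕ) → ℕ
sumTo zero    a = 0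
sumTo (suc j) a = sumTo j a + a (suc j)

sumTo-cong : ∀ j {a b : ℕ → ℕ} → (∀ {i} → i ≤ j → a i ≡ b i) → sumTo j a ≡ sumTo j b
sumTo-cong zero    eq = refl
sumTo-cong (suc j) eq = cong₂ _+_ (sumTo-cong j λ le → eq (m≤n⇒m≤1+n le)) (eq ≤-refl)

sumTo-0 : ∀ j {a : ℕ → ℕ} → (∀ {i} → i ≤ j → a i ≡ 0) → sumTo j a ≡ 0
sumTo-0 zero    eq = refl
sumTo-0 (suc j) eq = cong₂ _+_ (sumTo-0 j λ le → eq (m≤n⇒m≤1+n le)) (eq ≤-refl)

sumTo-suc : ∀ j k {a b : ℕ → ℕ} → 1 ≤ k → k ≤ j → b k ≡ suc (a k) → (∀ {i} → i ≢ k → b i ≡ a i) →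
  sumTo j b ≡ suc (sumTo j a)
sumTo-suc zero k 1≤k k≤0 _ _ = ⊥-elim (<⇒≱ 1≤k k≤0)
sumTo-suc (suc j) k {a} {b} 1≤k k≤j at other with m≤n⇒m<n∨m≡n k≤j
... | inj₁ (s≤s k≤j′) = cong₂ _+_ (sumTo-suc j k 1≤k k≤j′ at other) (other λ { refl → <-irrefl refl k≤j′ })
... | inj₂ refl = trans (cong₂ _+_ (sumTo-cong j λ le → other (<⇒≢ (s≤s le))) at) (+-suc (sumTo j a) (a (suc j)))

growth-row-pos : ∀ {r : Red ρ} {s : Red (ρ ++ [ x ])} (g : Growth r s j) → 1 ≤ Growth.row g
growth-row-pos {s = s} g =
  All.lookup (proj₁ s) (ht-letter⁻ s (subst (0 <_) (sym (Growth.after g)) (s≤s z≤n)))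

growth-sum : ∀ {r : Red ρ} {s : Red (ρ ++ [ x ])} n (g : Growth r s j) →
  (Growth.row g ≤ n × sumTo n (ht s) ≡ suc (sumTo n (ht r))) ⊎ (n < Growth.row g × sumTo n (ht s) ≡ sumTo n (ht r))
growth-sum n g with Growth.row g ≤? n
... | yes le = inj₁ (le , sumTo-suc n (Growth.row g) (growth-row-pos g) le
                          (trans (Growth.after g) (cong suc (sym (Growth.before g)))) (Growth.other g))
... | no ≰   = inj₂ (≰⇒> ≰ , sumTo-cong n λ le → Growth.other g (<⇒≢ (≤-<-trans le (≰⇒> ≰))))

sumTo-assoc : ∀ n ρ x τ (s : Red (ρ ++ x ∷ τ)) → sumTo n (ht (Red-assoc ρ x τ s)) ≡ sumTo n (ht s)
sumTo-assoc n ρ x τ s = sumTo-cong n λ {i} _ → ht-assoc ρ x τ s i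

ht-sum-≤ : ∀ n τ (r : Red ρ) (s : Red (ρ ++ τ)) → sumTo n (ht s) ≤ sumTo n (ht r) + length τ
ht-sum-≤ {ρ} n [] r s = ≤-reflexive (trans
  (sumTo-cong n λ {i} _ → ht-cong (∼-reflexive (++-identityʳ ρ)) s r i) (sym (+-identityʳ _)))
ht-sum-≤ {ρ} n (x ∷ τ) r s = begin
  sumTo n (ht s)                               ≡⟨ sumTo-assoc n ρ x τ s ⟨
  sumTo n (ht (Red-assoc ρ x τ s))             ≤⟨ ht-sum-≤ n τ t (Red-assoc ρ x τ s) ⟩
  sumTo n (ht t) + length τ                    ≤⟨ +-monoˡ-≤ (length τ) (one (growth-sum n (proj₂ (growth r t)))) ⟩
  suc (sumTo n (ht r)) + length τ              ≡⟨ +-suc (sumTo n (ht r)) (length τ) ⟨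
  sumTo n (ht r) + suc (length τ)              ∎
  where
  open ≤-Reasoning
  t : Red (ρ ++ [ x ])
  t = Red-split ρ x τ s
  one : _ → sumTo n (ht t) ≤ suc (sumTo n (ht r))
  one (inj₁ (_ , eq)) = ≤-reflexive eq
  one (inj₂ (_ , eq)) = ≤-trans (≤-reflexive eq) (n≤1+n _)

-- Each letter adds exactly one box. If the rows up to `n` receive all of them, none remains for the
-- rows above.
ht-sum-≡ : ∀ n τ (r : Red ρ) (s : Red (ρ ++ τ)) → sumTo n (ht r) + length τ ≤ sumTo n (ht s) →
  ∀ {i} → n < i → ht s i ≡ ht r i
ht-sum-≡ {ρ} n [] r s _ {i} _ = ht-cong (∼-reflexive (++-identityʳ ρ)) s r i
ht-sum-≡ {ρ} n (x ∷ τ) r s le {i} n<i with growth-sum n (proj₂ (growth r (Red-split ρ x τ s)))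
... | inj₁ (row≤n , eq) = trans (sym (ht-assoc ρ x τ s i)) (trans
  (ht-sum-≡ n τ (Red-split ρ x τ s) (Red-assoc ρ x τ s) le′ n<i)
  (Growth.other (proj₂ (growth r (Red-split ρ x τ s))) (>⇒≢ (≤-<-trans row≤n n<i))))
  where
  le′ : sumTo n (ht (Red-split ρ x τ s)) + length τ ≤ sumTo n (ht (Red-assoc ρ x τ s))
  le′ = ≤-trans (≤-reflexive (trans (cong (_+ length τ) eq) (sym (+-suc _ _))))
    (≤-trans le (≤-reflexive (sym (sumTo-assoc n ρ x τ s))))
... | inj₂ (_ , eq) = ⊥-elim (<⇒≱ lt le)
  where
  lt : sumTo n (ht s) < sumTo n (ht r) + length (x ∷ τ)
  lt = begin-strict
    sumTo n (ht s)                               ≡⟨ sumTo-assoc n ρ x τ s ⟨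
    sumTo n (ht (Red-assoc ρ x τ s))             ≤⟨ ht-sum-≤ n τ (Red-split ρ x τ s) (Red-assoc ρ x τ s) ⟩
    sumTo n (ht (Red-split ρ x τ s)) + length τ  ≡⟨ cong (_+ length τ) eq ⟩
    sumTo n (ht r) + length τ                    <⟨ +-monoʳ-< (sumTo n (ht r)) (n<1+n _) ⟩
    sumTo n (ht r) + suc (length τ)              ∎
    where open ≤-Reasoning

ht-sum-above : ∀ n τ (r : Red ρ) (s : Red (ρ ++ τ)) → (∀ {i} → n < i → ht s i ≡ ht r i) →
  sumTo n (ht s) ≡ sumTo n (ht r) + length τ
ht-sum-above {ρ} n [] r s _ = trans
  (sumTo-cong n λ {i} _ → ht-cong (∼-reflexive (++-identityʳ ρ)) s r i) (sym (+-identityʳ _))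
ht-sum-above {ρ} n (x ∷ τ) r s same with growth-sum n (proj₂ (growth r (Red-split ρ x τ s)))
... | inj₂ (n<row , _) = ⊥-elim (<-irrefl (sym (same n<row)) (begin-strict
    ht r row₀                   ≡⟨ Growth.before g ⟩
    proj₁ (growth r t)        <⟨ n<1+n _ ⟩
    suc (proj₁ (growth r t))  ≡⟨ Growth.after g ⟨
    ht t row₀                    ≤⟨ ht-mono τ t (Red-assoc ρ x τ s) row₀ ⟩
    ht (Red-assoc ρ x τ s) row₀  ≡⟨ ht-assoc ρ x τ s row₀ ⟩
    ht s row₀                    ∎))
  where
  open ≤-Reasoning
  t = Red-split ρ x τ s
  g = proj₂ (growth r t)
  row₀ = Growth.row g
... | inj₁ (row≤n , eq) = begin
  sumTo n (ht s)                     ≡⟨ sumTo-assoc n ρ x τ s ⟨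
  sumTo n (ht (Red-assoc ρ x τ s))   ≡⟨ ht-sum-above n τ t (Red-assoc ρ x τ s) same′ ⟩
  sumTo n (ht t) + length τ          ≡⟨ cong (_+ length τ) eq ⟩
  suc (sumTo n (ht r)) + length τ    ≡⟨ +-suc (sumTo n (ht r)) (length τ) ⟨
  sumTo n (ht r) + suc (length τ)    ∎
  where
  open ≡-Reasoning
  t = Red-split ρ x τ s
  same′ : ∀ {i} → n < i → ht (Red-assoc ρ x τ s) i ≡ ht t i
  same′ {i} n<i = trans (ht-assoc ρ x τ s i) (trans (same n<i)
    (sym (Growth.other (proj₂ (growth r t)) (>⇒≢ (≤-<-trans row≤n n<i)))))

-- cut j a is the chain of the tableau whose row i is filled with a i copies of i;
-- the factorization with this chain is the Yamanouchi word.
abstract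
  cut : ℕ → (ℕ → ℕ) → ℕ → ℕ
  cut j a i with j <? i
  ... | yes _ = a i
  ... | no _  = 0

  cut-> : ∀ {a : ℕ → ℕ} → j < i → cut j a i ≡ a i
  cut-> {j} {i} lt with j <? i
  ... | yes _ = refl
  ... | no ≮  = ⊥-elim (≮ lt)

  cut-≤ : ∀ {a : ℕ → ℕ} → i ≤ j → cut j a i ≡ 0
  cut-≤ {i} {j} le with j <? i
  ... | yes lt = ⊥-elim (<⇒≱ lt le)
  ... | no _   = refl

  cut-pos : ∀ {a : ℕ → ℕ} → 0 < cut j a i → j < i
  cut-pos {j} {i} lt with j <? i
  ... | yes h = h
  ... | no _ with lt
  ...   | ()

cut-box : ∀ {a : ℕ → ℕ} → cut (suc j) a i < c → c ≤ cut j a i → i ≡ suc j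
cut-box {j} {i} {c} {a} h₁ h₂ with <-cmp i (suc j)
... | tri≈ _ eq _ = eq
... | tri< lt _ _ = ⊥-elim (<⇒≱ h₁ (≤-trans h₂ (≤-trans (≤-reflexive (cut-≤ (≤-pred lt))) z≤n)))
... | tri> _ _ gt = ⊥-elim (<⇒≱ h₁ (≤-trans h₂ (≤-reflexive (trans (cut-> (<-trans (n<1+n j) gt)) (sym (cut-> gt))))))

cut-strip : ∀ (a : ℕ → ℕ) j → Strip (cut (suc j) a) (cut j a)
cut-strip a j = record
  { sub  = sub
  ; one  = λ h₁ h₂ h₃ h₄ → trans (cut-box h₁ h₂) (sym (cut-box h₃ h₄))
  ; cond = cond
  }
  where
  sub : ∀ i → cut (suc j) a i ≤ cut j a i
  sub i with suc j <? i
  ... | yes lt = ≤-reflexive (trans (cut-> lt) (sym (cut-> (<-trans (n<1+n j) lt))))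
  ... | no ≮   = subst (_≤ cut j a i) (sym (cut-≤ (≮⇒≥ ≮))) z≤n
  cond : ∀ {i k c} → i < k → cut (suc j) a k < c → c ≤ cut j a k → c ≤ cut (suc j) a i → c < cut (suc j) a i
  cond i<k h₁ h₂ h₃ with cut-box h₁ h₂
  ... | refl = ⊥-elim (<⇒≱ (≤-<-trans z≤n h₁) (≤-trans h₃ (≤-reflexive (cut-≤ (<⇒≤ i<k)))))

module _ {a : ℕ → ℕ} where

  cut-heights-≥ : (r : Red ρ) → (∀ i → ht r i ≡ cut j a i) → x ∈ ρ → j < x
  cut-heights-≥ r eq x∈ρ with ht-letter r x∈ρ
  ... | k , k≤x , lt = <-≤-trans (cut-pos (subst (0 <_) (eq k) lt)) k≤x

  -- All boxes of the strip lie in row `suc j`, which gives the length of `w`. If `w` is nonempty,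
  -- then `suc j` is a letter of the whole word; it is not in `ρ`, whose letters are larger, so it
  -- is in `w`, and no letter there is smaller.
  cut-step : (r : Red ρ) (s : Red (ρ ++ w)) → Increasing w →
    (∀ i → ht r i ≡ cut (suc j) a i) → (∀ i → ht s i ≡ cut j a i) →
    length w ≡ a (suc j) × (∀ {x v} → w ≡ x ∷ v → x ≡ suc j)
  cut-step {ρ} {w} {j} r s inc eqr eqs = sym a≡len , first
    where
    a≡len : a (suc j) ≡ length w
    a≡len = begin
      a (suc j)                                  ≡⟨ trans (eqs _) (cut-> (n<1+n j)) ⟨
      ht s (suc j)                               ≡⟨ cong (_+ ht s (suc j)) (sumTo-0 j λ le → trans (eqs _) (cut-≤ le)) ⟨
      sumTo (suc j) (ht s)                       ≡⟨ ht-sum-above (suc j) w r s (λ {i} lt →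
                                                      trans (eqs i) (trans (cut-> (<-trans (n<1+n j) lt)) (sym (trans (eqr i) (cut-> lt))))) ⟩
      sumTo (suc j) (ht r) + length w            ≡⟨ cong (_+ length w) (sumTo-0 (suc j) λ le → trans (eqr _) (cut-≤ le)) ⟩
      length w                                   ∎
      where open ≡-Reasoning
    first : ∀ {x v} → w ≡ x ∷ v → x ≡ suc j
    first {x} {v} refl with ∈-++⁻ ρ (ht-letter⁻ s (subst (0 <_) (sym (trans (trans (eqs _) (cut-> (n<1+n j))) a≡len)) (s≤s z≤n)))
    ... | inj₁ p = ⊥-elim (<-irrefl refl (cut-heights-≥ r eqr p))
    ... | inj₂ p = ≤-antisym (All.lookup (run-≥ inc) p) (cut-heights-≥ s eqs (∈-++⁺ʳ ρ (here refl)))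

  cut-chain : ∀ n fs (r : Red (factWord fs)) → All Increasing fs →
    (∀ j i → heights fs r j i ≡ cut (j + n) a i) →
    Std n fs × (∀ j → fromMaybe 0 (nth (L.map length fs) j) ≡ a (suc (j + n)))
  cut-chain n [] r [] eq = [] , λ j → sym (trans (sym (cut-> (n<1+n _))) (trans (sym (eq j _)) (heights-end {j} [] r z≤n _)))
  cut-chain n (w ∷ fs) r (inc ∷ incs) eq
    with cut-chain (suc n) fs (Red-tail {w} {fs} r) incs (λ j i → trans (eq (suc j) i) (cong (λ m → cut m a i) (sym (+-suc j n))))
       | cut-step (Red-tail {w} {fs} r) (subst Red (factWord-∷ w fs) r) inc (eq 1)
           (λ i → trans (ht-cong (∼-reflexive (sym (factWord-∷ w fs))) (subst Red (factWord-∷ w fs) r) r i) (eq 0 i))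
  ... | s , lens | len , first = std inc first s , λ
    { zero    → len
    ; (suc j) → trans (lens j) (cong (a ∘ suc) (+-suc j n))
    }

trim-Std : Std n fs → Std n (trim fs)
trim-Std [] = []
trim-Std {n} {w ∷ fs} (std inc first s) = lemma w (trim fs) inc first (trim-Std s)
  where
  lemma : ∀ w fs → Increasing w → (∀ {x v} → w ≡ x ∷ v → x ≡ suc n) → Std (suc n) fs → Std n (trim-∷ w fs)
  lemma []      []      _   _     _ = []
  lemma []      (_ ∷ _) inc first s = std inc first s
  lemma (_ ∷ _) _       inc first s = std inc first s

trim-lengths : ∀ fs j → fromMaybe 0 (nth (L.map length (trim fs)) j) ≡ fromMaybe 0 (nth (L.map length fs) j)
trim-lengths [] j = refl
trim-lengths (w ∷ fs) j = trans (lemma w (trim fs) j) (tail j)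
  where
  lemma : ∀ w fs j → fromMaybe 0 (nth (L.map length (trim-∷ w fs)) j) ≡ fromMaybe 0 (nth (L.map length (w ∷ fs)) j)
  lemma []      []      zero    = refl
  lemma []      []      (suc j) = refl
  lemma []      (_ ∷ _) j       = refl
  lemma (_ ∷ _) fs      j       = refl
  tail : ∀ j → fromMaybe 0 (nth (L.map length (w ∷ trim fs)) j) ≡ fromMaybe 0 (nth (L.map length (w ∷ fs)) j)
  tail zero    = refl
  tail (suc j) = trim-lengths fs j

sum-take : ∀ j α → sum (take j α) ≡ sumTo j (rowLen α)
sum-take zero    α = refl
sum-take (suc j) α = trans (step j α) (cong (_+ rowLen α (suc j)) (sum-take j α))
  where
  step : ∀ j α → sum (take (suc j) α) ≡ sum (take j α) + rowLen α (suc j)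
  step zero    []      = refl
  step zero    (x ∷ α) = +-identityʳ x
  step (suc j) []      = refl
  step (suc j) (x ∷ α) = trans (cong (x +_) (step j α)) (sym (+-assoc x _ _))

prefixWord-length : ∀ j fs → sum (take j (L.map length fs)) + length (prefixWord fs j) ≡ length (factWord fs)
prefixWord-length zero    fs       = refl
prefixWord-length (suc j) []       = refl
prefixWord-length (suc j) (w ∷ fs) = begin
  (length w + sum (take j (L.map length fs))) + length (prefixWord fs j)  ≡⟨ +-assoc (length w) _ _ ⟩
  length w + (sum (take j (L.map length fs)) + length (prefixWord fs j))  ≡⟨ cong (length w +_) (prefixWord-length j fs) ⟩
  length w + length (factWord fs)                                         ≡⟨ +-comm (length w) _ ⟩
  length (factWord fs) + length w                                         ≡⟨ length-++ (factWord fs) ⟨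
  length (factWord fs ++ w)                                               ≡⟨ cong length (factWord-∷ w fs) ⟨
  length (factWord (w ∷ fs))                                              ∎
  where open ≡-Reasoning

factWord-split : ∀ j fs → Σ (List ℕ) λ v → factWord fs ≡ prefixWord fs j ++ v
factWord-split zero    fs       = [] , sym (++-identityʳ _)
factWord-split (suc j) []       = [] , refl
factWord-split (suc j) (w ∷ fs) with factWord-split j fs
... | v , eq = v ++ w , trans (factWord-∷ w fs) (trans (cong (_++ w) eq) (++-assoc (prefixWord fs j) v w))

-- Flag conditions concern first letters only. The factor that contains `x` starts with some `y` at
-- most `x`, which transfers them to all letters.
letter-factor : ∀ fs → All Increasing fs → ∀ j → x ∈ prefixWord fs j →
  Σ ℕ λ i → Σ ℕ λ y → Σ (List ℕ) λ ys → j ≤ i × nth fs i ≡ just (y ∷ ys) × y ≤ x × y ∈ prefixWord fs j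
letter-factor []       _            zero    ()
letter-factor []       _            (suc j) ()
letter-factor (w ∷ fs) (inc ∷ incs) (suc j) p with letter-factor fs incs j p
... | i , y , ys , j≤i , eq , y≤x , q = suc i , y , ys , s≤s j≤i , eq , y≤x , q
letter-factor (w ∷ fs) (inc ∷ incs) zero p with ∈-++⁻ (factWord fs) (subst (_ ∈_) (factWord-∷ w fs) p)
... | inj₁ q with letter-factor fs incs 0 q
...   | i , y , ys , _ , eq , y≤x , q′ =
        suc i , y , ys , z≤n , eq , y≤x , subst (y ∈_) (sym (factWord-∷ w fs)) (∈-++⁺ˡ q′)
letter-factor ((y ∷ ys) ∷ fs) (inc ∷ incs) zero p | inj₂ q =
  0 , y , ys , z≤n , refl , All.lookup (run-≥ inc) q ,
  subst (y ∈_) (sym (factWord-∷ (y ∷ ys) fs)) (∈-++⁺ʳ (factWord fs) (here refl))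

ht-row-pos : (r : Red ρ) → 0 < ht r i → 1 ≤ i
ht-row-pos r lt = All.lookup (proj₁ r) (ht-letter⁻ r lt)

ht-row-0 : (r : Red ρ) → ht r 0 ≡ 0
ht-row-0 r with ht r 0 in eq
... | zero  = refl
... | suc _ with ht-row-pos {i = 0} r (subst (0 <_) (sym eq) (s≤s z≤n))
...   | ()

∈⇒≤sum : x ∈ ρ → x ≤ sum ρ
∈⇒≤sum {ρ = y ∷ ρ} (here refl) = m≤m+n y (sum ρ)
∈⇒≤sum {ρ = y ∷ ρ} (there p)   = ≤-trans (∈⇒≤sum p) (m≤n+m (sum ρ) y)

-- The minimal word of a class

record Minimal {ρ} (r : Red ρ) : Set where
  field
    word   : List ℕ
    comp   : List ℕ
    equiv  : word ∼ ρ
    hasDes : HasDes word comp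
    rows   : ∀ i → rowLen comp i ≡ ht r i
    below  : ∀ {τ ν} → τ ∼ ρ → HasDes τ ν → comp ⊴ ν
    -- No minimality of `τ` is assumed: being below the minimal composition already forces the word.
    -- This is what identifies any Yamanouchi word of the class.
    unique : ∀ {τ ν} → τ ∼ ρ → HasDes τ ν → ν ⊴ comp → τ ≡ word

hasDes⁻ : ∀ {ν} τ → HasDes τ ν → Σ (List (List ℕ)) λ T → weakDesTab τ ≡ just T × ν ≡ L.map length T
hasDes⁻ τ eq with weakDesTab τ
hasDes⁻ τ refl | just T = T , refl , refl

-- A nonempty row is a letter of the prefix word, and for the identity flag all letters of the
-- factors with index above `j` exceed `j`.
flagged-heights : ∀ fs (r : Red (factWord fs)) → All Increasing fs → Flagged id fs → i ≤ j → heights fs r j i ≡ 0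
flagged-heights {i} {j} fs r incs fl i≤j with heights fs r j i in eq
... | zero  = refl
... | suc _ with letter-factor fs incs j (ht-letter⁻ (Red-drop fs r j) (subst (0 <_) (sym eq) (s≤s z≤n)))
...   | k , y , ys , j≤k , nth≡ , y≤i , _ =
        ⊥-elim (<⇒≱ (fl k y ys nth≡) (≤-trans y≤i (≤-trans i≤j j≤k)))

module _ (fs : List (List ℕ)) (r : Red (factWord fs)) (incs : All Increasing fs) (fl : Flagged id fs) where

  private
    module Split (j : ℕ) where
      rest : List ℕ
      rest = proj₁ (factWord-split j fs)
      s : Red (prefixWord fs j ++ rest)
      s = subst Red (proj₂ (factWord-split j fs)) r
      s≡r : ∀ i → ht s i ≡ ht r i
      s≡r = ht-cong (∼-reflexive (sym (proj₂ (factWord-split j fs)))) s r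
      rest-length : length rest ≡ sum (take j (L.map length fs))
      rest-length = +-cancelʳ-≡ (length (prefixWord fs j)) _ _ (begin
        length rest + length (prefixWord fs j)                        ≡⟨ +-comm (length rest) _ ⟩
        length (prefixWord fs j) + length rest                        ≡⟨ length-++ (prefixWord fs j) ⟨
        length (prefixWord fs j ++ rest)                              ≡⟨ cong length (proj₂ (factWord-split j fs)) ⟨
        length (factWord fs)                                          ≡⟨ prefixWord-length j fs ⟨
        sum (take j (L.map length fs)) + length (prefixWord fs j)     ∎)
        where open ≡-Reasoning
      none : sumTo j (heights fs r j) ≡ 0
      none = sumTo-0 j (flagged-heights fs r incs fl)

  -- The rows up to `j` are still empty before the last `j` factors are read, and each letter of
  -- these factors puts at most one box there.
  flagged-sum-≤ : ∀ j → sumTo j (ht r) ≤ sum (take j (L.map length fs))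
  flagged-sum-≤ j = begin
    sumTo j (ht r)                            ≡⟨ sumTo-cong j (λ {i} _ → s≡r i) ⟨
    sumTo j (ht s)                            ≤⟨ ht-sum-≤ j rest (Red-drop fs r j) s ⟩
    sumTo j (heights fs r j) + length rest    ≡⟨ cong₂ _+_ none rest-length ⟩
    sum (take j (L.map length fs))            ∎
    where
    open ≤-Reasoning
    open Split j

  -- In the case of equality all boxes of the last `j` factors lie in rows up to `j`, so the rows
  -- above have their final length before these factors are read.
  flagged-sum-≡ : ∀ j → sum (take j (L.map length fs)) ≤ sumTo j (ht r) → ∀ i → heights fs r j i ≡ cut j (ht r) i
  flagged-sum-≡ j le i with j <? i
  ... | no j≮i  = trans (flagged-heights fs r incs fl (≮⇒≥ j≮i)) (sym (cut-≤ (≮⇒≥ j≮i)))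
  ... | yes j<i = trans (sym (ht-sum-≡ j rest (Red-drop fs r j) s le′ j<i)) (trans (s≡r i) (sym (cut-> j<i)))
    where
    open Split j
    le′ : sumTo j (heights fs r j) + length rest ≤ sumTo j (ht s)
    le′ = ≤-trans (≤-reflexive (cong₂ _+_ none rest-length))
      (≤-trans le (≤-reflexive (sym (sumTo-cong j λ {i} _ → s≡r i))))

minimal : (r : Red ρ) → Minimal r
minimal {ρ} r = record
  { word   = factWord gs₀
  ; comp   = L.map length gs₀
  ; equiv  = equiv
  ; hasDes = cong (M.map (L.map length)) (weakDesTab-std (trim-Std (proj₁ standard)) (trim-noTrailing fs₀))
  ; rows   = rows
  ; below  = below
  ; unique = unique
  }
  where
  a₀ : ℕ → ℕ
  a₀ = ht r
  -- `sum ρ` is a crude bound for the letters of `ρ`, and nonempty rows are letters.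
  end : ∀ j i → sum ρ ≤ j → cut j a₀ i ≡ 0
  end j i le with j <? i
  ... | no ≮ = cut-≤ (≮⇒≥ ≮)
  ... | yes j<i with ht r i in eq
  ...   | zero  = trans (cut-> j<i) eq
  ...   | suc _ = ⊥-elim (<⇒≱ j<i
    (≤-trans (∈⇒≤sum (ht-letter⁻ {i = i} r (subst (0 <_) (sym eq) (s≤s z≤n)))) le))
  start : ∀ i → ht r i ≡ cut 0 a₀ i
  start zero    = trans (ht-row-0 r) (sym (cut-≤ z≤n))
  start (suc i) = sym (cut-> (s≤s z≤n))
  chain = chain-exists (sum ρ) r start (cut-strip a₀) end
  fs₀ = proj₁ chain
  red₀ = proj₁ (proj₂ chain)
  incs₀ = proj₁ (proj₂ (proj₂ chain))
  fs₀∼ρ = proj₁ (proj₂ (proj₂ (proj₂ chain)))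
  heights₀ = proj₂ (proj₂ (proj₂ (proj₂ chain)))
  gs₀ = trim fs₀
  standard : Std 0 fs₀ × (∀ j → fromMaybe 0 (nth (L.map length fs₀) j) ≡ a₀ (suc (j + 0)))
  standard = cut-chain 0 fs₀ red₀ incs₀
    (λ j i → trans (heights₀ j i) (cong (λ j → cut j a₀ i) (sym (+-identityʳ j))))
  equiv : factWord gs₀ ∼ ρ
  equiv = ∼-reflexive (prefixWord-trim fs₀ 0) ◅◅ fs₀∼ρ
  rows : ∀ i → rowLen (L.map length gs₀) i ≡ ht r i
  rows zero    = sym (ht-row-0 r)
  rows (suc i) = trans (trim-lengths fs₀ i) (trans (proj₂ standard i) (cong (a₀ ∘ suc) (+-identityʳ i)))
  sums : ∀ j → sum (take j (L.map length gs₀)) ≡ sumTo j (ht r)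
  sums j = trans (sum-take j (L.map length gs₀)) (sumTo-cong j λ {i} _ → rows i)
  below : ∀ {τ ν} → τ ∼ ρ → HasDes τ ν → L.map length gs₀ ⊴ ν
  below {τ} p d j with hasDes⁻ τ d
  ... | T , eq , refl with weakDesTab-factors τ eq
  ...   | refl , incs , fl = ≤-trans (≤-reflexive (trans (sums j) (sumTo-cong j λ {i} _ → ht-cong (∼-sym p) r t i)))
                               (flagged-sum-≤ T t incs fl j)
    where t = Red-∼ (∼-sym p) r
  unique : ∀ {τ ν} → τ ∼ ρ → HasDes τ ν → ν ⊴ L.map length gs₀ → τ ≡ factWord gs₀
  unique {τ} p d le with hasDes⁻ τ d
  ... | T , eq , refl with weakDesTab-factors τ eq
  ...   | refl , incs , fl = trans (sym (prefixWord-trim T 0))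
      (cong factWord (chain-unique T fs₀ t red₀ incs incs₀ (p ◅◅ ∼-sym fs₀∼ρ) same))
    where
    t = Red-∼ (∼-sym p) r
    t≡r : ∀ i → ht t i ≡ ht r i
    t≡r = ht-cong p t r
    same : ∀ j i → heights T t j i ≡ heights fs₀ red₀ j i
    same j i = trans
      (flagged-sum-≡ T t incs fl j (≤-trans (le j) (≤-reflexive (trans (sums j) (sumTo-cong j λ {i} _ → sym (t≡r i))))) i)
      (trans (cut-cong j i) (sym (heights₀ j i)))
      where
      cut-cong : ∀ j i → cut j (ht t) i ≡ cut j a₀ i
      cut-cong j i with j <? i
      ... | yes lt = trans (cut-> lt) (trans (t≡r i) (sym (cut-> lt)))
      ... | no ≮   = trans (cut-≤ (≮⇒≥ ≮)) (sym (cut-≤ (≮⇒≥ ≮)))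

minimal-Yamanouchi : {r : Red ρ} (m : Minimal r) → Yamanouchi (Minimal.word m)
minimal-Yamanouchi {ρ} m with hasDes⁻ (Minimal.word m) (Minimal.hasDes m)
... | T , eq , _ = subst Is-just (sym eq) (MAny.just tt) , λ τ → λ
  { (τ∼σ , μ , ν , dτ , dσ , _) → ∼-sym τ∼σ , Minimal.comp m , μ , Minimal.hasDes m , dτ ,
      Minimal.below m (τ∼σ ◅◅ Minimal.equiv m) dτ }

yamanouchi-hasDes : Yamanouchi σ → Σ (List ℕ) (HasDes σ)
yamanouchi-hasDes {σ} (nv , _) with weakDesTab σ
yamanouchi-hasDes (MAny.just tt , _) | just T = _ , refl

-- The minimal word lies below `σ`, so the minimality of `σ` puts `σ` below it in turn, and
-- `Minimal.unique` applies.
yamanouchi-unique : {r : Red ρ} (m : Minimal r) → Yamanouchi σ → σ ∼ ρ → σ ≡ Minimal.word m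
yamanouchi-unique m y σ∼ρ with yamanouchi-hasDes y
... | ν , d with proj₂ y (Minimal.word m) (Minimal.equiv m ◅◅ ∼-sym σ∼ρ , Minimal.comp m , ν , Minimal.hasDes m , d , Minimal.below m σ∼ρ d)
... | _ , μ , ν′ , dσ , dm , le with trans (sym dm) (Minimal.hasDes m)
... | refl = Minimal.unique m σ∼ρ dσ le

yamanouchi-rows : ∀ {α} (r : Red ρ) → Yamanouchi σ → σ ∼ ρ → HasDes σ α → ∀ i → rowLen α i ≡ ht r i
yamanouchi-rows r y σ∼ρ d with yamanouchi-unique (minimal r) y σ∼ρ
... | refl with trans (sym d) (Minimal.hasDes (minimal r))
... | refl = Minimal.rows (minimal r)

inDiagP⇒ : (r : Red ρ) → InDiagP ρ i c → 1 ≤ c × c ≤ ht r i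
inDiagP⇒ {i = i} r (σ , α , σ∼ρ , y , d , 1≤c , c≤) = 1≤c , ≤-trans c≤ (≤-reflexive (yamanouchi-rows r y σ∼ρ d i))

inDiagP⇐ : (r : Red ρ) → 1 ≤ c → c ≤ ht r i → InDiagP ρ i c
inDiagP⇐ {i = i} r 1≤c c≤ =
  word , comp , equiv , minimal-Yamanouchi (minimal r) , hasDes , 1≤c , ≤-trans c≤ (≤-reflexive (sym (rows i)))
  where open Minimal (minimal r)

-- Key tableaux and chains of diagrams

private
  variable
    Q Q′ : List (List ℕ)
    H H′ : ℕ → ℕ → ℕ
    α : List ℕ

-- Q represents the decreasing chain of diagrams H: the boxes of H j are those
-- with entry greater than j.
record Rep (Q : List (List ℕ)) (H : ℕ → ℕ → ℕ) : Set where
  field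
    to   : ∀ {r c j x} → entry Q r c ≡ just x → j < x → c ≤ H j r
    from : ∀ {r c j} → 1 ≤ c → c ≤ H j r → Σ ℕ λ x → entry Q r c ≡ just x × j < x

entry-col : ∀ Q r c → entry Q r c ≡ just x → 1 ≤ c
entry-col Q (suc r) (suc c) eq = s≤s z≤n

just-injective : {A : Set} {x y : A} → just x ≡ just y → x ≡ y
just-injective refl = refl

entry-functional : ∀ Q r c → entry Q r c ≡ just x → entry Q r c ≡ just y → x ≡ y
entry-functional Q r c p q = just-injective (trans (sym p) q)

rep-from : Rep Q H → ∀ {r c} → entry Q r c ≡ just x → c ≤ H j r → j < x
rep-from {Q = Q} {j = j} rep {r} {c} eq le with Rep.from rep (entry-col Q r c eq) le
... | y , eq′ , lt = subst (j <_) (entry-functional Q r c eq′ eq) lt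

rep-unique : Rep Q H → Rep Q H′ → ∀ j r → H j r ≡ H′ j r
rep-unique rep rep′ j r = ≤-antisym (le rep rep′) (le rep′ rep)
  where
  le : ∀ {H H′} → Rep Q H → Rep Q H′ → H j r ≤ H′ j r
  le {Q} {H} {H′} p q with H j r in eq
  ... | zero  = z≤n
  ... | suc c with Rep.from p (s≤s z≤n) (≤-reflexive (sym eq))
  ...   | x , en , lt = Rep.to q en lt

rep-resp : (∀ j r → H j r ≡ H′ j r) → Rep Q H → Rep Q H′
rep-resp eq p = record
  { to   = λ {r} {c} {j} en lt → subst (c ≤_) (eq j r) (Rep.to p en lt)
  ; from = λ {r} {c} {j} 1≤c le → Rep.from p 1≤c (subst (c ≤_) (sym (eq j r)) le)
  }

rep-entry : Rep Q H → Rep Q′ H → ∀ {r c} → entry Q r c ≡ just x → entry Q′ r c ≡ just y → x ≡ y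
rep-entry {x = x} {y} p q {r} {c} en en′ with <-cmp x y
... | tri≈ _ eq _ = eq
... | tri< x<y _ _ = ⊥-elim (<-irrefl refl (rep-from p {r} {c} en (Rep.to q {r} {c} en′ x<y)))
... | tri> _ _ y<x = ⊥-elim (<-irrefl refl (rep-from q {r} {c} en′ (Rep.to p {r} {c} en y<x)))

rep-box : Rep Q H → ∀ {r c} → entry Q r c ≡ just (suc j) → H (suc j) r < c × c ≤ H j r
rep-box p en = ≰⇒> (λ le → <-irrefl refl (rep-from p en le)) , Rep.to p en (n<1+n _)

rep-box⁻ : Rep Q H → ∀ {r c} → H (suc j) r < c → c ≤ H j r → entry Q r c ≡ just (suc j)
rep-box⁻ {j = j} p lt le with Rep.from p (≤-<-trans z≤n lt) le
... | x , en , j<x with m≤n⇒m<n∨m≡n j<x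
...   | inj₂ refl = en
...   | inj₁ sj<x = ⊥-elim (<⇒≱ lt (Rep.to p en sj<x))

rep-KeyTableau : Rep Q H → PositiveEntries Q → (∀ j → Strip (H (suc j)) (H j)) → KeyTableau Q
rep-KeyTableau {Q} {H} p pos st = rows , columns , condition
  where
  rows : ∀ r c x y → entry Q r c ≡ just x → entry Q r (suc c) ≡ just y → y ≤ x
  rows r c x y en en′ = ≮⇒≥ λ x<y →
    <-irrefl refl (rep-from p {r} {c} en (≤-trans (n≤1+n c) (Rep.to p {r} {suc c} en′ x<y)))
  columns : ∀ i k j x → i < k → entry Q i j ≡ just x → entry Q k j ≡ just x → ⊥
  columns i k j zero    i<k en en′ = <-irrefl refl (pos i j 0 en)
  columns i k j (suc n) i<k en en′ = <⇒≢ i<k (Strip.one (st n) (proj₁ (rep-box p en)) (proj₂ (rep-box p en))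
                                              (proj₁ (rep-box p en′)) (proj₂ (rep-box p en′)))
  condition : ∀ i k j x y → i < k → entry Q i j ≡ just x → entry Q k j ≡ just y → y < x →
    Σ ℕ λ z → entry Q i (suc j) ≡ just z × y < z
  condition i k j x zero    i<k en en′ y<x = ⊥-elim (<-irrefl refl (pos k j 0 en′))
  condition i k j x (suc n) i<k en en′ y<x = Rep.from p (s≤s z≤n)
    (Strip.cond (st n) i<k (proj₁ (rep-box p en′)) (proj₂ (rep-box p en′)) (Rep.to p en y<x))

rep-strip : Rep Q H → KeyTableau Q → ∀ j → Strip (H (suc j)) (H j)
rep-strip {Q} {H} p (_ , columns , condition) j = record { sub = sub ; one = one ; cond = cond }
  where
  sub : ∀ i → H (suc j) i ≤ H j i
  sub i with H (suc j) i in eq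
  ... | zero  = z≤n
  ... | suc c with Rep.from p {r = i} (s≤s z≤n) (≤-reflexive (sym eq))
  ...   | x , en , lt = Rep.to p en (<-trans (n<1+n j) lt)
  one : ∀ {i k c} → H (suc j) i < c → c ≤ H j i → H (suc j) k < c → c ≤ H j k → i ≡ k
  one {i} {k} {c} h₁ h₂ h₃ h₄ with <-cmp i k
  ... | tri≈ _ eq _  = eq
  ... | tri< i<k _ _ = ⊥-elim (columns i k c (suc j) i<k (rep-box⁻ p h₁ h₂) (rep-box⁻ p h₃ h₄))
  ... | tri> _ _ k<i = ⊥-elim (columns k i c (suc j) k<i (rep-box⁻ p h₃ h₄) (rep-box⁻ p h₁ h₂))
  cond : ∀ {i k c} → i < k → H (suc j) k < c → c ≤ H j k → c ≤ H (suc j) i → c < H (suc j) i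
  cond {i} {k} {c} i<k h₁ h₂ h₃ with Rep.from p (≤-<-trans z≤n h₁) h₃
  ... | x , en , lt with condition i k c x (suc j) i<k en (rep-box⁻ p h₁ h₂) lt
  ...   | z , en′ , lt′ = Rep.to p en′ lt′

rowOf : List (List ℕ) → ℕ → List ℕ
rowOf Q zero    = []
rowOf Q (suc r) = fromMaybe [] (nth Q r)

entry-row : ∀ Q r c → entry Q r (suc c) ≡ nth (rowOf Q r) c
entry-row Q zero    c = refl
entry-row Q (suc r) c with nth Q r
... | just w  = refl
... | nothing = refl

rowLen-shape : ∀ Q r → rowLen (shape Q) r ≡ length (rowOf Q r)
rowLen-shape Q       zero          = refl
rowLen-shape []      (suc r)       = refl
rowLen-shape (w ∷ Q) (suc zero)    = refl
rowLen-shape (w ∷ Q) (suc (suc r)) = rowLen-shape Q (suc r)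

nth-< : ∀ (w : List ℕ) i → i < length w → Σ ℕ λ x → nth w i ≡ just x
nth-< (x ∷ w) zero    _        = x , refl
nth-< (x ∷ w) (suc i) (s≤s lt) = nth-< w i lt

nth-<⁻ : ∀ (w : List ℕ) i → nth w i ≡ just x → i < length w
nth-<⁻ (x ∷ w) zero    _  = s≤s z≤n
nth-<⁻ (x ∷ w) (suc i) eq = s≤s (nth-<⁻ w i eq)

nth-∈ : {A : Set} {x : A} (w : List A) → ∀ i → nth w i ≡ just x → x ∈ w
nth-∈ (x ∷ w) zero    refl = here refl
nth-∈ (x ∷ w) (suc i) eq   = there (nth-∈ w i eq)

entry-exists : ∀ Q r c → 1 ≤ c → c ≤ rowLen (shape Q) r → Σ ℕ λ x → entry Q r c ≡ just x
entry-exists Q r (suc c) _ le with nth-< (rowOf Q r) c (≤-trans le (≤-reflexive (rowLen-shape Q r)))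
... | x , eq = x , trans (entry-row Q r c) eq

entry-exists⁻ : ∀ Q r c → entry Q r c ≡ just x → c ≤ rowLen (shape Q) r
entry-exists⁻ Q zero    zero    ()
entry-exists⁻ Q zero    (suc c) ()
entry-exists⁻ Q (suc r) (suc c) eq =
  ≤-trans (nth-<⁻ (rowOf Q (suc r)) c (trans (sym (entry-row Q (suc r) c)) eq)) (≤-reflexive (sym (rowLen-shape Q (suc r))))

nth-ext : ∀ (v w : List ℕ) → length v ≡ length w → (∀ i {x y} → nth v i ≡ just x → nth w i ≡ just y → x ≡ y) → v ≡ w
nth-ext []      []      _  _  = refl
nth-ext (x ∷ v) (y ∷ w) len eq = cong₂ _∷_ (eq 0 refl refl) (nth-ext v w (suc-injective len) (λ i → eq (suc i)))

tableau-ext : ∀ Q Q′ → shape Q ≡ shape Q′ →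
  (∀ r c {x y} → entry Q r c ≡ just x → entry Q′ r c ≡ just y → x ≡ y) → Q ≡ Q′
tableau-ext []      []        _  _  = refl
tableau-ext (v ∷ Q) (w ∷ Q′) sh eq = cong₂ _∷_
  (nth-ext v w (∷-injectiveˡ sh) (λ i → eq 1 (suc i)))
  (tableau-ext Q Q′ (∷-injectiveʳ sh) λ { (suc r) (suc c) → eq (suc (suc r)) (suc c) ; zero _ () ; (suc _) zero () })

-- Only the initial stretch of entries above `j` is counted; in a weakly decreasing row these are
-- all such entries.
count : ℕ → List ℕ → ℕ
count j []      = 0
count j (x ∷ w) with j <? x
... | yes _ = suc (count j w)
... | no _  = 0

Decreasing : List ℕ → Set
Decreasing w = ∀ i {x y} → nth w i ≡ just x → nth w (suc i) ≡ just y → y ≤ x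

decreasing-head : ∀ w → Decreasing (x ∷ w) → ∀ i → nth w i ≡ just y → y ≤ x
decreasing-head (z ∷ w) d zero    refl = d 0 refl refl
decreasing-head (z ∷ w) d (suc i) eq   =
  ≤-trans (decreasing-head w (λ i → d (suc i)) i eq) (d 0 refl refl)

count-to : ∀ w → Decreasing w → ∀ i → nth w i ≡ just x → j < x → i < count j w
count-to {j = j} (y ∷ w) d i eq lt with j <? y
count-to (y ∷ w) d zero    eq   lt | yes _ = s≤s z≤n
count-to (y ∷ w) d (suc i) eq   lt | yes _ = s≤s (count-to w (λ i → d (suc i)) i eq lt)
count-to (y ∷ w) d zero    refl lt | no ≮  = ⊥-elim (≮ lt)
count-to (y ∷ w) d (suc i) eq   lt | no ≮  = ⊥-elim (≮ (<-≤-trans lt (decreasing-head w d i eq)))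

count-from : ∀ w i → i < count j w → Σ ℕ λ x → nth w i ≡ just x × j < x
count-from {j} (y ∷ w) i lt with j <? y
count-from (y ∷ w) zero    lt       | yes j<y = y , refl , j<y
count-from (y ∷ w) (suc i) (s≤s lt) | yes _   = count-from w i lt

count-all : ∀ w → (∀ i {x} → nth w i ≡ just x → j < x) → count j w ≡ length w
count-all []      _   = refl
count-all {j} (y ∷ w) all with j <? y
... | yes _ = cong suc (count-all w (λ i → all (suc i)))
... | no ≮  = ⊥-elim (≮ (all 0 refl))

chain : List (List ℕ) → ℕ → ℕ → ℕ
chain Q j r = count j (rowOf Q r)

chain-Rep : KeyTableau Q → Rep Q (chain Q)
chain-Rep {Q} (rows , _) = record { to = λ {r} {c} → to {r} {c} ; from = λ {r} → from {r} }
  where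
  to : ∀ {r c j x} → entry Q r c ≡ just x → j < x → c ≤ chain Q j r
  to {suc r} {suc c} en lt = count-to (rowOf Q (suc r))
    (λ i p q → rows (suc r) (suc i) _ _ (trans (entry-row Q (suc r) i) p) (trans (entry-row Q (suc r) (suc i)) q))
    c (trans (sym (entry-row Q (suc r) c)) en) lt
  from : ∀ {r c j} → 1 ≤ c → c ≤ chain Q j r → Σ ℕ λ x → entry Q r c ≡ just x × j < x
  from {r} {suc c} _ le with count-from (rowOf Q r) c le
  ... | x , eq , lt = x , trans (entry-row Q r c) eq , lt

chain-0 : ∀ Q → PositiveEntries Q → ∀ r → chain Q 0 r ≡ rowLen (shape Q) r
chain-0 Q pos r = trans (count-all (rowOf Q r) λ i {x} eq → pos r (suc i) x (trans (entry-row Q r i) eq))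
  (sym (rowLen-shape Q r))

-- The sum of all entries is a crude bound for each of them; it serves as the length of the chain.
chain-end : ∀ Q j r → sum (concat Q) ≤ j → chain Q j r ≡ 0
chain-end Q j r le with chain Q j r in eq
... | zero  = refl
... | suc _ with count-from (rowOf Q r) 0 (subst (0 <_) (sym eq) (s≤s z≤n))
...   | x , en , j<x = ⊥-elim (<⇒≱ j<x (≤-trans (∈⇒≤sum (∈-concat r (nth-∈ (rowOf Q r) 0 en))) le))
  where
  ∈-concat : ∀ r → x ∈ rowOf Q r → x ∈ concat Q
  ∈-concat (suc r) p with nth Q r in eq
  ... | just w = ∈-concat⁺′ p (nth-∈ Q r eq)

tabulate : (ℕ → ℕ → ℕ) → List ℕ → List (List ℕ)
tabulate lab []      = []
tabulate lab (n ∷ α) = applyUpTo (lab 0) n ∷ tabulate (lab ∘ suc) α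

tabulate-shape : ∀ lab α → shape (tabulate lab α) ≡ α
tabulate-shape lab []      = refl
tabulate-shape lab (n ∷ α) = cong₂ _∷_ (length-applyUpTo (lab 0) n) (tabulate-shape (lab ∘ suc) α)

tabulate-entry : ∀ lab α r c → entry (tabulate lab α) (suc r) (suc c) ≡ just x → x ≡ lab r c
tabulate-entry lab (n ∷ α) zero    c eq = nth-applyUpTo (lab 0) n c eq
tabulate-entry lab (n ∷ α) (suc r) c eq = tabulate-entry (lab ∘ suc) α r c eq

-- The greatest `suc j` up to `n` for which the box lies in `H j`, or 0 if there is none. For a
-- decreasing chain this is the last step at which the box is still present, its entry in the
-- tableau.
label : (ℕ → ℕ → ℕ) → ℕ → ℕ → ℕ → ℕ
label H zero    r c = 0
label H (suc n) r c with c ≤? H n r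
... | yes _ = suc n
... | no _  = label H n r c

label-to : (∀ {i j} → i ≤ j → ∀ r → H j r ≤ H i r) → ∀ n r c → j < label H n r c → c ≤ H j r
label-to {H} anti (suc n) r c lt with c ≤? H n r
... | yes le = ≤-trans le (anti (≤-pred lt) r)
... | no _   = label-to anti n r c lt

label-from : ∀ n r c → c ≤ H j r → j < n → j < label H n r c
label-from {H} {j} (suc n) r c le lt with c ≤? H n r
... | yes _ = lt
... | no ≰  = label-from n r c le (≤∧≢⇒< (≤-pred lt) λ { refl → ≰ le })

tabulate-Rep : ∀ n → (∀ {i j} → i ≤ j → ∀ r → H j r ≤ H i r) → (∀ {j} → n ≤ j → ∀ r → H j r ≡ 0) →
  (∀ r → rowLen α r ≡ H 0 r) → Rep (tabulate (λ r c → label H n (suc r) (suc c)) α) H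
tabulate-Rep {H} {α} n anti end rows = record { to = to ; from = from }
  where
  lab : ℕ → ℕ → ℕ
  lab r c = label H n (suc r) (suc c)
  to : ∀ {r c j x} → entry (tabulate lab α) r c ≡ just x → j < x → c ≤ H j r
  to {suc r} {suc c} en lt with tabulate-entry lab α r c en
  ... | refl = label-to anti n (suc r) (suc c) lt
  from : ∀ {r c j} → 1 ≤ c → c ≤ H j r → Σ ℕ λ x → entry (tabulate lab α) r c ≡ just x × j < x
  from {r} {c} {j} 1≤c le with n ≤? j
  ... | yes n≤j = ⊥-elim (<⇒≱ 1≤c (≤-trans le (≤-reflexive (end n≤j r))))
  ... | no n≰j with entry-exists (tabulate lab α) r c 1≤c (≤-trans le (≤-trans (anti z≤n r)
                     (≤-reflexive (trans (sym (rows r)) (cong (λ α → rowLen α r) (sym (tabulate-shape lab α)))))))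
  from {suc r} {suc c} 1≤c le | no n≰j | x , en with tabulate-entry lab α r c en
  ... | refl = x , en , label-from n (suc r) (suc c) le (≰⇒> n≰j)

rep-positive : Rep Q H → (∀ r → rowLen (shape Q) r ≡ H 0 r) → PositiveEntries Q
rep-positive {Q} p rows r c x en = rep-from p en (≤-trans (entry-exists⁻ Q r c en) (≤-reflexive (rows r)))

-- The recording tableau and its flag

module _ {fs : List (List ℕ)} (s : Red (factWord fs)) (incs : All Increasing fs) where

  -- The recording tableau is specified by the single step at which a box appears. Since the
  -- diagrams form a chain, this step is a threshold: the box is present exactly for smaller
  -- indices.
  isQhat⇒Rep : PositiveEntries Q → (∀ r → rowLen α r ≡ ht s r) → IsQhat fs α Q → Rep Q (heights fs s)
  isQhat⇒Rep {Q} {α} pos rows (sh , spec) = record { to = to ; from = from }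
    where
    to : ∀ {r c j x} → entry Q r c ≡ just x → j < x → c ≤ heights fs s j r
    to {r} {c} {j} {suc x} en (s≤s j≤x) =
      ≤-trans (proj₂ (inDiagP⇒ (Red-drop fs s x) (proj₁ (Equivalence.to (spec r c (suc x) en x) refl))))
        (heights-antitone incs s j≤x r)
    from : ∀ {r c j} → 1 ≤ c → c ≤ heights fs s j r → Σ ℕ λ x → entry Q r c ≡ just x × j < x
    from {r} {c} {j} 1≤c le with entry-exists Q r c 1≤c (≤-trans le (≤-trans (heights-antitone {i = 0} {j} incs s z≤n r)
                     (≤-reflexive (trans (sym (rows r)) (cong (λ α → rowLen α r) (sym sh))))))
    ... | zero , en = ⊥-elim (<-irrefl refl (pos r c 0 en))
    ... | suc x , en with suc x ≤? j
    ...   | no ≰    = suc x , en , ≰⇒> ≰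
    ...   | yes x<j = ⊥-elim (proj₂ (Equivalence.to (spec r c (suc x) en x) refl)
        (inDiagP⇐ (Red-drop fs s (suc x)) 1≤c (≤-trans le (heights-antitone incs s x<j r))))

  rep⇒isQhat : shape Q ≡ α → Rep Q (heights fs s) → IsQhat fs α Q
  rep⇒isQhat {Q} sh rep = sh , λ r c x en j → mk⇔ (λ { refl → to r c j en }) (from r c x j en)
    where
    to : ∀ r c j → entry Q r c ≡ just (suc j) → InDiagP (prefixWord fs j) r c × ¬ InDiagP (prefixWord fs (suc j)) r c
    to r c j en = inDiagP⇐ {i = r} (Red-drop fs s j) (entry-col Q r c en) (proj₂ (rep-box rep {r} {c} en)) ,
      λ d → <⇒≱ (proj₁ (rep-box rep {r} {c} en)) (proj₂ (inDiagP⇒ {i = r} (Red-drop fs s (suc j)) d))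
    from : ∀ r c x j → entry Q r c ≡ just x →
      InDiagP (prefixWord fs j) r c × ¬ InDiagP (prefixWord fs (suc j)) r c → x ≡ suc j
    from r c x j en (d , ¬d) = entry-functional Q r c en
      (rep-box⁻ rep {r} {c} (≰⇒> λ le → ¬d (inDiagP⇐ {i = r} (Red-drop fs s (suc j)) (entry-col Q r c en) le))
        (proj₂ (inDiagP⇒ {i = r} (Red-drop fs s j) d)))

  -- An entry `suc j` in row `r` makes `r` a letter of a factor with index at least `suc j`. The
  -- first letter of this factor is at most `r`, and `φ` is monotone.
  flagged⇒tableau : ∀ {φ} → Flag φ → Flagged φ fs → PositiveEntries Q → Rep Q (heights fs s) → FlaggedTab φ Q
  flagged⇒tableau {Q} {φ} (mono , _) fl pos rep r c zero    en = z≤n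
  flagged⇒tableau {Q} {φ} (mono , _) fl pos rep r c (suc j) en with letter-factor fs incs j (ht-letter⁻ (Red-drop fs s j)
                         (<-≤-trans (entry-col Q r c en) (proj₂ (rep-box rep en))))
  ... | i , y , ys , j≤i , eq , y≤r , y∈ =
    ≤-trans (s≤s j≤i) (≤-trans (fl i y ys eq) (mono y r (All.lookup (proj₁ (Red-drop fs s j)) y∈) y≤r))

  -- Below or at the first letter `x` of the factor there is a nonempty row `k`. Its first box is
  -- already present, so its entry exceeds `j`, and the flag at `k` bounds the flag at `x` from
  -- below.
  tableau⇒flagged : ∀ {φ} → Flag φ → FlaggedTab φ Q → Rep Q (heights fs s) → Flagged φ fs
  tableau⇒flagged {φ = φ} (mono , _) fl rep j x xs eq with ht-letter (Red-drop fs s j) (nth-prefixWord fs j eq (here refl))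
    where
    nth-prefixWord : ∀ fs j {w} → nth fs j ≡ just w → y ∈ w → y ∈ prefixWord fs j
    nth-prefixWord (w ∷ fs) zero    refl p = subst (_ ∈_) (sym (factWord-∷ w fs)) (∈-++⁺ʳ (factWord fs) p)
    nth-prefixWord (w ∷ fs) (suc j) eq   p = nth-prefixWord fs j eq p
  ... | k , k≤x , lt with Rep.from rep {r = k} ≤-refl lt
  ...   | z , en , j<z = ≤-trans j<z (≤-trans (fl k 1 z en) (mono k x (ht-row-pos (Red-drop fs s j) lt) k≤x))

-- The bijection

module _ (u : List ℕ) (φ : ℕ → ℕ) (flag : Flag φ) where

  insertion : ∀ fs → RFC u φ fs → Σ (List ℕ × List ℕ × List (List ℕ)) λ b →
    Target u φ b × WeakEG fs b × (∀ b′ → Target u φ b′ → WeakEG fs b′ → b′ ≡ b)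
  insertion fs (incs , red , fl , _) =
    (comp , word , Q₀) ,
    ((Reduced-∼ u (∼-sym equiv) red , minimal-Yamanouchi (minimal s) , hasDes) ,
      shape₀ , pos₀ , rep-KeyTableau rep₀ pos₀ (heights-strip incs s) , flagged⇒tableau s incs flag fl pos₀ rep₀) ,
    (equiv , minimal-Yamanouchi (minimal s) , hasDes , rep⇒isQhat s incs shape₀ rep₀) ,
    unique₀
    where
    s : Red (factWord fs)
    s = Reduced⇒Red u red
    open Minimal (minimal s)
    -- All diagrams from index `length fs` on are empty, so larger labels cannot occur.
    Q₀ = tabulate (λ r c → label (heights fs s) (length fs) (suc r) (suc c)) comp
    shape₀ : shape Q₀ ≡ comp
    shape₀ = tabulate-shape _ comp
    rep₀ : Rep Q₀ (heights fs s)
    rep₀ = tabulate-Rep (length fs) (heights-antitone incs s) (heights-end fs s) rows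
    pos₀ : PositiveEntries Q₀
    pos₀ = rep-positive rep₀ λ r → trans (cong (λ α → rowLen α r) shape₀) (rows r)
    unique₀ : ∀ b′ → Target u φ b′ → WeakEG fs b′ → b′ ≡ (comp , word , Q₀)
    unique₀ (α , σ , Q) (_ , sh , pos , _) (σ∼ , y , d , q) with yamanouchi-unique (minimal s) y σ∼
    ... | refl with trans (sym d) hasDes
    ...   | refl = cong (λ Q → comp , word , Q) (tableau-ext Q Q₀ (trans sh (sym shape₀))
                     λ r c → rep-entry (isQhat⇒Rep s incs pos rows q) rep₀ {r} {c})

  insertion⁻¹ : ∀ b → Target u φ b → Σ (List (List ℕ)) λ fs →
    RFC u φ fs × WeakEG fs b × (∀ fs′ → RFC u φ fs′ → WeakEG fs′ b → fs′ ≡ fs)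
  insertion⁻¹ (α , σ , Q) ((red , y , d) , sh , pos , kt , fl) =
    fs₁ , (incs , Reduced-∼ u σ∼fs₁ red , tableau⇒flagged s incs flag fl rep , trim-noTrailing fs₀) ,
    (σ∼fs₁ , y , d , rep⇒isQhat s incs sh rep) , unique₀
    where
    r₀ : Red σ
    r₀ = Reduced⇒Red u red
    rows : ∀ i → rowLen α i ≡ ht r₀ i
    rows = yamanouchi-rows r₀ y ε d
    start : ∀ i → ht r₀ i ≡ chain Q 0 i
    start i = sym (trans (chain-0 Q pos i) (trans (cong (λ α → rowLen α i) sh) (rows i)))
    ex = chain-exists (sum (concat Q)) r₀ start (rep-strip (chain-Rep kt) kt) (chain-end Q)
    fs₀ = proj₁ ex
    fs₁ = trim fs₀
    incs : All Increasing fs₁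
    incs = trim-All (proj₁ (proj₂ (proj₂ ex)))
    σ∼fs₁ : σ ∼ factWord fs₁
    σ∼fs₁ = ∼-sym (proj₁ (proj₂ (proj₂ (proj₂ ex)))) ◅◅ ∼-reflexive (sym (prefixWord-trim fs₀ 0))
    s : Red (factWord fs₁)
    s = Red-∼ σ∼fs₁ r₀
    heights≡ : ∀ j i → chain Q j i ≡ heights fs₁ s j i
    heights≡ j i = sym (trans
      (ht-cong (∼-reflexive (prefixWord-trim fs₀ j)) (Red-drop fs₁ s j) (Red-drop fs₀ (proj₁ (proj₂ ex)) j) i)
      (proj₂ (proj₂ (proj₂ (proj₂ ex))) j i))
    rep : Rep Q (heights fs₁ s)
    rep = rep-resp heights≡ (chain-Rep kt)
    unique₀ : ∀ fs′ → RFC u φ fs′ → WeakEG fs′ (α , σ , Q) → fs′ ≡ fs₁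
    unique₀ fs′ (incs′ , red′ , _ , noTrail) (σ∼ , _ , _ , q) = begin
      fs′        ≡⟨ noTrailing-trim fs′ noTrail ⟨
      trim fs′   ≡⟨ chain-unique fs′ fs₁ s′ s incs′ incs (∼-sym σ∼ ◅◅ σ∼fs₁) (rep-unique rep′ rep) ⟩
      trim fs₁    ≡⟨ noTrailing-trim fs₁ (trim-noTrailing fs₀) ⟩
      fs₁         ∎
      where
      open ≡-Reasoning
      s′ : Red (factWord fs′)
      s′ = Reduced⇒Red u red′
      rep′ : Rep Q (heights fs′ s′)
      rep′ = isQhat⇒Rep s′ incs′ pos (λ i → trans (rows i) (ht-cong σ∼ r₀ s′ i)) q

theorem3p29 : (u : List ℕ) → Word u → (φ : ℕ → ℕ) → Flag φ →
    IsBijectionGraph (RFC u φ) (Target u φ) WeakEG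
theorem3p29 u _ φ flag = insertion u φ flag , insertion⁻¹ u φ flag
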